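{- Let $n\ge1$ and let $X$ be a $(\mathbb{Z}/n\mathbb{Z})$-circulant, i.e. a graph of order $n$ whose Hermitian adjacency matrix $A\in\mathbb{C}^{n\times n}$ is a circulant matrix. If the eigenvalues of $A$ are all distinct ($A$ has $n$ distinct eigenvalues), then $X$ has average uniform mixing, that is, $\widehat{M}_X=\frac1nJ_n$.
   Context: A matrix $A$ indexed by $\mathbb{Z}/n\mathbb{Z}$ is circulant if $A_{j,k}$ depends only on $k-j$ modulo $n$. Complex edge weights are allowed as long as $A$ is Hermitian. For a graph $X$ of order $n$ with Hermitian adjacency matrix $A$, let $U_X(t)=e^{ -itA}$ and $M_X(t)=U_X(t)\circ\overline{U_X(t)}$ (entrywise product). The average mixing matrix is $\widehat{M}_X=\lim_{T\to\infty}\frac1T\int_0^TM_X(t)\,dt$. $J_n$ is the $n\times n$ all-one matrix. -}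

module Defs where

open import Level using (0ℓ)
open import Algebra.Bundles.Raw using (RawMonoid)
import Algebra.Definitions.RawMonoid as RawMonoidDefs
open import Data.Nat as ℕ using (ℕ; zero; suc; _!)
import Data.Nat.Properties as ℕ
open import Data.Integer as ℤ using (+_; 1ℤ)
import Data.Integer.Divisibility as ℤ
open import Data.Rational as ℚ using (ℚ; 0ℚ; 1ℚ; ½)
import Data.Rational.Properties as ℚ
open import Data.Rational.Solver using (module +-*-Solver)
open import Data.Fin using (Fin; zero; suc; toℕ; fromℕ; inject₁)
import Data.Fin as Fin
open import Data.Product using (Σ-syntax; ∃-syntax; _×_; _,_)
open import Data.Vec.Functional using (Vector)
open import Relation.Nullary using (yes; no)
open import Relation.Binary.PropositionalEquality
  using (_≡_; _≢_; refl; sym; trans; cong; cong₂; subst; subst₂)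

------------------------------------------------------------------------
-- Rational estimates behind the real operations

module _ where
  open import Data.Rational using (_+_; _-_; _*_; -_; ∣_∣; _<_; _≤_; _⊔_)
  open +-*-Solver

  recip : (p : ℚ) → 0ℚ < p → ℚ
  recip p 0<p = ℚ.1/_ p {{ℚ.>-nonZero 0<p}}

  recip-inverseˡ : ∀ p (0<p : 0ℚ < p) → recip p 0<p * p ≡ 1ℚ
  recip-inverseˡ p 0<p = ℚ.*-inverseˡ p {{ℚ.>-nonZero 0<p}}

  recip-pos : ∀ p (0<p : 0ℚ < p) → 0ℚ < recip p 0<p
  recip-pos p 0<p = ℚ.positive⁻¹ _ {{ℚ.1/pos⇒pos p {{ℚ.positive 0<p}}}}

  *-pos : ∀ {p q} → 0ℚ < p → 0ℚ < q → 0ℚ < p * q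
  *-pos {p} {q} 0<p 0<q =
    ℚ.positive⁻¹ _ {{ℚ.pos*pos⇒pos p {{ℚ.positive 0<p}} q {{ℚ.positive 0<q}}}}

  +-pos : ∀ {p q} → 0ℚ < p → 0ℚ < q → 0ℚ < p + q
  +-pos {p} {q} 0<p 0<q =
    ℚ.positive⁻¹ _ {{ℚ.pos+pos⇒pos p {{ℚ.positive 0<p}} q {{ℚ.positive 0<q}}}}

  ½-pos : ∀ {p} → 0ℚ < p → 0ℚ < ½ * p
  ½-pos = *-pos (ℚ.positive⁻¹ ½)

  ∣-∣-sym : ∀ p q → ∣ p - q ∣ ≡ ∣ q - p ∣
  ∣-∣-sym p q = trans (sym (ℚ.∣-p∣≡∣p∣ (p - q)))
    (cong ∣_∣ (solve 2 (λ p q → :- (p :- q) := q :- p) refl p q))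

  +-close : ∀ {ε} a b c d → ∣ a - b ∣ < ½ * ε → ∣ c - d ∣ < ½ * ε →
            ∣ (a + c) - (b + d) ∣ < ε
  +-close {ε} a b c d p q = begin-strict
    ∣ (a + c) - (b + d) ∣    ≡⟨ cong ∣_∣ (solve 4 (λ a b c d →
                                 (a :+ c) :- (b :+ d) := (a :- b) :+ (c :- d)) refl a b c d) ⟩
    ∣ (a - b) + (c - d) ∣    ≤⟨ ℚ.∣p+q∣≤∣p∣+∣q∣ (a - b) (c - d) ⟩
    ∣ a - b ∣ + ∣ c - d ∣    <⟨ ℚ.+-mono-< p q ⟩
    ½ * ε + ½ * ε            ≡⟨ sym (ℚ.*-distribʳ-+ ε ½ ½) ⟩
    1ℚ * ε                   ≡⟨ ℚ.*-identityˡ ε ⟩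
    ε                        ∎
    where open ℚ.≤-Reasoning

  neg-close : ∀ {ε} a b → ∣ a - b ∣ < ε → ∣ - a - - b ∣ < ε
  neg-close {ε} a b = subst (_< ε) (trans (∣-∣-sym a b)
    (cong ∣_∣ (solve 2 (λ a b → b :- a := :- a :- :- b) refl a b)))

  *-close : ∀ {δ B C} a b c d → 0ℚ < B → 0ℚ < C → ∣ a ∣ < B → ∣ d ∣ < C →
            ∣ a - b ∣ < δ → ∣ c - d ∣ < δ → ∣ a * c - b * d ∣ < δ * (B + C)
  *-close {δ} {B} {C} a b c d 0<B 0<C a<B d<C p q = begin-strict
    ∣ a * c - b * d ∣                        ≡⟨ cong ∣_∣ (solve 4 (λ a b c d →
                                                 a :* c :- b :* d := a :* (c :- d) :+ (a :- b) :* d)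
                                                 refl a b c d) ⟩
    ∣ a * (c - d) + (a - b) * d ∣            ≤⟨ ℚ.∣p+q∣≤∣p∣+∣q∣ (a * (c - d)) ((a - b) * d) ⟩
    ∣ a * (c - d) ∣ + ∣ (a - b) * d ∣        ≡⟨ cong₂ _+_ (ℚ.∣p*q∣≡∣p∣*∣q∣ a (c - d))
                                                          (ℚ.∣p*q∣≡∣p∣*∣q∣ (a - b) d) ⟩
    ∣ a ∣ * ∣ c - d ∣ + ∣ a - b ∣ * ∣ d ∣    <⟨ ℚ.+-mono-<
                                                 (*-mono-< a (c - d) 0<B a<B q)
                                                 (*-mono-< (a - b) d (0<δ p) p d<C) ⟩
    B * δ + δ * C                            ≡⟨ solve 3 (λ B C δ →
                                                 B :* δ :+ δ :* C := δ :* (B :+ C)) refl B C δ ⟩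
    δ * (B + C)                              ∎
    where
    open ℚ.≤-Reasoning
    0<δ : ∀ {δ r} → ∣ r ∣ < δ → 0ℚ < δ
    0<δ {r = r} = ℚ.≤-<-trans (ℚ.0≤∣p∣ r)
    *-mono-< : ∀ {P Q} r s → 0ℚ < P → ∣ r ∣ < P → ∣ s ∣ < Q → ∣ r ∣ * ∣ s ∣ < P * Q
    *-mono-< {P} {Q} r s 0<P r<P s<Q = ℚ.≤-<-trans
      (ℚ.*-monoʳ-≤-nonNeg ∣ s ∣ {{ℚ.∣-∣-nonNeg s}} (ℚ.<⇒≤ r<P))
      (ℚ.*-monoʳ-<-pos P {{ℚ.positive 0<P}} s<Q)

  near⇒bounded : ∀ a b → ∣ a - b ∣ < 1ℚ → ∣ a ∣ < ∣ b ∣ + 1ℚ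
  near⇒bounded a b p = begin-strict
    ∣ a ∣              ≡⟨ cong ∣_∣ (solve 2 (λ a b → a := b :+ (a :- b)) refl a b) ⟩
    ∣ b + (a - b) ∣    ≤⟨ ℚ.∣p+q∣≤∣p∣+∣q∣ b (a - b) ⟩
    ∣ b ∣ + ∣ a - b ∣  <⟨ ℚ.+-monoʳ-< ∣ b ∣ p ⟩
    ∣ b ∣ + 1ℚ         ∎
    where open ℚ.≤-Reasoning

  bound-pos : ∀ b → 0ℚ < ∣ b ∣ + 1ℚ
  bound-pos b = ℚ.+-mono-≤-< (ℚ.0≤∣p∣ b) (ℚ.positive⁻¹ 1ℚ)

  ⊔-pos : ∀ {δ} p → 0ℚ < δ → 0ℚ < p ⊔ δ
  ⊔-pos {δ} p 0<δ = ℚ.<-≤-trans 0<δ (ℚ.p≤q⊔p p δ)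

  recip-close : ∀ {ε δ} a b (0<a : 0ℚ < a) (0<b : 0ℚ < b) →
                0ℚ < ε → 0ℚ < δ → δ ≤ a → δ ≤ b →
                ∣ a - b ∣ < ε * (δ * δ) → ∣ recip a 0<a - recip b 0<b ∣ < ε
  recip-close {ε} {δ} a b 0<a 0<b 0<ε 0<δ δ≤a δ≤b p =
    ℚ.*-cancelʳ-<-nonNeg (a * b) {{0≤ab}} (begin-strict
      ∣ a⁻¹ - b⁻¹ ∣ * (a * b)        ≡⟨ cong (∣ a⁻¹ - b⁻¹ ∣ *_)
                                         (sym (ℚ.0≤p⇒∣p∣≡p (ℚ.<⇒≤ 0<ab))) ⟩
      ∣ a⁻¹ - b⁻¹ ∣ * ∣ a * b ∣      ≡⟨ sym (ℚ.∣p*q∣≡∣p∣*∣q∣ (a⁻¹ - b⁻¹) (a * b)) ⟩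
      ∣ (a⁻¹ - b⁻¹) * (a * b) ∣      ≡⟨ cong ∣_∣ (solve 4 (λ a b x y →
                                         (x :- y) :* (a :* b) := (x :* a) :* b :- (y :* b) :* a)
                                         refl a b a⁻¹ b⁻¹) ⟩
      ∣ a⁻¹ * a * b - b⁻¹ * b * a ∣  ≡⟨ cong₂ (λ x y → ∣ x * b - y * a ∣)
                                         (recip-inverseˡ a 0<a) (recip-inverseˡ b 0<b) ⟩
      ∣ 1ℚ * b - 1ℚ * a ∣            ≡⟨ cong₂ (λ x y → ∣ x - y ∣)
                                         (ℚ.*-identityˡ b) (ℚ.*-identityˡ a) ⟩
      ∣ b - a ∣                      ≡⟨ ∣-∣-sym b a ⟩
      ∣ a - b ∣                      <⟨ p ⟩
      ε * (δ * δ)                    ≤⟨ ℚ.*-monoˡ-≤-nonNeg ε {{nonNeg 0<ε}} δδ≤ab ⟩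
      ε * (a * b)                    ∎)
    where
    open ℚ.≤-Reasoning
    nonNeg : ∀ {q} → 0ℚ < q → ℚ.NonNegative q
    nonNeg 0<q = ℚ.nonNegative (ℚ.<⇒≤ 0<q)
    a⁻¹ = recip a 0<a
    b⁻¹ = recip b 0<b
    0<ab = *-pos 0<a 0<b
    0≤ab = nonNeg 0<ab
    δδ≤ab : δ * δ ≤ a * b
    δδ≤ab = ℚ.≤-trans (ℚ.*-monoˡ-≤-nonNeg δ {{nonNeg 0<δ}} δ≤b)
                      (ℚ.*-monoʳ-≤-nonNeg b {{nonNeg 0<b}} δ≤a)

------------------------------------------------------------------------
-- Real numbers: Cauchy sequences of rationals, with equality _≈ᴿ_

IsCauchy : (ℕ → ℚ) → Set
IsCauchy u = ∀ ε → 0ℚ ℚ.< ε →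
  ∃[ N ] ∀ m n → N ℕ.≤ m → N ℕ.≤ n → ℚ.∣ u m ℚ.- u n ∣ ℚ.< ε

record ℝ : Set where
  constructor mkℝ
  field
    seq    : ℕ → ℚ
    cauchy : IsCauchy seq

open ℝ public

infix  4 _≈ᴿ_ _<ᴿ_ _≤ᴿ_
infixl 6 _+ᴿ_ _-ᴿ_
infixl 7 _*ᴿ_
infix  8 -ᴿ_

_≈ᴿ_ : ℝ → ℝ → Set
x ≈ᴿ y = ∀ ε → 0ℚ ℚ.< ε → ∃[ N ] ∀ n → N ℕ.≤ n → ℚ.∣ seq x n ℚ.- seq y n ∣ ℚ.< ε

_<ᴿ_ : ℝ → ℝ → Set
x <ᴿ y = ∃[ δ ] 0ℚ ℚ.< δ × ∃[ N ] ∀ n → N ℕ.≤ n → seq x n ℚ.+ δ ℚ.≤ seq y n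

_≤ᴿ_ : ℝ → ℝ → Set
x ≤ᴿ y = ∀ ε → 0ℚ ℚ.< ε → ∃[ N ] ∀ n → N ℕ.≤ n → seq x n ℚ.≤ seq y n ℚ.+ ε

abstract
  const-cauchy : ∀ q → IsCauchy (λ _ → q)
  const-cauchy q ε 0<ε =
    0 , λ _ _ _ _ → subst (ℚ._< ε) (cong ℚ.∣_∣ (sym (ℚ.+-inverseʳ q))) 0<ε

  +-cauchy : ∀ x y → IsCauchy (λ n → seq x n ℚ.+ seq y n)
  +-cauchy x y ε 0<ε =
    let (M , hx) = cauchy x (½ ℚ.* ε) (½-pos 0<ε)
        (N , hy) = cauchy y (½ ℚ.* ε) (½-pos 0<ε)
    in M ℕ.⊔ N , λ m n p q →
       +-close (seq x m) (seq x n) (seq y m) (seq y n)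
         (hx m n (ℕ.m⊔n≤o⇒m≤o M N p) (ℕ.m⊔n≤o⇒m≤o M N q))
         (hy m n (ℕ.m⊔n≤o⇒n≤o M N p) (ℕ.m⊔n≤o⇒n≤o M N q))

  neg-cauchy : ∀ x → IsCauchy (λ n → ℚ.- seq x n)
  neg-cauchy x ε 0<ε =
    let (N , hx) = cauchy x ε 0<ε
    in N , λ m n p q → neg-close (seq x m) (seq x n) (hx m n p q)

  eventually-bounded : ∀ x → ∃[ B ] 0ℚ ℚ.< B × ∃[ N ] ∀ n → N ℕ.≤ n → ℚ.∣ seq x n ∣ ℚ.< B
  eventually-bounded x =
    let (N , h) = cauchy x 1ℚ (ℚ.positive⁻¹ 1ℚ)
    in ℚ.∣ seq x N ∣ ℚ.+ 1ℚ , bound-pos (seq x N) , N ,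
       λ n p → near⇒bounded (seq x n) (seq x N) (h n N p ℕ.≤-refl)

  *-cauchy : ∀ x y → IsCauchy (λ n → seq x n ℚ.* seq y n)
  *-cauchy x y ε 0<ε =
    let (B , 0<B , K , bx) = eventually-bounded x
        (C , 0<C , L , by) = eventually-bounded y
        0<B+C = +-pos 0<B 0<C
        r     = recip (B ℚ.+ C) 0<B+C
        δ     = ε ℚ.* r
        0<δ   = *-pos 0<ε (recip-pos (B ℚ.+ C) 0<B+C)
        (M , hx) = cauchy x δ 0<δ
        (N , hy) = cauchy y δ 0<δ
        δ[B+C]≡ε = trans (ℚ.*-assoc ε r (B ℚ.+ C))
          (trans (cong (ε ℚ.*_) (recip-inverseˡ (B ℚ.+ C) 0<B+C)) (ℚ.*-identityʳ ε))
    in (K ℕ.⊔ L) ℕ.⊔ (M ℕ.⊔ N) , λ m n p q →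
       let p₁ = ℕ.m⊔n≤o⇒m≤o (K ℕ.⊔ L) (M ℕ.⊔ N) p
           p₂ = ℕ.m⊔n≤o⇒n≤o (K ℕ.⊔ L) (M ℕ.⊔ N) p
           q₁ = ℕ.m⊔n≤o⇒m≤o (K ℕ.⊔ L) (M ℕ.⊔ N) q
           q₂ = ℕ.m⊔n≤o⇒n≤o (K ℕ.⊔ L) (M ℕ.⊔ N) q
       in subst (ℚ.∣ seq x m ℚ.* seq y m ℚ.- seq x n ℚ.* seq y n ∣ ℚ.<_) δ[B+C]≡ε
            (*-close (seq x m) (seq x n) (seq y m) (seq y n) 0<B 0<C
              (bx m (ℕ.m⊔n≤o⇒m≤o K L p₁)) (by n (ℕ.m⊔n≤o⇒n≤o K L q₁))
              (hx m n (ℕ.m⊔n≤o⇒m≤o M N p₂) (ℕ.m⊔n≤o⇒m≤o M N q₂))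
              (hy m n (ℕ.m⊔n≤o⇒n≤o M N p₂) (ℕ.m⊔n≤o⇒n≤o M N q₂)))

fromℚ : ℚ → ℝ
fromℚ q = mkℝ (λ _ → q) (const-cauchy q)

0ᴿ 1ᴿ : ℝ
0ᴿ = fromℚ 0ℚ
1ᴿ = fromℚ 1ℚ

-ᴿ_ : ℝ → ℝ
-ᴿ x = mkℝ (λ n → ℚ.- seq x n) (neg-cauchy x)

_+ᴿ_ _-ᴿ_ _*ᴿ_ : ℝ → ℝ → ℝ
x +ᴿ y = mkℝ (λ n → seq x n ℚ.+ seq y n) (+-cauchy x y)
x *ᴿ y = mkℝ (λ n → seq x n ℚ.* seq y n) (*-cauchy x y)
x -ᴿ y = x +ᴿ (-ᴿ y)

abstract
  inverse-cauchy : ∀ x {δ} (0<δ : 0ℚ ℚ.< δ) N → (∀ n → N ℕ.≤ n → 0ℚ ℚ.+ δ ℚ.≤ seq x n) →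
                   IsCauchy (λ n → recip (seq x n ℚ.⊔ δ) (⊔-pos (seq x n) 0<δ))
  inverse-cauchy x {δ} 0<δ N h ε 0<ε =
    let (M , hx) = cauchy x (ε ℚ.* (δ ℚ.* δ)) (*-pos 0<ε (*-pos 0<δ 0<δ))
        fix : ∀ n → N ℕ.≤ n → seq x n ℚ.⊔ δ ≡ seq x n
        fix n p = ℚ.p≥q⇒p⊔q≡p (subst (ℚ._≤ seq x n) (ℚ.+-identityˡ δ) (h n p))
    in N ℕ.⊔ M , λ m n p q →
       recip-close (seq x m ℚ.⊔ δ) (seq x n ℚ.⊔ δ)
         (⊔-pos (seq x m) 0<δ) (⊔-pos (seq x n) 0<δ) 0<ε 0<δ
         (ℚ.p≤q⊔p (seq x m) δ) (ℚ.p≤q⊔p (seq x n) δ)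
         (subst₂ (λ a b → ℚ.∣ a ℚ.- b ∣ ℚ.< ε ℚ.* (δ ℚ.* δ))
           (sym (fix m (ℕ.m⊔n≤o⇒m≤o N M p))) (sym (fix n (ℕ.m⊔n≤o⇒m≤o N M q)))
           (hx m n (ℕ.m⊔n≤o⇒n≤o N M p) (ℕ.m⊔n≤o⇒n≤o N M q)))

-- The maximum with δ makes every term invertible; from index N on it
-- changes nothing.
inverse : (x : ℝ) → 0ᴿ <ᴿ x → ℝ
inverse x (δ , 0<δ , N , h) =
  mkℝ (λ n → recip (seq x n ℚ.⊔ δ) (⊔-pos (seq x n) 0<δ)) (inverse-cauchy x 0<δ N h)

------------------------------------------------------------------------
-- Complex numbers

record ℂ : Set where
  constructor _+i_
  field
    re im : ℝ

open ℂ public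

infix  3 _+i_
infix  4 _≈ᶜ_ _#_
infixl 6 _+ᶜ_ _-ᶜ_
infixl 7 _*ᶜ_
infix  8 -ᶜ_

_≈ᶜ_ : ℂ → ℂ → Set
z ≈ᶜ w = re z ≈ᴿ re w × im z ≈ᴿ im w

fromℝ : ℝ → ℂ
fromℝ x = x +i 0ᴿ

0ᶜ 1ᶜ iᶜ : ℂ
0ᶜ = fromℝ 0ᴿ
1ᶜ = fromℝ 1ᴿ
iᶜ = 0ᴿ +i 1ᴿ

-ᶜ_ conj : ℂ → ℂ
-ᶜ z = (-ᴿ re z) +i (-ᴿ im z)
conj z = re z +i (-ᴿ im z)

_+ᶜ_ _-ᶜ_ _*ᶜ_ : ℂ → ℂ → ℂ
z +ᶜ w = (re z +ᴿ re w) +i (im z +ᴿ im w)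
z -ᶜ w = (re z -ᴿ re w) +i (im z -ᴿ im w)
z *ᶜ w = (re z *ᴿ re w -ᴿ im z *ᴿ im w) +i (re z *ᴿ im w +ᴿ im z *ᴿ re w)

normSq : ℂ → ℝ
normSq z = re z *ᴿ re z +ᴿ im z *ᴿ im z

-- Apartness, the constructive form of z ≠ w (classically equivalent to it).
_#_ : ℂ → ℂ → Set
z # w = 0ᴿ <ᴿ normSq (z -ᶜ w)

-- ∣z − w∣ < ε for ε > 0, squared to avoid the square root.
_within_of_ : ℂ → ℝ → ℂ → Set
z within ε of w = normSq (z -ᶜ w) <ᴿ ε *ᴿ ε

+-0-rawMonoid : RawMonoid 0ℓ 0ℓ
+-0-rawMonoid = record { _≈_ = _≈ᶜ_ ; _∙_ = _+ᶜ_ ; ε = 0ᶜ }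

open RawMonoidDefs +-0-rawMonoid public using (sum)

------------------------------------------------------------------------
-- Limits and integrals of complex-valued functions

_⟶_ : (ℕ → ℂ) → ℂ → Set
u ⟶ L = ∀ ε → 0ᴿ <ᴿ ε → ∃[ N ] ∀ n → N ℕ.≤ n → u n within ε of L

LimitAtInfinity : ((T : ℝ) → 0ᴿ <ᴿ T → ℂ) → ℂ → Set
LimitAtInfinity f L =
  ∀ ε → 0ᴿ <ᴿ ε → ∃[ T₀ ] ∀ T (0<T : 0ᴿ <ᴿ T) → T₀ ≤ᴿ T → f T 0<T within ε of L

record TaggedPartition (a b : ℝ) : Set where
  field
    size      : ℕ
    point     : Vector ℝ (suc size)
    tag       : Vector ℝ size
    first     : point zero ≈ᴿ a
    last      : point (fromℕ size) ≈ᴿ b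
    ascending : ∀ i → point (inject₁ i) ≤ᴿ point (suc i)
    point≤tag : ∀ i → point (inject₁ i) ≤ᴿ tag i
    tag≤point : ∀ i → tag i ≤ᴿ point (suc i)

  width : Vector ℝ size
  width i = point (suc i) -ᴿ point (inject₁ i)

open TaggedPartition public

riemannSum : ∀ {a b} → (ℝ → ℂ) → TaggedPartition a b → ℂ
riemannSum f P = sum (λ i → f (tag P i) *ᶜ fromℝ (width P i))

-- I is the Riemann integral of f over [a , b].
IsIntegral : (ℝ → ℂ) → ℝ → ℝ → ℂ → Set
IsIntegral f a b I =
  ∀ ε → 0ᴿ <ᴿ ε → ∃[ δ ] 0ᴿ <ᴿ δ ×
    ((P : TaggedPartition a b) → (∀ i → width P i <ᴿ δ) → riemannSum f P within ε of I)

------------------------------------------------------------------------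
-- Matrices

Matrix : ℕ → Set
Matrix n = Vector (Vector ℂ n) n

infix  4 _≈ᴹ_
infixl 6 _+ᴹ_
infixl 7 _*ᴹ_
infixr 7 _•ᴹ_
infixr 8 _^ᴹ_

_≈ᴹ_ : ∀ {n} → Matrix n → Matrix n → Set
A ≈ᴹ B = ∀ j k → A j k ≈ᶜ B j k

𝟙 𝟘 J : ∀ n → Matrix n
𝟙 n j k with j Fin.≟ k
... | yes _ = 1ᶜ
... | no  _ = 0ᶜ
𝟘 n _ _ = 0ᶜ
J n _ _ = 1ᶜ

_+ᴹ_ _*ᴹ_ _∘ᴹ_ : ∀ {n} → Matrix n → Matrix n → Matrix n
(A +ᴹ B) j k = A j k +ᶜ B j k
(A *ᴹ B) j k = sum (λ l → A j l *ᶜ B l k)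
(A ∘ᴹ B) j k = A j k *ᶜ B j k

_•ᴹ_ : ∀ {n} → ℂ → Matrix n → Matrix n
(c •ᴹ A) j k = c *ᶜ A j k

conjᴹ _ᴴ : ∀ {n} → Matrix n → Matrix n
conjᴹ A j k = conj (A j k)
(A ᴴ) j k = conj (A k j)

_*ᵛ_ : ∀ {n} → Matrix n → Vector ℂ n → Vector ℂ n
(A *ᵛ v) j = sum (λ k → A j k *ᶜ v k)

_^ᴹ_ : ∀ {n} → Matrix n → ℕ → Matrix n
_^ᴹ_ {n} B zero = 𝟙 n
B ^ᴹ suc m = B *ᴹ B ^ᴹ m

1/_! : ℕ → ℂ
1/ m ! = fromℝ (fromℚ (ℚ._/_ 1ℤ (m !) {{ℕ._!≢0 m}}))

expPartialSum : ∀ {n} → Matrix n → ℕ → Matrix n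
expPartialSum {n} B zero = 𝟘 n
expPartialSum B (suc m) = expPartialSum B m +ᴹ 1/ m ! •ᴹ B ^ᴹ m

-- E is the matrix exponential of B.
IsExp : ∀ {n} → Matrix n → Matrix n → Set
IsExp B E = ∀ j k → (λ m → expPartialSum B m j k) ⟶ E j k

IsHermitian : ∀ {n} → Matrix n → Set
IsHermitian A = A ≈ᴹ A ᴴ

-- Rows and columns are indexed by ℤ/nℤ through its representatives 0, …, n−1.
IsCirculant : ∀ {n} → Matrix n → Set
IsCirculant {n} A = ∀ j k j′ k′ →
  + n ℤ.∣ (+ toℕ k ℤ.- + toℕ j) ℤ.- (+ toℕ k′ ℤ.- + toℕ j′) →
  A j k ≈ᶜ A j′ k′

IsEigenvalue : ∀ {n} → Matrix n → ℂ → Set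
IsEigenvalue {n} A μ =
  Σ[ v ∈ Vector ℂ n ] (∃[ j ] v j # 0ᶜ) × (∀ j → (A *ᵛ v) j ≈ᶜ μ *ᶜ v j)

HasDistinctEigenvalues : ∀ {n} → Matrix n → Set
HasDistinctEigenvalues {n} A =
  Σ[ μ ∈ Vector ℂ n ] (∀ r → IsEigenvalue A (μ r)) × (∀ r s → r ≢ s → μ r # μ s)

------------------------------------------------------------------------
-- Graphs and average mixing

record Graph (n : ℕ) : Set where
  field
    adjacency : Matrix n
    hermitian : IsHermitian adjacency

open Graph public

IsTransitionMatrix : ∀ {n} → Graph n → ℝ → Matrix n → Set
IsTransitionMatrix X t = IsExp ((-ᶜ (iᶜ *ᶜ fromℝ t)) •ᴹ adjacency X)

-- L is the limit of (1/T) ∫₀ᵀ f(t) dt as T → ∞.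
IsTimeAverage : (ℝ → ℂ) → ℂ → Set
IsTimeAverage f L =
  Σ[ F ∈ ((T : ℝ) → 0ᴿ <ᴿ T → ℂ) ]
    (∀ T 0<T → IsIntegral f 0ᴿ T (F T 0<T)) ×
    LimitAtInfinity (λ T 0<T → fromℝ (inverse T 0<T) *ᶜ F T 0<T) L

-- Exponentials, integrals and limits are unique up to equality, so existential
-- quantification over them pins down M̂.
IsAverageMixingMatrix : ∀ {n} → Graph n → Matrix n → Set
IsAverageMixingMatrix {n} X M̂ =
  Σ[ U ∈ (ℝ → Matrix n) ]
    (∀ t → IsTransitionMatrix X t (U t)) ×
    (∀ j k → IsTimeAverage (λ t → (U t ∘ᴹ conjᴹ (U t)) j k) (M̂ j k))

HasAverageUniformMixing : ∀ {n} .{{_ : ℕ.NonZero n}} → Graph n → Set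
HasAverageUniformMixing {n} X = IsAverageMixingMatrix X (fromℝ (fromℚ (1ℤ ℚ./ n)) •ᴹ J n)

{-# OPTIONS --safe #-}

-- Let v_r be eigenvectors of A for its n distinct eigenvalues μ_r. As A is
-- Hermitian, the μ_r are real and the v_r orthogonal, so that the rank-one
-- projections E_r = v_r v_r* / ⟨v_r, v_r⟩ resolve the identity: 1 − Σ E_r is a
-- Hermitian idempotent of trace 0, hence 0. Cyclically shifting v_r gives an
-- eigenvector of the circulant A for the same μ_r, i.e. a unimodular multiple
-- of v_r; so the entries of v_r have equal modulus and ∣E_r(j,k)∣² = 1/n². No
-- roots of unity are needed. In
--
--   ∣U(t)(j,k)∣² = Σ_{r,s} E_r(j,k) conj(E_s(j,k)) exp(−i t (μ_r − μ_s))
--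
-- the terms with r ≠ s have bounded integrals over [0,T], so the time average
-- is Σ_r ∣E_r(j,k)∣² = n · 1/n².
--
-- Analytically, "F is an antiderivative of f" is used in the form
-- ∣F(y) − F(x) − (y − x) f(x)∣ ≤ K (y − x)² on [0,T], which makes Riemann sums
-- telescope up to K T times the mesh. For z ↦ exp(c z) the estimate comes from
-- the power series, and ∣exp(−i t μ)∣ = 1 because its square has derivative 0.
module Submission where

open import Defs
open import Data.Nat using (ℕ; NonZero)

open import Level using (0ℓ)
open import Algebra.Bundles using (CommutativeRing)
open import Algebra.Structures using (IsCommutativeRing)
open import Algebra.Solver.Ring.AlmostCommutativeRing using (fromCommutativeRing; _-Raw-AlmostCommutative⟶_)
import Algebra.Solver.Ring
import Algebra.Properties.Semiring.Sum
open import Data.Empty using (⊥-elim)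
open import Data.Fin as Fin using (Fin; zero; suc; inject₁; toℕ)
open import Data.Fin.Induction using (<-weakInduction)
open import Data.Fin.Properties using (suc-injective; toℕ-inject₁; toℕ-fromℕ)
open import Data.Fin.Relation.Unary.Top using (view; ‵fromℕ; ‵inject₁; view-fromℕ; view-inject₁)
open import Data.Integer as ℤ using (1ℤ; 0ℤ; -1ℤ)
import Data.Integer.Divisibility as ℤ
import Data.Integer.Divisibility.Signed as Signed
import Data.Integer.Properties as ℤ
open import Data.Maybe using (Maybe; just; nothing; map)
open import Data.Nat as ℕ using (zero; suc; _!)
import Data.Nat.Properties as ℕ
open import Data.Product using (∃-syntax; _×_; _,_; proj₁; proj₂)
open import Data.Rational as ℚ using (ℚ; 0ℚ; 1ℚ; ½; ∣_∣)
import Data.Rational.Properties as ℚ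
import Data.Rational.Unnormalised as ℚᵘ
import Data.Rational.Unnormalised.Properties as ℚᵘ
open import Data.Sum using (inj₁; inj₂)
open import Data.Vec.Functional using (Vector)
open import Function using (_∘_)
open import Relation.Binary.Bundles using (Poset)
open import Relation.Binary.PropositionalEquality as ≡ using (_≡_; _≢_)
import Relation.Binary.Reasoning.PartialOrder
import Relation.Binary.Reasoning.Setoid
open import Relation.Nullary using (yes; no)

-- Real numbers are Cauchy sequences, so neither equality nor order between them is decidable, and
-- this shapes every step. Wherever division occurs, distinctness arrives as apartness and is turned
-- at once into an explicit inverse: `d r` for the squared norm of an eigenvector, `κ` for a
-- difference of eigenvalues. Counting dimensions would mean elimination with pivots known to be
-- apart from 0; the trace takes its place, since a sum of squared moduli that equals 0 forces every
-- entry to equal 0 without any choice. Likewise no intermediate point is ever located: the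
-- estimates for derivatives hold on the whole of [0,T] with one constant. Tolerances are rational,
-- because rationals can be compared and every positive real lies above a positive rational.
-- Products of an exponential with a conjugate one are handled through their differential equation:
-- solutions of f′ = c f are closed under conjugation and products, the constants being conjugated
-- and added.

-- Rational arithmetic.

module Rationals where
  open import Data.Rational
  open import Data.Rational.Properties
  open import Data.Rational.Solver using (module +-*-Solver)
  open import Relation.Binary.PropositionalEquality

  0≤1 : 0ℚ ≤ 1ℚ
  0≤1 = nonNegative⁻¹ 1ℚ

  0<½ : 0ℚ < ½
  0<½ = positive⁻¹ ½

  +-nonneg : ∀ {p q} → 0ℚ ≤ p → 0ℚ ≤ q → 0ℚ ≤ p + q
  +-nonneg = +-mono-≤

  *-monoˡ : ∀ {p q} r → 0ℚ ≤ r → p ≤ q → r * p ≤ r * q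
  *-monoˡ r 0≤r = *-monoˡ-≤-nonNeg r {{nonNegative 0≤r}}

  *-monoʳ : ∀ {p q} r → 0ℚ ≤ r → p ≤ q → p * r ≤ q * r
  *-monoʳ r 0≤r = *-monoʳ-≤-nonNeg r {{nonNegative 0≤r}}

  *-nonneg : ∀ {p q} → 0ℚ ≤ p → 0ℚ ≤ q → 0ℚ ≤ p * q
  *-nonneg {p} {q} 0≤p 0≤q = subst (_≤ p * q) (*-zeroʳ p) (*-monoˡ p 0≤p 0≤q)

  square-nonneg : ∀ p → 0ℚ ≤ p * p
  square-nonneg p = subst (0ℚ ≤_) ∣pp∣≡pp (*-nonneg (0≤∣p∣ p) (0≤∣p∣ p))
    where
    ∣pp∣≡pp : ∣ p ∣ * ∣ p ∣ ≡ p * p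
    ∣pp∣≡pp with ∣p∣≡p∨∣p∣≡-p p
    ... | inj₁ e = cong₂ _*_ e e
    ... | inj₂ e = trans (cong₂ _*_ e e) (solve 1 (λ p → :- p :* :- p := p :* p) refl p)
      where open +-*-Solver

  ≤∣_∣ : ∀ p → p ≤ ∣ p ∣
  ≤∣ p ∣ with ≤-total 0ℚ p
  ... | inj₁ 0≤p = ≤-reflexive (sym (0≤p⇒∣p∣≡p 0≤p))
  ... | inj₂ p≤0 = ≤-trans p≤0 (0≤∣p∣ p)

  p≡q+[p-q] : ∀ p q → p ≡ q + (p - q)
  p≡q+[p-q] = solve 2 (λ p q → p := q :+ (p :- q)) refl
    where open +-*-Solver

  -- The recursion makes `natℚ (suc n)` unfold to `1ℚ + natℚ n`, the shape in which inductions and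
  -- the ring solver use it.
  natℚ : ℕ → ℚ
  natℚ zero    = 0ℚ
  natℚ (suc n) = 1ℚ + natℚ n

  natℚ-nonneg : ∀ n → 0ℚ ≤ natℚ n
  natℚ-nonneg zero    = ≤-refl
  natℚ-nonneg (suc n) = +-nonneg 0≤1 (natℚ-nonneg n)

  natℚ-mono : ∀ {m n} → m ℕ.≤ n → natℚ m ≤ natℚ n
  natℚ-mono {n = n} ℕ.z≤n = natℚ-nonneg n
  natℚ-mono (ℕ.s≤s p) = +-monoʳ-≤ 1ℚ (natℚ-mono p)

  natℚ-+ : ∀ m n → natℚ (m ℕ.+ n) ≡ natℚ m + natℚ n
  natℚ-+ zero n = sym (+-identityˡ _)
  natℚ-+ (suc m) n = trans (cong (_+_ 1ℚ) (natℚ-+ m n)) (sym (+-assoc 1ℚ (natℚ m) (natℚ n)))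

  natℚ-* : ∀ m n → natℚ (m ℕ.* n) ≡ natℚ m * natℚ n
  natℚ-* zero n = sym (*-zeroˡ (natℚ n))
  natℚ-* (suc m) n = trans (natℚ-+ n (m ℕ.* n)) (trans (cong (_+_ (natℚ n)) (natℚ-* m n))
    (solve 2 (λ m n → n :+ m :* n := (con 1ℚ :+ m) :* n) refl (natℚ m) (natℚ n)))
    where open +-*-Solver

  -- `_/_` normalises by a gcd and does not compute on variables; between unnormalised fractions,
  -- equality is an identity of integers.
  toℚᵘ-/ : ∀ i n → toℚᵘ (i / suc n) ℚᵘ.≃ ℚᵘ.mkℚᵘ i n
  toℚᵘ-/ i n = toℚᵘ-fromℚᵘ (ℚᵘ.mkℚᵘ i n)

  natℚ≡/1 : ∀ n → natℚ n ≡ ℤ.+ n / 1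
  natℚ≡/1 zero = refl
  natℚ≡/1 (suc n) = trans (cong (_+_ 1ℚ) (natℚ≡/1 n)) (toℚᵘ-injective
    (ℚᵘ.≃-trans (toℚᵘ-homo-+ 1ℚ (ℤ.+ n / 1))
    (ℚᵘ.≃-trans (ℚᵘ.+-congʳ ℚᵘ.1ℚᵘ (toℚᵘ-/ (ℤ.+ n) 0))
    (ℚᵘ.≃-trans (ℚᵘ.*≡* (cong₂ ℤ._*_ (cong (ℤ._+_ 1ℤ) (ℤ.*-identityʳ (ℤ.+ n))) (refl {x = 1ℤ})))
      (ℚᵘ.≃-sym (toℚᵘ-/ (ℤ.+ suc n) 0))))))

  1/n*n≡1 : ∀ n .{{_ : ℕ.NonZero n}} → (1ℤ / n) * natℚ n ≡ 1ℚ
  1/n*n≡1 (suc n) = trans (cong ((1ℤ / suc n) *_) (natℚ≡/1 (suc n))) (toℚᵘ-injective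
    (ℚᵘ.≃-trans (toℚᵘ-homo-* (1ℤ / suc n) (ℤ.+ suc n / 1))
    (ℚᵘ.≃-trans (ℚᵘ.*-cong (toℚᵘ-/ 1ℤ n) (toℚᵘ-/ (ℤ.+ suc n) 0))
      (ℚᵘ.*≡* (trans (ℤ.*-identityʳ _) (trans (ℤ.*-identityˡ _) (sym (trans (ℤ.*-identityˡ _) (cong ℤ.+_ (ℕ.*-identityʳ (suc n)))))))))))

  *-inverse-unique : ∀ {p q r} → p * r ≡ 1ℚ → q * r ≡ 1ℚ → p ≡ q
  *-inverse-unique {p} {q} {r} pr qr = begin
    p           ≡⟨ sym (*-identityʳ p) ⟩
    p * 1ℚ      ≡⟨ cong (p *_) (sym qr) ⟩
    p * (q * r) ≡⟨ solve 3 (λ p q r → p :* (q :* r) := q :* (p :* r)) refl p q r ⟩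
    q * (p * r) ≡⟨ cong (q *_) pr ⟩
    q * 1ℚ      ≡⟨ *-identityʳ q ⟩
    q           ∎
    where
    open ≡-Reasoning
    open +-*-Solver

  1/suc : ℕ → ℚ
  1/suc n = 1ℤ / suc n

  1/suc-pos : ∀ n → 0ℚ < 1/suc n
  1/suc-pos n = positive⁻¹ _ {{normalize-pos 1 (suc n)}}

  1/suc-inverse : ∀ n → 1/suc n * natℚ (suc n) ≡ 1ℚ
  1/suc-inverse n = 1/n*n≡1 (suc n)

  1/[_!] : ℕ → ℚ
  1/[ n !] = _/_ 1ℤ (n !) {{ℕ._!≢0 n}}

  -- Both sides are inverse to `natℚ (suc n !)`.
  1/!-suc : ∀ n → 1/[ suc n !] ≡ 1/suc n * 1/[ n !]
  1/!-suc n = *-inverse-unique {r = natℚ (suc n !)} (1/n*n≡1 (suc n !) {{ℕ._!≢0 (suc n)}}) (begin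
    1/suc n * 1/[ n !] * natℚ (suc n !)
      ≡⟨ cong (1/suc n * 1/[ n !] *_) (natℚ-* (suc n) (n !)) ⟩
    1/suc n * 1/[ n !] * (natℚ (suc n) * natℚ (n !))
      ≡⟨ solve 4 (λ a b c d → a :* b :* (c :* d) := (a :* c) :* (b :* d)) refl
           (1/suc n) 1/[ n !] (natℚ (suc n)) (natℚ (n !)) ⟩
    (1/suc n * natℚ (suc n)) * (1/[ n !] * natℚ (n !))
      ≡⟨ cong₂ _*_ (1/suc-inverse n) (1/n*n≡1 (n !) {{ℕ._!≢0 n}}) ⟩
    1ℚ ∎)
    where
    open ≡-Reasoning
    open +-*-Solver

  -- The denominator is at least 1, so the absolute value of the numerator is already a bound.
  archimedean : ∀ p → ∃[ n ] p ≤ natℚ n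
  archimedean p@(mkℚ i d _) = ℤ.∣ i ∣ , subst (p ≤_) (sym (natℚ≡/1 ℤ.∣ i ∣))
    (toℚᵘ-cancel-≤ (ℚᵘ.≤-trans (ℚᵘ.*≤* (bound i)) (ℚᵘ.≤-reflexive (ℚᵘ.≃-sym (toℚᵘ-/ (ℤ.+ ℤ.∣ i ∣) 0)))))
    where
    bound : ∀ i → i ℤ.* ℤ.+ 1 ℤ.≤ ℤ.+ ℤ.∣ i ∣ ℤ.* ℤ.+ suc d
    bound (ℤ.+ n) = subst₂ ℤ._≤_ (sym (ℤ.*-identityʳ (ℤ.+ n))) (ℤ.pos-* n (suc d)) (ℤ.+≤+ (ℕ.m≤m*n n (suc d)))
    bound (ℤ.-[1+ n ]) = ℤ.≤-trans (ℤ.≤-reflexive (ℤ.*-identityʳ ℤ.-[1+ n ])) (ℤ.≤-trans ℤ.-≤+ (ℤ.≤-reflexive (ℤ.pos-* (suc n) (suc d))))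

  2⁻ : ℕ → ℚ
  2⁻ zero    = 1ℚ
  2⁻ (suc n) = ½ * 2⁻ n

  2⁻-pos : ∀ n → 0ℚ < 2⁻ n
  2⁻-pos zero    = positive⁻¹ 1ℚ
  2⁻-pos (suc n) = Defs.½-pos (2⁻-pos n)

  -- Bernoulli's inequality n + 1 ≤ 2ⁿ without division: one more halving outweighs one more
  -- summand, as n + 2 ≤ 2 (n + 1).
  2⁻*suc≤1 : ∀ n → 2⁻ n * natℚ (suc n) ≤ 1ℚ
  2⁻*suc≤1 zero = ≤-refl
  2⁻*suc≤1 (suc n) = begin
    ½ * 2⁻ n * (1ℚ + natℚ (suc n))         ≤⟨ *-monoˡ (½ * 2⁻ n) (<⇒≤ (2⁻-pos (suc n)))
                                                (+-monoˡ-≤ (natℚ (suc n)) 1≤suc) ⟩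
    ½ * 2⁻ n * (natℚ (suc n) + natℚ (suc n)) ≡⟨ solve 2 (λ a x → con ½ :* a :* (x :+ x) := a :* x)
                                                  refl (2⁻ n) (natℚ (suc n)) ⟩
    2⁻ n * natℚ (suc n)                    ≤⟨ 2⁻*suc≤1 n ⟩
    1ℚ                                      ∎
    where
    open ≤-Reasoning
    open +-*-Solver
    1≤suc : 1ℚ ≤ natℚ (suc n)
    1≤suc = subst (_≤ natℚ (suc n)) (+-identityʳ 1ℚ) (+-monoʳ-≤ 1ℚ (natℚ-nonneg n))

  2⁻-null : ∀ b ε → 0ℚ < ε → ∃[ N ] ∀ n → N ℕ.≤ n → b * 2⁻ n ≤ ε
  2⁻-null b ε 0<ε = N , λ n N≤n → begin
    b * 2⁻ n                  ≡⟨ cong (_* 2⁻ n) b≡ ⟩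
    b * r * ε * 2⁻ n          ≤⟨ *-monoʳ (2⁻ n) (<⇒≤ (2⁻-pos n)) (*-monoʳ ε (<⇒≤ 0<ε)
                                  (≤-trans (proj₂ (archimedean (b * r))) (natℚ-mono (ℕ.m≤n⇒m≤1+n N≤n)))) ⟩
    natℚ (suc n) * ε * 2⁻ n  ≡⟨ solve 3 (λ x e a → x :* e :* a := e :* (a :* x)) refl
                                  (natℚ (suc n)) ε (2⁻ n) ⟩
    ε * (2⁻ n * natℚ (suc n)) ≤⟨ *-monoˡ ε (<⇒≤ 0<ε) (2⁻*suc≤1 n) ⟩
    ε * 1ℚ                    ≡⟨ *-identityʳ ε ⟩
    ε                         ∎
    where
    open ≤-Reasoning
    open +-*-Solver
    r = recip ε 0<ε
    -- Since b/ε ≤ N, every n ≥ N satisfies b ≤ (n + 1) ε.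
    N = proj₁ (archimedean (b * r))
    b≡ : b ≡ b * r * ε
    b≡ = sym (trans (*-assoc b r ε) (trans (cong (b *_) (recip-inverseˡ ε 0<ε)) (*-identityʳ b)))

  *-recip : ∀ b q (0<b : 0ℚ < b) → b * (q * recip b 0<b) ≡ q
  *-recip b q 0<b = begin
    b * (q * r)  ≡⟨ solve 3 (λ b q r → b :* (q :* r) := r :* b :* q) refl b q r ⟩
    r * b * q    ≡⟨ cong (_* q) (recip-inverseˡ b 0<b) ⟩
    1ℚ * q       ≡⟨ *-identityˡ q ⟩
    q            ∎
    where
    open ≡-Reasoning
    open +-*-Solver
    r = recip b 0<b

  2ℚ : ℚ
  2ℚ = 1ℚ + 1ℚ

  0≤2ℚ : 0ℚ ≤ 2ℚ
  0≤2ℚ = nonNegative⁻¹ 2ℚ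

  -- The majorant series of the exponential.

  module ExpBound (M : ℚ) (0≤M : 0ℚ ≤ M) where

    -- `expTerm k` is Mᵏ/k!, `prevTerm k` is its derivative in M, and `expSum k` adds up the first k
    -- terms. This series dominates the complex one on the ball of radius M.
    expTerm prevTerm expSum : ℕ → ℚ
    expTerm zero    = 1ℚ
    expTerm (suc k) = 1/suc k * (M * expTerm k)
    prevTerm zero    = 0ℚ
    prevTerm (suc k) = expTerm k
    expSum zero    = 0ℚ
    expSum (suc k) = expSum k + expTerm k

    expTerm-nonneg : ∀ k → 0ℚ ≤ expTerm k
    expTerm-nonneg zero    = 0≤1
    expTerm-nonneg (suc k) = *-nonneg (<⇒≤ (1/suc-pos k)) (*-nonneg 0≤M (expTerm-nonneg k))

    prevTerm-step : ∀ k → M * prevTerm k ≡ natℚ k * expTerm k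
    prevTerm-step zero    = *-zeroʳ M
    prevTerm-step (suc k) = sym (begin
      natℚ (suc k) * (1/suc k * (M * expTerm k)) ≡⟨ solve 3 (λ a b c → a :* (b :* c) := (b :* a) :* c)
                                                     refl (natℚ (suc k)) (1/suc k) (M * expTerm k) ⟩
      1/suc k * natℚ (suc k) * (M * expTerm k)   ≡⟨ cong (_* (M * expTerm k)) (1/suc-inverse k) ⟩
      1ℚ * (M * expTerm k)                        ≡⟨ *-identityˡ _ ⟩
      M * expTerm k                               ∎)
      where
      open ≡-Reasoning
      open +-*-Solver

    -- By M p(k) = k a(k), what is left is (k + 1)/(k + 2) ≤ 1. This is the induction step for the
    -- Taylor remainders of the monomials zᵏ/k!.
    remainder-step : ∀ k → 1/suc (suc k) * (M * prevTerm k + expTerm k) ≤ expTerm k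
    remainder-step k = begin
      1/suc (suc k) * (M * prevTerm k + A)   ≡⟨ cong (λ x → 1/suc (suc k) * (x + A)) (prevTerm-step k) ⟩
      1/suc (suc k) * (natℚ k * A + A)      ≤⟨ *-monoˡ (1/suc (suc k)) (<⇒≤ (1/suc-pos (suc k)))
                                                (≤-trans (≤-reflexive (sym (+-identityˡ _)))
                                                  (+-monoˡ-≤ (natℚ k * A + A) (expTerm-nonneg k))) ⟩
      1/suc (suc k) * (A + (natℚ k * A + A)) ≡⟨ solve 3 (λ r n a → r :* (a :+ (n :* a :+ a)) :=
                                                 r :* (con 1ℚ :+ (con 1ℚ :+ n)) :* a) refl
                                                 (1/suc (suc k)) (natℚ k) A ⟩
      1/suc (suc k) * natℚ (suc (suc k)) * A ≡⟨ cong (_* A) (1/suc-inverse (suc k)) ⟩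
      1ℚ * A                                 ≡⟨ *-identityˡ A ⟩
      A                                      ∎
      where
      open ≤-Reasoning
      open +-*-Solver
      A = expTerm k

    private
      -- The ratio M/(k + 1) of consecutive terms is at most `½` once k ≥ 2 M.
      k₀ : ℕ
      k₀ = proj₁ (archimedean (2ℚ * M))

    expTerm-halves : ∀ k → k₀ ℕ.≤ k → expTerm (suc k) ≤ ½ * expTerm k
    expTerm-halves k k₀≤k = begin
      1/suc k * (M * expTerm k)      ≡⟨ solve 3 (λ r m a → r :* (m :* a) := con ½ :* (r :* ((con 1ℚ :+ con 1ℚ) :* m)) :* a)
                                        refl (1/suc k) M (expTerm k) ⟩
      ½ * (1/suc k * (2ℚ * M)) * expTerm k
        ≤⟨ *-monoʳ (expTerm k) (expTerm-nonneg k) (*-monoˡ ½ (<⇒≤ 0<½)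
             (*-monoˡ (1/suc k) (<⇒≤ (1/suc-pos k))
               (≤-trans (proj₂ (archimedean (2ℚ * M))) (natℚ-mono (ℕ.m≤n⇒m≤1+n k₀≤k))))) ⟩
      ½ * (1/suc k * natℚ (suc k)) * expTerm k ≡⟨ cong (λ x → ½ * x * expTerm k) (1/suc-inverse k) ⟩
      ½ * 1ℚ * expTerm k             ≡⟨ cong (_* expTerm k) (*-identityʳ ½) ⟩
      ½ * expTerm k                  ∎
      where
      open ≤-Reasoning
      open +-*-Solver

    expTerm-decay : ∀ j → expTerm (j ℕ.+ k₀) ≤ expTerm k₀ * 2⁻ j
    expTerm-decay zero    = ≤-reflexive (sym (*-identityʳ _))
    expTerm-decay (suc j) = begin
      expTerm (suc j ℕ.+ k₀)   ≤⟨ expTerm-halves (j ℕ.+ k₀) (ℕ.m≤n+m k₀ j) ⟩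
      ½ * expTerm (j ℕ.+ k₀)   ≤⟨ *-monoˡ ½ (<⇒≤ 0<½) (expTerm-decay j) ⟩
      ½ * (expTerm k₀ * 2⁻ j)  ≡⟨ solve 2 (λ a b → con ½ :* (a :* b) := a :* (con ½ :* b)) refl (expTerm k₀) (2⁻ j) ⟩
      expTerm k₀ * 2⁻ (suc j)  ∎
      where
      open ≤-Reasoning
      open +-*-Solver

    -- Beyond k₀ the terms at least halve, so expSum k + 2 expTerm k decreases.
    expSum-upper : ∀ j m → k₀ ℕ.≤ m →
                   expSum (j ℕ.+ m) + 2ℚ * expTerm (j ℕ.+ m) ≤ expSum m + 2ℚ * expTerm m
    expSum-upper zero    m k₀≤m = ≤-refl
    expSum-upper (suc j) m k₀≤m = begin
      s + a + 2ℚ * expTerm (suc (j ℕ.+ m)) ≤⟨ +-monoʳ-≤ (s + a) (*-monoˡ 2ℚ 0≤2ℚ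
                                              (expTerm-halves (j ℕ.+ m) (ℕ.≤-trans k₀≤m (ℕ.m≤n+m m j)))) ⟩
      s + a + 2ℚ * (½ * a)                 ≡⟨ solve 2 (λ s a → s :+ a :+ (con 1ℚ :+ con 1ℚ) :* (con ½ :* a) :=
                                              s :+ (con 1ℚ :+ con 1ℚ) :* a) refl s a ⟩
      s + 2ℚ * a                           ≤⟨ expSum-upper j m k₀≤m ⟩
      expSum m + 2ℚ * expTerm m            ∎
      where
      open ≤-Reasoning
      open +-*-Solver
      s = expSum (j ℕ.+ m)
      a = expTerm (j ℕ.+ m)

    expSum≤upper : ∀ k → expSum k ≤ expSum k + 2ℚ * expTerm k
    expSum≤upper k = ≤-trans (≤-reflexive (sym (+-identityʳ _)))
      (+-monoʳ-≤ (expSum k) (*-nonneg 0≤2ℚ (expTerm-nonneg k)))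

    expSum-mono : ∀ {m n} → m ℕ.≤ n → expSum m ≤ expSum n
    expSum-mono {m} {n} m≤n = subst (λ k → expSum m ≤ expSum k) (ℕ.m∸n+n≡m m≤n) (go (n ℕ.∸ m))
      where
      go : ∀ j → expSum m ≤ expSum (j ℕ.+ m)
      go zero    = ≤-refl
      go (suc j) = ≤-trans (go j) (≤-trans (≤-reflexive (sym (+-identityʳ _)))
        (+-monoʳ-≤ (expSum (j ℕ.+ m)) (expTerm-nonneg (j ℕ.+ m))))

    expBound : ℚ
    expBound = expSum k₀ + 2ℚ * expTerm k₀

    expSum-bounded : ∀ n → expSum n ≤ expBound
    expSum-bounded n = ≤-trans (expSum-mono (ℕ.m≤m+n n k₀))
      (≤-trans (expSum≤upper (n ℕ.+ k₀)) (expSum-upper n k₀ ℕ.≤-refl))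

    expBound-nonneg : 0ℚ ≤ expBound
    expBound-nonneg = expSum-bounded 0

    expSum-tail : ∀ ε → 0ℚ < ε → ∃[ N ] ∀ m → N ℕ.≤ m → ∀ j → expSum (j ℕ.+ m) - expSum m ≤ ε
    -- The tail after m terms is at most 2 a(m): `k₀` indices until the terms begin to halve, then
    -- `N` halvings to bring 2 a(m) below ε.
    expSum-tail ε 0<ε = N ℕ.+ k₀ , bound
      where
      open +-*-Solver
      null = 2⁻-null (2ℚ * expTerm k₀) ε 0<ε
      N = proj₁ null
      small : ∀ m → N ℕ.+ k₀ ℕ.≤ m → 2ℚ * expTerm m ≤ ε
      small m p = begin
        2ℚ * expTerm m                       ≡⟨ cong (λ k → 2ℚ * expTerm k) (sym (ℕ.m∸n+n≡m k₀≤m)) ⟩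
        2ℚ * expTerm (m ℕ.∸ k₀ ℕ.+ k₀)       ≤⟨ *-monoˡ 2ℚ 0≤2ℚ (expTerm-decay (m ℕ.∸ k₀)) ⟩
        2ℚ * (expTerm k₀ * 2⁻ (m ℕ.∸ k₀))    ≡⟨ sym (*-assoc 2ℚ (expTerm k₀) (2⁻ (m ℕ.∸ k₀))) ⟩
        2ℚ * expTerm k₀ * 2⁻ (m ℕ.∸ k₀)      ≤⟨ proj₂ null (m ℕ.∸ k₀) (ℕ.m+n≤o⇒m≤o∸n N p) ⟩
        ε                                    ∎
        where
        open ≤-Reasoning
        k₀≤m = ℕ.m+n≤o⇒n≤o N p
      bound : ∀ m → N ℕ.+ k₀ ℕ.≤ m → ∀ j → expSum (j ℕ.+ m) - expSum m ≤ ε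
      bound m p j = begin
        expSum (j ℕ.+ m) - expSum m ≤⟨ +-monoˡ-≤ (- expSum m) (≤-trans (expSum≤upper (j ℕ.+ m))
                                        (expSum-upper j m (ℕ.m+n≤o⇒n≤o N p))) ⟩
        expSum m + 2ℚ * expTerm m - expSum m ≡⟨ solve 2 (λ s a → s :+ a :- s := a) refl (expSum m) (2ℚ * expTerm m) ⟩
        2ℚ * expTerm m              ≤⟨ small m p ⟩
        ε                           ∎
        where open ≤-Reasoning

open Rationals

-- The real numbers as a commutative ring with order and absolute value.

module Reals where
  open import Data.Rational.Solver using (module +-*-Solver)
  open import Relation.Binary.PropositionalEquality

  Eventually : (ℕ → Set) → Set
  Eventually P = ∃[ N ] ∀ n → N ℕ.≤ n → P n

  always : ∀ {P : ℕ → Set} → (∀ n → P n) → Eventually P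
  always h = 0 , λ n _ → h n

  eventually-map : ∀ {P Q : ℕ → Set} → (∀ n → P n → Q n) → Eventually P → Eventually Q
  eventually-map f (N , h) = N , λ n p → f n (h n p)

  eventually-zip : ∀ {P Q R : ℕ → Set} → (∀ n → P n → Q n → R n) →
                   Eventually P → Eventually Q → Eventually R
  eventually-zip f (M , g) (N , h) =
    M ℕ.⊔ N , λ n p → f n (g n (ℕ.m⊔n≤o⇒m≤o M N p)) (h n (ℕ.m⊔n≤o⇒n≤o M N p))

  module _ where
    open import Data.Rational
    open +-*-Solver

    half+half : ∀ p → ½ * p + ½ * p ≡ p
    half+half = solve 1 (λ p → con ½ :* p :+ con ½ :* p := p) refl

    half< : ∀ {p} → 0ℚ < p → ½ * p < p
    half< {p} 0<p = subst₂ _<_ (ℚ.+-identityʳ (½ * p)) (half+half p) (ℚ.+-monoʳ-< (½ * p) (Defs.½-pos 0<p))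

    ∣∣-least : ∀ {p q} → p ≤ q → - p ≤ q → ∣ p ∣ ≤ q
    ∣∣-least {p} {q} a b with ℚ.∣p∣≡p∨∣p∣≡-p p
    ... | inj₁ e = subst (_≤ q) (sym e) a
    ... | inj₂ e = subst (_≤ q) (sym e) b

    ∣∣-reverse-triangle : ∀ p q → ∣ ∣ p ∣ - ∣ q ∣ ∣ ≤ ∣ p - q ∣
    ∣∣-reverse-triangle p q = ∣∣-least (go p q)
      (subst₂ _≤_ (solve 2 (λ a b → b :- a := :- (a :- b)) refl ∣ p ∣ ∣ q ∣) (∣-∣-sym q p) (go q p))
      where
      go : ∀ p q → ∣ p ∣ - ∣ q ∣ ≤ ∣ p - q ∣
      go p q = begin
        ∣ p ∣ - ∣ q ∣                ≡⟨ cong (λ x → ∣ x ∣ - ∣ q ∣) (p≡q+[p-q] p q) ⟩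
        ∣ q + (p - q) ∣ - ∣ q ∣      ≤⟨ ℚ.+-monoˡ-≤ (- ∣ q ∣) (ℚ.∣p+q∣≤∣p∣+∣q∣ q (p - q)) ⟩
        ∣ q ∣ + ∣ p - q ∣ - ∣ q ∣    ≡⟨ solve 2 (λ a b → a :+ b :- a := b) refl ∣ q ∣ ∣ p - q ∣ ⟩
        ∣ p - q ∣                    ∎
        where open ℚ.≤-Reasoning

    +-eps : ∀ {a b c d ε} → a ≤ b + ½ * ε → c ≤ d + ½ * ε → a + c ≤ (b + d) + ε
    +-eps {a} {b} {c} {d} {ε} p q = ℚ.≤-trans (ℚ.+-mono-≤ p q) (ℚ.≤-reflexive
      (solve 3 (λ b d e → b :+ con ½ :* e :+ (d :+ con ½ :* e) := b :+ d :+ e) refl b d ε))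

    trans-eps : ∀ {a b c ε} → a ≤ b + ½ * ε → b ≤ c + ½ * ε → a ≤ c + ε
    trans-eps {a} {b} {c} {ε} p q = ℚ.≤-trans p (ℚ.≤-trans (ℚ.+-monoˡ-≤ (½ * ε) q) (ℚ.≤-reflexive
      (solve 2 (λ c e → c :+ con ½ :* e :+ con ½ :* e := c :+ e) refl c ε)))

    ≤+⇒-≤ : ∀ {a b ε} → a ≤ b + ε → a - b ≤ ε
    ≤+⇒-≤ {a} {b} {ε} p = ℚ.≤-trans (ℚ.+-monoˡ-≤ (- b) p) (ℚ.≤-reflexive
      (solve 2 (λ b e → b :+ e :- b := e) refl b ε))

    -≤⇒≤+ : ∀ {a b ε} → a - b ≤ ε → a ≤ b + ε
    -≤⇒≤+ {a} {b} {ε} p = ℚ.≤-trans (ℚ.≤-reflexive (p≡q+[p-q] a b)) (ℚ.+-monoʳ-≤ b p)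

    ∣-∣-least : ∀ {a b ε} → a ≤ b + ε → b ≤ a + ε → ∣ a - b ∣ ≤ ε
    ∣-∣-least {a} {b} {ε} p q = ∣∣-least (≤+⇒-≤ p)
      (subst (_≤ ε) (solve 2 (λ a b → b :- a := :- (a :- b)) refl a b) (≤+⇒-≤ q))

    ≤+eps : ∀ {p ε} → 0ℚ < ε → p ≤ p + ε
    ≤+eps {p} 0<ε = ℚ.≤-trans (ℚ.≤-reflexive (sym (ℚ.+-identityʳ p))) (ℚ.+-monoʳ-≤ p (ℚ.<⇒≤ 0<ε))

  infix  4 _≈ʳ_ _≤ʳ_
  infixl 6 _+ʳ_ _-ʳ_
  infixl 7 _*ʳ_
  infix  8 -ʳ_

  -- The operations of Defs are made opaque so that unification treats them as
  -- symbols; unfolded, they are sequences of rationals from which the operands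
  -- cannot be inferred.
  opaque
    _≈ʳ_ _≤ʳ_ : ℝ → ℝ → Set
    _≈ʳ_ = _≈ᴿ_
    _≤ʳ_ = _≤ᴿ_

    _+ʳ_ _*ʳ_ : ℝ → ℝ → ℝ
    _+ʳ_ = _+ᴿ_
    _*ʳ_ = _*ᴿ_

    -ʳ_ : ℝ → ℝ
    -ʳ_ = -ᴿ_

    ⌊_⌋ : ℚ → ℝ
    ⌊_⌋ = fromℚ

    absʳ : ℝ → ℝ
    absʳ x = mkℝ (λ n → ∣ seq x n ∣) λ ε 0<ε →
      let (N , h) = cauchy x ε 0<ε
      in N , λ m n p q → ℚ.≤-<-trans (∣∣-reverse-triangle (seq x m) (seq x n)) (h m n p q)

  _-ʳ_ : ℝ → ℝ → ℝ
  x -ʳ y = x +ʳ -ʳ y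

  opaque
    unfolding _≈ʳ_

    ≈ʳ-refl : ∀ {x} → x ≈ʳ x
    ≈ʳ-refl {x} ε 0<ε = always λ n → subst (ℚ._< ε) (cong ∣_∣ (sym (ℚ.+-inverseʳ (seq x n)))) 0<ε

    ≈ʳ-sym : ∀ {x y} → x ≈ʳ y → y ≈ʳ x
    ≈ʳ-sym {x} {y} h ε 0<ε = eventually-map (λ n → subst (ℚ._< ε) (∣-∣-sym (seq x n) (seq y n))) (h ε 0<ε)

    ≈ʳ-trans : ∀ {x y z} → x ≈ʳ y → y ≈ʳ z → x ≈ʳ z
    ≈ʳ-trans {x} {y} {z} h k ε 0<ε = eventually-zip
      (λ n p q → subst (ℚ._< ε) (cong ∣_∣ (solve 3 (λ a b c → a :+ b :- (b :+ c) := a :- c) refl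
                   (seq x n) (seq y n) (seq z n)))
         (+-close (seq x n) (seq y n) (seq y n) (seq z n) p q))
      (h _ (½-pos 0<ε)) (k _ (½-pos 0<ε))
      where open +-*-Solver

    -- The operations act termwise, so each ring law of ℚ passes to `ℝ` through this lemma.
    ≈ʳ-pointwise : ∀ {x y} → (∀ n → seq x n ≡ seq y n) → x ≈ʳ y
    ≈ʳ-pointwise {x} {y} h ε 0<ε = always λ n →
      subst (ℚ._< ε) (sym (trans (cong (λ a → ∣ a ℚ.- seq y n ∣) (h n)) (cong ∣_∣ (ℚ.+-inverseʳ (seq y n))))) 0<ε

    +ʳ-cong : ∀ {x y u v} → x ≈ʳ y → u ≈ʳ v → x +ʳ u ≈ʳ y +ʳ v
    +ʳ-cong {x} {y} {u} {v} h k ε 0<ε = eventually-zip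
      (λ n p q → +-close (seq x n) (seq y n) (seq u n) (seq v n) p q)
      (h _ (½-pos 0<ε)) (k _ (½-pos 0<ε))

    -ʳ-cong : ∀ {x y} → x ≈ʳ y → -ʳ x ≈ʳ -ʳ y
    -ʳ-cong {x} {y} h ε 0<ε = eventually-map (λ n → neg-close (seq x n) (seq y n)) (h ε 0<ε)

    -- From x u - y v = x (u - v) + (x - y) v: bounds on x and v alone determine how close the
    -- factors must be.
    *ʳ-cong : ∀ {x y u v} → x ≈ʳ y → u ≈ʳ v → x *ʳ u ≈ʳ y *ʳ v
    *ʳ-cong {x} {y} {u} {v} h k ε 0<ε =
      let (B , 0<B , b) = eventually-bounded x
          (C , 0<C , c) = eventually-bounded v
          0<B+C = +-pos 0<B 0<C
          r     = recip (B ℚ.+ C) 0<B+C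
          0<δ   = *-pos 0<ε (recip-pos (B ℚ.+ C) 0<B+C)
          δ[B+C]≡ε = trans (ℚ.*-assoc ε r (B ℚ.+ C))
            (trans (cong (ε ℚ.*_) (recip-inverseˡ (B ℚ.+ C) 0<B+C)) (ℚ.*-identityʳ ε))
      in eventually-zip
           (λ n (bx , cv) (p , q) → subst (_ ℚ.<_) δ[B+C]≡ε
              (*-close (seq x n) (seq y n) (seq u n) (seq v n) 0<B 0<C bx cv p q))
           (eventually-zip (λ _ → _,_) b c)
           (eventually-zip (λ _ → _,_) (h _ 0<δ) (k _ 0<δ))

    ℝ-isCommutativeRing : IsCommutativeRing _≈ʳ_ _+ʳ_ _*ʳ_ -ʳ_ ⌊ 0ℚ ⌋ ⌊ 1ℚ ⌋
    ℝ-isCommutativeRing = record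
      { isRing = record
        { +-isAbelianGroup = record
          { isGroup = record
            { isMonoid = record
              { isSemigroup = record
                { isMagma = record
                  { isEquivalence = record
                    { refl  = λ {x} → ≈ʳ-refl {x}
                    ; sym   = λ {x} {y} → ≈ʳ-sym {x} {y}
                    ; trans = λ {x} {y} {z} → ≈ʳ-trans {x} {y} {z}
                    }
                  ; ∙-cong = λ {x} {y} {u} {v} → +ʳ-cong {x} {y} {u} {v}
                  }
                ; assoc = λ x y z → pw (x +ʳ y +ʳ z) (x +ʳ (y +ʳ z)) λ n → ℚ.+-assoc (seq x n) (seq y n) (seq z n)
                }
              ; identity = (λ x → pw (⌊ 0ℚ ⌋ +ʳ x) x λ n → ℚ.+-identityˡ (seq x n)) , (λ x → pw (x +ʳ ⌊ 0ℚ ⌋) x λ n → ℚ.+-identityʳ (seq x n))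
              }
            ; inverse = (λ x → pw (-ʳ x +ʳ x) ⌊ 0ℚ ⌋ λ n → ℚ.+-inverseˡ (seq x n)) , (λ x → pw (x +ʳ -ʳ x) ⌊ 0ℚ ⌋ λ n → ℚ.+-inverseʳ (seq x n))
            ; ⁻¹-cong = λ {x} {y} → -ʳ-cong {x} {y}
            }
          ; comm = λ x y → pw (x +ʳ y) (y +ʳ x) λ n → ℚ.+-comm (seq x n) (seq y n)
          }
        ; *-cong = λ {x} {y} {u} {v} → *ʳ-cong {x} {y} {u} {v}
        ; *-assoc = λ x y z → pw (x *ʳ y *ʳ z) (x *ʳ (y *ʳ z)) λ n → ℚ.*-assoc (seq x n) (seq y n) (seq z n)
        ; *-identity = (λ x → pw (⌊ 1ℚ ⌋ *ʳ x) x λ n → ℚ.*-identityˡ (seq x n)) , (λ x → pw (x *ʳ ⌊ 1ℚ ⌋) x λ n → ℚ.*-identityʳ (seq x n))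
        ; distrib = (λ x y z → pw (x *ʳ (y +ʳ z)) (x *ʳ y +ʳ x *ʳ z) λ n → ℚ.*-distribˡ-+ (seq x n) (seq y n) (seq z n))
                  , (λ x y z → pw ((y +ʳ z) *ʳ x) (y *ʳ x +ʳ z *ʳ x) λ n → ℚ.*-distribʳ-+ (seq x n) (seq y n) (seq z n))
        }
      ; *-comm = λ x y → pw (x *ʳ y) (y *ʳ x) λ n → ℚ.*-comm (seq x n) (seq y n)
      }
      where
      pw : ∀ x y → (∀ n → seq x n ≡ seq y n) → x ≈ʳ y
      pw x y = ≈ʳ-pointwise {x} {y}

    ⌊⌋-+ : ∀ p q → ⌊ p ℚ.+ q ⌋ ≈ʳ ⌊ p ⌋ +ʳ ⌊ q ⌋
    ⌊⌋-+ p q = ≈ʳ-pointwise {⌊ p ℚ.+ q ⌋} {⌊ p ⌋ +ʳ ⌊ q ⌋} λ _ → refl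

    ⌊⌋-* : ∀ p q → ⌊ p ℚ.* q ⌋ ≈ʳ ⌊ p ⌋ *ʳ ⌊ q ⌋
    ⌊⌋-* p q = ≈ʳ-pointwise {⌊ p ℚ.* q ⌋} {⌊ p ⌋ *ʳ ⌊ q ⌋} λ _ → refl

    ⌊⌋-neg : ∀ p → ⌊ ℚ.- p ⌋ ≈ʳ -ʳ ⌊ p ⌋
    ⌊⌋-neg p = ≈ʳ-pointwise {⌊ ℚ.- p ⌋} { -ʳ ⌊ p ⌋} λ _ → refl

    ≤ʳ-pointwise : ∀ {x y} → (∀ n → seq x n ℚ.≤ seq y n) → x ≤ʳ y
    ≤ʳ-pointwise h ε 0<ε = always λ n → ℚ.≤-trans (h n) (≤+eps 0<ε)

    ≤ʳ-reflexive : ∀ {x y} → x ≈ʳ y → x ≤ʳ y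
    ≤ʳ-reflexive {x} {y} h ε 0<ε = eventually-map
      (λ n p → -≤⇒≤+ (ℚ.≤-trans ≤∣ seq x n ℚ.- seq y n ∣ (ℚ.<⇒≤ p))) (h ε 0<ε)

    ≤ʳ-trans : ∀ {x y z} → x ≤ʳ y → y ≤ʳ z → x ≤ʳ z
    ≤ʳ-trans {x} {y} {z} h k ε 0<ε = eventually-zip (λ n → trans-eps {seq x n} {seq y n} {seq z n} {ε}) (h _ (½-pos 0<ε)) (k _ (½-pos 0<ε))

    ≤ʳ-antisym : ∀ {x y} → x ≤ʳ y → y ≤ʳ x → x ≈ʳ y
    ≤ʳ-antisym {x} {y} h k ε 0<ε = eventually-zip (λ n p q → ℚ.≤-<-trans (∣-∣-least {seq x n} {seq y n} p q) (half< 0<ε))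
      (h _ (½-pos 0<ε)) (k _ (½-pos 0<ε))

    +ʳ-mono-≤ : ∀ {x y u v} → x ≤ʳ y → u ≤ʳ v → x +ʳ u ≤ʳ y +ʳ v
    +ʳ-mono-≤ {x} {y} {u} {v} h k ε 0<ε = eventually-zip
      (λ n → +-eps {seq x n} {seq y n} {seq u n} {seq v n} {ε}) (h _ (½-pos 0<ε)) (k _ (½-pos 0<ε))

    ⌊⌋-mono : ∀ {p q} → p ℚ.≤ q → ⌊ p ⌋ ≤ʳ ⌊ q ⌋
    ⌊⌋-mono {p} {q} p≤q = ≤ʳ-pointwise {⌊ p ⌋} {⌊ q ⌋} λ _ → p≤q

    -- Rationals can be compared: if q < p, the tolerance (p - q)/2 leads to p < p.
    ⌊⌋-reflects : ∀ {p q} → ⌊ p ⌋ ≤ʳ ⌊ q ⌋ → p ℚ.≤ q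
    ⌊⌋-reflects {p} {q} h = ℚ.≮⇒≥ λ q<p →
      let 0<p-q = subst (ℚ._< p ℚ.- q) (ℚ.+-inverseʳ q) (ℚ.+-monoˡ-< (ℚ.- q) q<p)
          (N , k) = h _ (½-pos 0<p-q)
      in ℚ.<-irrefl refl (ℚ.≤-<-trans (k N ℕ.≤-refl)
           (subst (q ℚ.+ ½ ℚ.* (p ℚ.- q) ℚ.<_) (sym (p≡q+[p-q] p q)) (ℚ.+-monoʳ-< q (half< 0<p-q))))

    ≤ʳ-approx : ∀ {x y} → (∀ ε → 0ℚ ℚ.< ε → x ≤ʳ y +ʳ ⌊ ε ⌋) → x ≤ʳ y
    ≤ʳ-approx {x} {y} h ε 0<ε = eventually-map
      (λ n p → ℚ.≤-trans p (ℚ.≤-reflexive (trans (ℚ.+-assoc (seq y n) (½ ℚ.* ε) (½ ℚ.* ε))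
        (cong (seq y n ℚ.+_) (half+half ε)))))
      (h _ (½-pos 0<ε) _ (½-pos 0<ε))

    upper-bound : ∀ x → ∃[ b ] 0ℚ ℚ.< b × x ≤ʳ ⌊ b ⌋
    upper-bound x =
      let (B , 0<B , h) = eventually-bounded x
      in B , 0<B , λ ε 0<ε → eventually-map
           (λ n p → ℚ.≤-trans ≤∣ seq x n ∣ (ℚ.≤-trans (ℚ.<⇒≤ p) (≤+eps 0<ε))) h

    rational-approx : ∀ x ε → 0ℚ ℚ.< ε → ∃[ p ] absʳ (x -ʳ ⌊ p ⌋) ≤ʳ ⌊ ε ⌋
    rational-approx x ε 0<ε =
      let (N , h) = cauchy x ε 0<ε
      in seq x N , λ η 0<η → N , λ n p → ℚ.≤-trans (ℚ.<⇒≤ (h n N p ℕ.≤-refl)) (≤+eps 0<η)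

    absʳ-nonneg : ∀ x → ⌊ 0ℚ ⌋ ≤ʳ absʳ x
    absʳ-nonneg x = ≤ʳ-pointwise {⌊ 0ℚ ⌋} {absʳ x} λ n → ℚ.0≤∣p∣ (seq x n)

    ≤absʳ : ∀ x → x ≤ʳ absʳ x
    ≤absʳ x = ≤ʳ-pointwise {x} {absʳ x} λ n → ≤∣ seq x n ∣

    absʳ-least : ∀ {x y} → x ≤ʳ y → -ʳ x ≤ʳ y → absʳ x ≤ʳ y
    absʳ-least h k ε 0<ε = eventually-zip (λ n → ∣∣-least) (h ε 0<ε) (k ε 0<ε)

    absʳ-neg : ∀ x → absʳ (-ʳ x) ≈ʳ absʳ x
    absʳ-neg x = ≈ʳ-pointwise {absʳ (-ʳ x)} {absʳ x} λ n → ℚ.∣-p∣≡∣p∣ (seq x n)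

    absʳ-+ : ∀ x y → absʳ (x +ʳ y) ≤ʳ absʳ x +ʳ absʳ y
    absʳ-+ x y = ≤ʳ-pointwise {absʳ (x +ʳ y)} {absʳ x +ʳ absʳ y} λ n → ℚ.∣p+q∣≤∣p∣+∣q∣ (seq x n) (seq y n)

    absʳ-* : ∀ x y → absʳ (x *ʳ y) ≈ʳ absʳ x *ʳ absʳ y
    absʳ-* x y = ≈ʳ-pointwise {absʳ (x *ʳ y)} {absʳ x *ʳ absʳ y} λ n → ℚ.∣p*q∣≡∣p∣*∣q∣ (seq x n) (seq y n)

    absʳ-⌊⌋ : ∀ p → absʳ ⌊ p ⌋ ≈ʳ ⌊ ∣ p ∣ ⌋
    absʳ-⌊⌋ p = ≈ʳ-pointwise {absʳ ⌊ p ⌋} {⌊ ∣ p ∣ ⌋} λ _ → refl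

    absʳ-cong : ∀ {x y} → x ≈ʳ y → absʳ x ≈ʳ absʳ y
    absʳ-cong {x} {y} h ε 0<ε = eventually-map
      (λ n → ℚ.≤-<-trans (∣∣-reverse-triangle (seq x n) (seq y n))) (h ε 0<ε)

    square-nonnegʳ : ∀ x → ⌊ 0ℚ ⌋ ≤ʳ x *ʳ x
    square-nonnegʳ x = ≤ʳ-pointwise {⌊ 0ℚ ⌋} {x *ʳ x} λ n → square-nonneg (seq x n)

    absʳ*absʳ-nonneg : ∀ x y → ⌊ 0ℚ ⌋ ≤ʳ absʳ x *ʳ absʳ y
    absʳ*absʳ-nonneg x y = ≤ʳ-pointwise {⌊ 0ℚ ⌋} {absʳ x *ʳ absʳ y}
      λ n → *-nonneg (ℚ.0≤∣p∣ (seq x n)) (ℚ.0≤∣p∣ (seq y n))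

    -- At tolerance ε²/2, a term with ∣x∣ ≥ ε would satisfy ε² ≤ x² ≤ ε²/2.
    square≤0⇒≈0 : ∀ x → x *ʳ x ≤ʳ ⌊ 0ℚ ⌋ → x ≈ʳ ⌊ 0ℚ ⌋
    square≤0⇒≈0 x h ε 0<ε = eventually-map (λ n p → ℚ.≰⇒> λ ε≤ → ℚ.<-irrefl refl (begin-strict
        ½ ℚ.* (ε ℚ.* ε)              <⟨ half< (*-pos 0<ε 0<ε) ⟩
        ε ℚ.* ε                      ≤⟨ *-monoʳ ε (ℚ.<⇒≤ 0<ε) ε≤ ⟩
        ∣ seq x n ℚ.- 0ℚ ∣ ℚ.* ε     ≤⟨ *-monoˡ _ (ℚ.0≤∣p∣ (seq x n ℚ.- 0ℚ)) ε≤ ⟩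
        ∣ seq x n ℚ.- 0ℚ ∣ ℚ.* ∣ seq x n ℚ.- 0ℚ ∣ ≡⟨ sym (ℚ.∣p*q∣≡∣p∣*∣q∣ (seq x n ℚ.- 0ℚ) (seq x n ℚ.- 0ℚ)) ⟩
        ∣ (seq x n ℚ.- 0ℚ) ℚ.* (seq x n ℚ.- 0ℚ) ∣ ≡⟨ cong (λ y → ∣ y ℚ.* y ∣) (ℚ.+-identityʳ (seq x n)) ⟩
        ∣ seq x n ℚ.* seq x n ∣      ≡⟨ ℚ.0≤p⇒∣p∣≡p (square-nonneg (seq x n)) ⟩
        seq x n ℚ.* seq x n          ≤⟨ p ⟩
        0ℚ ℚ.+ ½ ℚ.* (ε ℚ.* ε)       ≡⟨ ℚ.+-identityˡ (½ ℚ.* (ε ℚ.* ε)) ⟩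
        ½ ℚ.* (ε ℚ.* ε)              ∎))
      (h _ (½-pos (*-pos 0<ε 0<ε)))
      where open ℚ.≤-Reasoning

    <ᴿ⇒≤ʳ : ∀ {x y} → x <ᴿ y → x ≤ʳ y
    <ᴿ⇒≤ʳ {x} {y} (δ , 0<δ , h) ε 0<ε = eventually-map
      (λ n p → ℚ.≤-trans (≤+eps 0<δ) (ℚ.≤-trans p (≤+eps 0<ε))) h

    0<⇒lower : ∀ {x} → 0ᴿ <ᴿ x → ∃[ q ] 0ℚ ℚ.< q × ⌊ q ⌋ ≤ʳ x
    0<⇒lower {x} (δ , 0<δ , h) = δ , 0<δ , λ ε 0<ε → eventually-map
      (λ n p → ℚ.≤-trans (ℚ.≤-reflexive (sym (ℚ.+-identityˡ δ))) (ℚ.≤-trans p (≤+eps 0<ε))) h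

    -- `_<ᴿ_` asks for one rational gap in all late terms. Of the three thirds of q - p, each
    -- inequality `_≤ʳ_` costs one and the last is the gap.
    <ᴿ-between : ∀ {x y p q} → p ℚ.< q → x ≤ʳ ⌊ p ⌋ → ⌊ q ⌋ ≤ʳ y → x <ᴿ y
    <ᴿ-between {x} {y} {p} {q} p<q h k = δ , 0<δ , eventually-zip
      (λ n a b → begin
        seq x n ℚ.+ δ       ≤⟨ ℚ.+-monoˡ-≤ δ a ⟩
        p ℚ.+ δ ℚ.+ δ       ≡⟨ solve 2 (λ p d → p :+ d :+ d := p :+ ((con 1ℚ :+ con 1ℚ) :+ con 1ℚ) :* d :- d)
                                 refl p δ ⟩
        p ℚ.+ (1ℚ ℚ.+ 1ℚ ℚ.+ 1ℚ) ℚ.* δ ℚ.- δ ≡⟨ cong (ℚ._- δ) p+3δ≡q ⟩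
        q ℚ.- δ             ≤⟨ ℚ.+-monoˡ-≤ (ℚ.- δ) b ⟩
        seq y n ℚ.+ δ ℚ.- δ ≡⟨ solve 2 (λ y d → y :+ d :- d := y) refl (seq y n) δ ⟩
        seq y n             ∎)
      (h δ 0<δ) (k δ 0<δ)
      where
      open ℚ.≤-Reasoning
      open +-*-Solver
      0<q-p : 0ℚ ℚ.< q ℚ.- p
      0<q-p = subst (ℚ._< q ℚ.- p) (ℚ.+-inverseʳ p) (ℚ.+-monoˡ-< (ℚ.- p) p<q)
      δ : ℚ
      δ = 1/suc 2 ℚ.* (q ℚ.- p)
      0<δ : 0ℚ ℚ.< δ
      0<δ = *-pos (1/suc-pos 2) 0<q-p
      p+3δ≡q : p ℚ.+ (1ℚ ℚ.+ 1ℚ ℚ.+ 1ℚ) ℚ.* δ ≡ q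
      p+3δ≡q = solve 2 (λ p q → p :+ (con 1ℚ :+ con 1ℚ :+ con 1ℚ) :* (con (1/suc 2) :* (q :- p)) := q) refl p q

    inverse-nonneg : ∀ x 0<x → ⌊ 0ℚ ⌋ ≤ʳ inverse x 0<x
    inverse-nonneg x 0<x@(δ , 0<δ , N , h) = ≤ʳ-pointwise {⌊ 0ℚ ⌋} {inverse x 0<x}
      λ n → ℚ.<⇒≤ (recip-pos (seq x n ℚ.⊔ δ) (⊔-pos (seq x n) 0<δ))

    inverse-inverseˡ : ∀ x 0<x → inverse x 0<x *ʳ x ≈ʳ ⌊ 1ℚ ⌋
    inverse-inverseˡ x (δ , 0<δ , N , h) ε 0<ε = N , λ n p → subst (ℚ._< ε)
      (cong (λ y → ∣ y ℚ.- 1ℚ ∣) (sym (trans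
        (cong (recip (seq x n ℚ.⊔ δ) (⊔-pos (seq x n) 0<δ) ℚ.*_) (sym (fix n p)))
        (recip-inverseˡ (seq x n ℚ.⊔ δ) (⊔-pos (seq x n) 0<δ))))) 0<ε
      where
      fix : ∀ n → N ℕ.≤ n → seq x n ℚ.⊔ δ ≡ seq x n
      fix n p = ℚ.p≥q⇒p⊔q≡p (subst (ℚ._≤ seq x n) (ℚ.+-identityˡ δ) (h n p))

    limit-of-rationals : ∀ (u : ℕ → ℚ) (c : IsCauchy u) ε → 0ℚ ℚ.< ε →
                         Eventually λ n → absʳ (⌊ u n ⌋ -ʳ mkℝ u c) ≤ʳ ⌊ ε ⌋
    limit-of-rationals u c ε 0<ε =
      let (N , h) = c ε 0<ε
      in N , λ n p η 0<η → N , λ m q → ℚ.≤-trans (ℚ.<⇒≤ (h n m p q)) (≤+eps 0<η)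

  ℝ-ring : CommutativeRing 0ℓ 0ℓ
  ℝ-ring = record { isCommutativeRing = ℝ-isCommutativeRing }

open Reals

-- Order estimates and completeness of the reals.

module RealOrder where
  0ʳ 1ʳ : ℝ
  0ʳ = ⌊ 0ℚ ⌋
  1ʳ = ⌊ 1ℚ ⌋

  -- Rational coefficients let the ring solver work with constants such as `½`: their equality is
  -- decidable, whereas that of reals is not.
  ℚ→ℝ : CommutativeRing.rawRing ℚ.+-*-commutativeRing -Raw-AlmostCommutative⟶ fromCommutativeRing ℝ-ring
  ℚ→ℝ = record
    { ⟦_⟧ = ⌊_⌋ ; +-homo = ⌊⌋-+ ; *-homo = ⌊⌋-* ; -‿homo = ⌊⌋-neg
    ; 0-homo = ≈ʳ-refl ; 1-homo = ≈ʳ-refl }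

  ⌊⌋-≟ : ∀ p q → Maybe (⌊ p ⌋ ≈ʳ ⌊ q ⌋)
  ⌊⌋-≟ p q with p ℚ.≟ q
  ... | yes p≡q = just (≡.subst (λ r → ⌊ p ⌋ ≈ʳ ⌊ r ⌋) p≡q ≈ʳ-refl)
  ... | no  _   = nothing

  module ℝS = Algebra.Solver.Ring
    (CommutativeRing.rawRing ℚ.+-*-commutativeRing) (fromCommutativeRing ℝ-ring) ℚ→ℝ ⌊⌋-≟

  open ℝS public using ()
    renaming (solve to solveʳ; con to conʳ; _:=_ to _⊜_; _:+_ to _⊕_; _:*_ to _⊗_; _:-_ to _⊖_; :-_ to ⊖_)

  ℝ-poset : Poset 0ℓ 0ℓ 0ℓ
  ℝ-poset = record
    { isPartialOrder = record
      { isPreorder = record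
        { isEquivalence = CommutativeRing.isEquivalence ℝ-ring
        ; reflexive = ≤ʳ-reflexive
        ; trans = ≤ʳ-trans
        }
      ; antisym = ≤ʳ-antisym
      }
    }

  module ℝ-Reasoning = Relation.Binary.Reasoning.PartialOrder ℝ-poset
  open CommutativeRing ℝ-ring public using ()
    renaming (+-identityˡ to +ʳ-identityˡ; +-identityʳ to +ʳ-identityʳ; *-identityˡ to *ʳ-identityˡ;
              *-identityʳ to *ʳ-identityʳ; zeroˡ to *ʳ-zeroˡ; zeroʳ to *ʳ-zeroʳ; +-comm to +ʳ-comm;
              *-comm to *ʳ-comm; +-assoc to +ʳ-assoc; *-assoc to *ʳ-assoc; -‿inverseʳ to -ʳ-inverseʳ)

  ≤ʳ-refl : ∀ {x} → x ≤ʳ x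
  ≤ʳ-refl = ≤ʳ-reflexive ≈ʳ-refl

  ⌊⌋-cong : ∀ {p q} → p ≡ q → ⌊ p ⌋ ≈ʳ ⌊ q ⌋
  ⌊⌋-cong ≡.refl = ≈ʳ-refl

  ⌊⌋-nonneg : ∀ {p} → 0ℚ ℚ.≤ p → 0ʳ ≤ʳ ⌊ p ⌋
  ⌊⌋-nonneg = ⌊⌋-mono

  +ʳ-nonneg : ∀ {x y} → 0ʳ ≤ʳ x → 0ʳ ≤ʳ y → 0ʳ ≤ʳ x +ʳ y
  +ʳ-nonneg h k = ≤ʳ-trans (≤ʳ-reflexive (≈ʳ-sym (+ʳ-identityˡ 0ʳ))) (+ʳ-mono-≤ h k)

  ≤ʳ⇒0≤- : ∀ {x y} → x ≤ʳ y → 0ʳ ≤ʳ y -ʳ x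
  ≤ʳ⇒0≤- {x} {y} h = ≤ʳ-trans (≤ʳ-reflexive (≈ʳ-sym (-ʳ-inverseʳ x))) (+ʳ-mono-≤ h ≤ʳ-refl)

  0≤-⇒≤ʳ : ∀ {x y} → 0ʳ ≤ʳ y -ʳ x → x ≤ʳ y
  0≤-⇒≤ʳ {x} {y} h = ≤ʳ-trans (≤ʳ-reflexive (≈ʳ-sym (+ʳ-identityˡ x)))
    (≤ʳ-trans (+ʳ-mono-≤ h ≤ʳ-refl) (≤ʳ-reflexive (solve 2 (λ x y → y :- x :+ x := y) ≈ʳ-refl x y)))
    where open ℝS

  absʳ-of-nonneg : ∀ {x} → 0ʳ ≤ʳ x → absʳ x ≈ʳ x
  absʳ-of-nonneg {x} 0≤x = ≤ʳ-antisym (absʳ-least ≤ʳ-refl -x≤x) (≤absʳ x)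
    where
    open ℝS
    -x≤x : -ʳ x ≤ʳ x
    -x≤x = 0≤-⇒≤ʳ (≤ʳ-trans (+ʳ-nonneg 0≤x 0≤x)
      (≤ʳ-reflexive (solve 1 (λ x → x :+ x := x :- (:- x)) ≈ʳ-refl x)))

  -- A nonnegative real may have negative terms, so the termwise argument is applied to the absolute
  -- values, which are equal to x and y.
  *ʳ-nonneg : ∀ {x y} → 0ʳ ≤ʳ x → 0ʳ ≤ʳ y → 0ʳ ≤ʳ x *ʳ y
  *ʳ-nonneg {x} {y} h k = ≤ʳ-trans (absʳ*absʳ-nonneg x y)
    (≤ʳ-reflexive (*ʳ-cong (absʳ-of-nonneg h) (absʳ-of-nonneg k)))

  *ʳ-monoˡ : ∀ z {x y} → 0ʳ ≤ʳ z → x ≤ʳ y → z *ʳ x ≤ʳ z *ʳ y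
  *ʳ-monoˡ z {x} {y} h k = 0≤-⇒≤ʳ (≤ʳ-trans (*ʳ-nonneg h (≤ʳ⇒0≤- k))
    (≤ʳ-reflexive (solve 3 (λ x y z → z :* (y :- x) := z :* y :- z :* x) ≈ʳ-refl x y z)))
    where open ℝS

  *ʳ-monoʳ : ∀ z {x y} → 0ʳ ≤ʳ z → x ≤ʳ y → x *ʳ z ≤ʳ y *ʳ z
  *ʳ-monoʳ z {x} {y} h k = ≤ʳ-trans (≤ʳ-reflexive (*ʳ-comm x z))
    (≤ʳ-trans (*ʳ-monoˡ z h k) (≤ʳ-reflexive (*ʳ-comm z y)))

  *ʳ-mono-≤ : ∀ {x y u v} → 0ʳ ≤ʳ y → 0ʳ ≤ʳ u → x ≤ʳ y → u ≤ʳ v → x *ʳ u ≤ʳ y *ʳ v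
  *ʳ-mono-≤ {y = y} {u = u} 0≤y 0≤u h k = ≤ʳ-trans (*ʳ-monoʳ u 0≤u h) (*ʳ-monoˡ y 0≤y k)

  absʳ-square : ∀ x → absʳ x *ʳ absʳ x ≈ʳ x *ʳ x
  absʳ-square x = ≈ʳ-trans (≈ʳ-sym (absʳ-* x x)) (absʳ-of-nonneg (square-nonnegʳ x))

  absʳ-sub : ∀ x y → absʳ (x -ʳ y) ≈ʳ absʳ (y -ʳ x)
  absʳ-sub x y = ≈ʳ-trans (≈ʳ-sym (absʳ-neg (x -ʳ y)))
    (absʳ-cong (solve 2 (λ x y → :- (x :- y) := y :- x) ≈ʳ-refl x y))
    where open ℝS

  absʳ-triangle : ∀ x y z → absʳ (x -ʳ z) ≤ʳ absʳ (x -ʳ y) +ʳ absʳ (y -ʳ z)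
  absʳ-triangle x y z = ≤ʳ-trans
    (≤ʳ-reflexive (absʳ-cong (solve 3 (λ x y z → x :- z := x :- y :+ (y :- z)) ≈ʳ-refl x y z)))
    (absʳ-+ (x -ʳ y) (y -ʳ z))
    where open ℝS

  -- The later index is written `j ℕ.+ m` so that tails can be estimated by induction on j.
  IsCauchyʳ : (ℕ → ℝ) → Set
  IsCauchyʳ u = ∀ ε → 0ℚ ℚ.< ε → ∃[ N ] ∀ m → N ℕ.≤ m → ∀ j → absʳ (u (j ℕ.+ m) -ʳ u m) ≤ʳ ⌊ ε ⌋

  -- A rational within 2⁻ⁿ of `u n` is chosen for each n. These rationals form a Cauchy sequence,
  -- which as a real number is the limit.
  module Completeness (u : ℕ → ℝ) (u-cauchy : IsCauchyʳ u) where

    opaque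
      approximant : ℕ → ℚ
      approximant n = proj₁ (rational-approx (u n) (2⁻ n) (2⁻-pos n))

      approximant-close : ∀ n → absʳ (u n -ʳ ⌊ approximant n ⌋) ≤ʳ ⌊ 2⁻ n ⌋
      approximant-close n = proj₂ (rational-approx (u n) (2⁻ n) (2⁻-pos n))

    approximant-eventually : ∀ ε → 0ℚ ℚ.< ε → Eventually λ n → absʳ (u n -ʳ ⌊ approximant n ⌋) ≤ʳ ⌊ ε ⌋
    approximant-eventually ε 0<ε = eventually-map
      (λ n p → ≤ʳ-trans (approximant-close n) (⌊⌋-mono (≡.subst (ℚ._≤ ε) (ℚ.*-identityˡ (2⁻ n)) p)))
      (2⁻-null 1ℚ ε 0<ε)

    from-start : ∀ ε → 0ℚ ℚ.< ε → ∃[ N ] ∀ m → N ℕ.≤ m → absʳ (u m -ʳ u N) ≤ʳ ⌊ ε ⌋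
    from-start ε 0<ε =
      let (N , h) = u-cauchy ε 0<ε
      in N , λ m p → ≡.subst (λ k → absʳ (u k -ʳ u N) ≤ʳ ⌊ ε ⌋) (ℕ.m∸n+n≡m p) (h N ℕ.≤-refl (m ℕ.∸ N))

    to-start : ∀ ε → 0ℚ ℚ.< ε → ∃[ N ] Eventually λ m → absʳ (u N -ʳ ⌊ approximant m ⌋) ≤ʳ ⌊ ε ⌋
    to-start ε 0<ε =
      let (N , h) = from-start _ (½-pos 0<ε)
      in N , eventually-zip
        (λ m p q → ≤ʳ-trans (absʳ-triangle (u N) (u m) ⌊ approximant m ⌋)
          (≤ʳ-trans (+ʳ-mono-≤ (≤ʳ-trans (≤ʳ-reflexive (absʳ-sub (u N) (u m))) p) q)
            (≤ʳ-reflexive (≈ʳ-trans (≈ʳ-sym (⌊⌋-+ (½ ℚ.* ε) (½ ℚ.* ε))) (⌊⌋-cong (half+half ε))))))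
        (N , h) (approximant-eventually _ (½-pos 0<ε))

    -- The triangle inequality through `u N` takes place in `ℝ`; `⌊⌋-reflects` brings it back to ℚ,
    -- where `IsCauchy` is stated.
    approximants-close : ∀ N η m n → absʳ (u N -ʳ ⌊ approximant m ⌋) ≤ʳ ⌊ η ⌋ →
                         absʳ (u N -ʳ ⌊ approximant n ⌋) ≤ʳ ⌊ η ⌋ →
                         ∣ approximant m ℚ.- approximant n ∣ ℚ.≤ η ℚ.+ η
    approximants-close N η m n p q = ⌊⌋-reflects (begin
      ⌊ ∣ a ℚ.- b ∣ ⌋                           ≈⟨ absʳ-⌊⌋ (a ℚ.- b) ⟨
      absʳ ⌊ a ℚ.- b ⌋                          ≈⟨ absʳ-cong (⌊⌋-+ a (ℚ.- b)) ⟩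
      absʳ (⌊ a ⌋ +ʳ ⌊ ℚ.- b ⌋)                 ≈⟨ absʳ-cong (+ʳ-cong ≈ʳ-refl (⌊⌋-neg b)) ⟩
      absʳ (⌊ a ⌋ -ʳ ⌊ b ⌋)                     ≤⟨ absʳ-triangle ⌊ a ⌋ (u N) ⌊ b ⌋ ⟩
      absʳ (⌊ a ⌋ -ʳ u N) +ʳ absʳ (u N -ʳ ⌊ b ⌋) ≤⟨ +ʳ-mono-≤ (≤ʳ-trans (≤ʳ-reflexive (absʳ-sub ⌊ a ⌋ (u N))) p) q ⟩
      ⌊ η ⌋ +ʳ ⌊ η ⌋                            ≈⟨ ⌊⌋-+ η η ⟨
      ⌊ η ℚ.+ η ⌋                               ∎)
      where
      open ℝ-Reasoning
      a = approximant m
      b = approximant n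

    opaque
      approximant-cauchy : IsCauchy approximant
      approximant-cauchy ε 0<ε =
        -- A quarter of ε: two approximants this close to `u N` differ by at most ε/2, which leaves
        -- room for the strict bound ε.
        let (N , K , h) = to-start (½ ℚ.* (½ ℚ.* ε)) (½-pos (½-pos 0<ε))
        in K , λ m n p q → ℚ.≤-<-trans
          (≡.subst (∣ approximant m ℚ.- approximant n ∣ ℚ.≤_) (half+half (½ ℚ.* ε))
            (approximants-close N (½ ℚ.* (½ ℚ.* ε)) m n (h m p) (h n q)))
          (half< {ε} 0<ε)

    limit : ℝ
    limit = mkℝ approximant approximant-cauchy

    limit-converges : ∀ ε → 0ℚ ℚ.< ε → Eventually λ n → absʳ (u n -ʳ limit) ≤ʳ ⌊ ε ⌋
    limit-converges ε 0<ε = eventually-zip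
      (λ n p q → ≤ʳ-trans (absʳ-triangle (u n) ⌊ approximant n ⌋ limit) (≤ʳ-trans (+ʳ-mono-≤ p q)
        (≤ʳ-reflexive (≈ʳ-trans (≈ʳ-sym (⌊⌋-+ (½ ℚ.* ε) (½ ℚ.* ε))) (⌊⌋-cong (half+half ε))))))
      (approximant-eventually _ (½-pos 0<ε))
      (limit-of-rationals approximant approximant-cauchy _ (½-pos 0<ε))

open RealOrder

-- The complex numbers: ring structure, conjugation and norms.

module ComplexNumbers where
  infix  4 _≈_
  infixl 6 _+_
  infixl 7 _*_
  infix  8 -_

  opaque
    _≈_ : ℂ → ℂ → Set
    z ≈ w = re z ≈ʳ re w × im z ≈ʳ im w

    _+_ _*_ : ℂ → ℂ → ℂ
    z + w = (re z +ʳ re w) +i (im z +ʳ im w)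
    z * w = (re z *ʳ re w -ʳ im z *ʳ im w) +i (re z *ʳ im w +ʳ im z *ʳ re w)

    -_ : ℂ → ℂ
    - z = (-ʳ re z) +i (-ʳ im z)

    ι : ℝ → ℂ
    ι x = x +i 0ʳ

    𝕚 : ℂ
    𝕚 = 0ʳ +i 1ʳ

    infix 9 _̄
    _̄ : ℂ → ℂ
    z ̄ = re z +i (-ʳ im z)

    -- The ℓ¹ norm is submultiplicative and needs no square root.
    ‖_‖ : ℂ → ℝ
    ‖ z ‖ = absʳ (re z) +ʳ absʳ (im z)

    normSqʳ : ℂ → ℝ
    normSqʳ z = re z *ʳ re z +ʳ im z *ʳ im z

  0# 1# : ℂ
  0# = ι 0ʳ
  1# = ι 1ʳ

  open ℝS

  opaque
    unfolding _≈_

    re-cong : ∀ {z w} → z ≈ w → re z ≈ʳ re w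
    re-cong = proj₁

    ℂ-isCommutativeRing : IsCommutativeRing _≈_ _+_ _*_ -_ 0# 1#
    ℂ-isCommutativeRing = record
      { isRing = record
        { +-isAbelianGroup = record
          { isGroup = record
            { isMonoid = record
              { isSemigroup = record
                { isMagma = record
                  { isEquivalence = record
                    { refl  = ≈ʳ-refl , ≈ʳ-refl
                    ; sym   = λ (p , q) → ≈ʳ-sym p , ≈ʳ-sym q
                    ; trans = λ (p , q) (p′ , q′) → ≈ʳ-trans p p′ , ≈ʳ-trans q q′
                    }
                  ; ∙-cong = λ (p , q) (p′ , q′) → +ʳ-cong p p′ , +ʳ-cong q q′
                  }
                ; assoc = λ x y z → +ʳ-assoc (re x) (re y) (re z) , +ʳ-assoc (im x) (im y) (im z)
                }
              ; identity = (λ x → +ʳ-identityˡ (re x) , +ʳ-identityˡ (im x))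
                         , (λ x → +ʳ-identityʳ (re x) , +ʳ-identityʳ (im x))
              }
            ; inverse = (λ x → -ʳ-inverseˡ (re x) , -ʳ-inverseˡ (im x))
                      , (λ x → -ʳ-inverseʳ (re x) , -ʳ-inverseʳ (im x))
            ; ⁻¹-cong = λ (p , q) → -ʳ-cong p , -ʳ-cong q
            }
          ; comm = λ x y → +ʳ-comm (re x) (re y) , +ʳ-comm (im x) (im y)
          }
        ; *-cong = λ (p , q) (p′ , q′) →
            +ʳ-cong (*ʳ-cong p p′) (-ʳ-cong (*ʳ-cong q q′)) , +ʳ-cong (*ʳ-cong p q′) (*ʳ-cong q p′)
        ; *-assoc = λ x y z →
            solve 6 (λ a b c d e f → (a :* c :- b :* d) :* e :- (a :* d :+ b :* c) :* f
                                  := a :* (c :* e :- d :* f) :- b :* (c :* f :+ d :* e)) ≈ʳ-refl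
              (re x) (im x) (re y) (im y) (re z) (im z) ,
            solve 6 (λ a b c d e f → (a :* c :- b :* d) :* f :+ (a :* d :+ b :* c) :* e
                                  := a :* (c :* f :+ d :* e) :+ b :* (c :* e :- d :* f)) ≈ʳ-refl
              (re x) (im x) (re y) (im y) (re z) (im z)
        ; *-identity =
            (λ x → solve 2 (λ a b → con 1ℚ :* a :- con 0ℚ :* b := a) ≈ʳ-refl (re x) (im x) ,
                   solve 2 (λ a b → con 1ℚ :* b :+ con 0ℚ :* a := b) ≈ʳ-refl (re x) (im x)) ,
            (λ x → solve 2 (λ a b → a :* con 1ℚ :- b :* con 0ℚ := a) ≈ʳ-refl (re x) (im x) ,
                   solve 2 (λ a b → a :* con 0ℚ :+ b :* con 1ℚ := b) ≈ʳ-refl (re x) (im x))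
        ; distrib =
            (λ x y z →
              solve 6 (λ a b c d e f → a :* (c :+ e) :- b :* (d :+ f)
                                    := (a :* c :- b :* d) :+ (a :* e :- b :* f)) ≈ʳ-refl
                (re x) (im x) (re y) (im y) (re z) (im z) ,
              solve 6 (λ a b c d e f → a :* (d :+ f) :+ b :* (c :+ e)
                                    := (a :* d :+ b :* c) :+ (a :* f :+ b :* e)) ≈ʳ-refl
                (re x) (im x) (re y) (im y) (re z) (im z)) ,
            (λ x y z →
              solve 6 (λ a b c d e f → (c :+ e) :* a :- (d :+ f) :* b
                                    := (c :* a :- d :* b) :+ (e :* a :- f :* b)) ≈ʳ-refl
                (re x) (im x) (re y) (im y) (re z) (im z) ,
              solve 6 (λ a b c d e f → (c :+ e) :* b :+ (d :+ f) :* a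
                                    := (c :* b :+ d :* a) :+ (e :* b :+ f :* a)) ≈ʳ-refl
                (re x) (im x) (re y) (im y) (re z) (im z))
        }
      ; *-comm = λ x y →
          solve 4 (λ a b c d → a :* c :- b :* d := c :* a :- d :* b) ≈ʳ-refl (re x) (im x) (re y) (im y) ,
          solve 4 (λ a b c d → a :* d :+ b :* c := c :* b :+ d :* a) ≈ʳ-refl (re x) (im x) (re y) (im y)
      }
      where
      -ʳ-inverseˡ : ∀ x → -ʳ x +ʳ x ≈ʳ 0ʳ
      -ʳ-inverseˡ = CommutativeRing.-‿inverseˡ ℝ-ring

    ι-cong : ∀ {x y} → x ≈ʳ y → ι x ≈ ι y
    ι-cong h = h , ≈ʳ-refl

    ι-+ : ∀ x y → ι (x +ʳ y) ≈ ι x + ι y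
    ι-+ x y = ≈ʳ-refl , ≈ʳ-sym (+ʳ-identityˡ 0ʳ)

    ι-* : ∀ x y → ι (x *ʳ y) ≈ ι x * ι y
    ι-* x y = solve 2 (λ x y → x :* y := x :* y :- con 0ℚ :* con 0ℚ) ≈ʳ-refl x y
            , solve 2 (λ x y → con 0ℚ := x :* con 0ℚ :+ con 0ℚ :* y) ≈ʳ-refl x y

    ι-neg : ∀ x → ι (-ʳ x) ≈ - ι x
    ι-neg x = ≈ʳ-refl , solve 0 (con 0ℚ := :- con 0ℚ) ≈ʳ-refl

    𝕚*𝕚≈-1 : 𝕚 * 𝕚 ≈ - 1#
    𝕚*𝕚≈-1 = solve 0 (con 0ℚ :* con 0ℚ :- con 1ℚ :* con 1ℚ := :- con 1ℚ) ≈ʳ-refl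
           , solve 0 (con 0ℚ :* con 1ℚ :+ con 1ℚ :* con 0ℚ := :- con 0ℚ) ≈ʳ-refl

    conj-cong : ∀ {z w} → z ≈ w → z ̄ ≈ w ̄
    conj-cong (p , q) = p , -ʳ-cong q

    conj-involutive : ∀ z → z ̄ ̄ ≈ z
    conj-involutive z = ≈ʳ-refl , solve 1 (λ x → :- (:- x) := x) ≈ʳ-refl (im z)

    conj-+ : ∀ z w → (z + w) ̄ ≈ z ̄ + w ̄
    conj-+ z w = ≈ʳ-refl , solve 2 (λ x y → :- (x :+ y) := :- x :+ :- y) ≈ʳ-refl (im z) (im w)

    conj-* : ∀ z w → (z * w) ̄ ≈ z ̄ * w ̄
    conj-* z w =
      solve 4 (λ a b c d → a :* c :- b :* d := a :* c :- :- b :* :- d) ≈ʳ-refl (re z) (im z) (re w) (im w) ,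
      solve 4 (λ a b c d → :- (a :* d :+ b :* c) := a :* :- d :+ :- b :* c) ≈ʳ-refl (re z) (im z) (re w) (im w)

    conj-neg : ∀ z → (- z) ̄ ≈ - (z ̄)
    conj-neg z = ≈ʳ-refl , ≈ʳ-refl

    conj-ι : ∀ x → ι x ̄ ≈ ι x
    conj-ι x = ≈ʳ-refl , solve 0 (:- con 0ℚ := con 0ℚ) ≈ʳ-refl

    conj-𝕚 : 𝕚 ̄ ≈ - 𝕚
    conj-𝕚 = solve 0 (con 0ℚ := :- con 0ℚ) ≈ʳ-refl , ≈ʳ-refl

    self-conj⇒real : ∀ {z} → z ̄ ≈ z → z ≈ ι (re z)
    self-conj⇒real {z} (_ , h) = ≈ʳ-refl , (begin-equality
      im z                            ≈⟨ solve 1 (λ x → x := con ½ :* (x :+ x)) ≈ʳ-refl (im z) ⟩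
      ⌊ ½ ⌋ *ʳ (im z +ʳ im z)         ≈⟨ *ʳ-cong ≈ʳ-refl (+ʳ-cong (≈ʳ-sym h) ≈ʳ-refl) ⟩
      ⌊ ½ ⌋ *ʳ (-ʳ im z +ʳ im z)      ≈⟨ solve 1 (λ x → con ½ :* (:- x :+ x) := con 0ℚ) ≈ʳ-refl (im z) ⟩
      0ʳ                              ∎)
      where open ℝ-Reasoning

    conj*self : ∀ z → z ̄ * z ≈ ι (normSqʳ z)
    conj*self z =
      solve 2 (λ a b → a :* a :- :- b :* b := a :* a :+ b :* b) ≈ʳ-refl (re z) (im z) ,
      solve 2 (λ a b → a :* b :+ :- b :* a := con 0ℚ) ≈ʳ-refl (re z) (im z)

    re-ι : ∀ x → re (ι x) ≈ʳ x
    re-ι x = ≈ʳ-refl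

    re-+ : ∀ z w → re (z + w) ≈ʳ re z +ʳ re w
    re-+ z w = ≈ʳ-refl

    normSqʳ-cong : ∀ {z w} → z ≈ w → normSqʳ z ≈ʳ normSqʳ w
    normSqʳ-cong (p , q) = +ʳ-cong (*ʳ-cong p p) (*ʳ-cong q q)

    normSqʳ-nonneg : ∀ z → 0ʳ ≤ʳ normSqʳ z
    normSqʳ-nonneg z = +ʳ-nonneg (square-nonnegʳ (re z)) (square-nonnegʳ (im z))

    re-square≤normSqʳ : ∀ z → re z *ʳ re z ≤ʳ normSqʳ z
    re-square≤normSqʳ z = ≤ʳ-trans (≤ʳ-reflexive (≈ʳ-sym (+ʳ-identityʳ _))) (+ʳ-mono-≤ ≤ʳ-refl (square-nonnegʳ (im z)))

    im-square≤normSqʳ : ∀ z → im z *ʳ im z ≤ʳ normSqʳ z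
    im-square≤normSqʳ z = ≤ʳ-trans (≤ʳ-reflexive (≈ʳ-sym (+ʳ-identityˡ _))) (+ʳ-mono-≤ (square-nonnegʳ (re z)) ≤ʳ-refl)

    normSqʳ≤0⇒≈0 : ∀ {z} → normSqʳ z ≤ʳ 0ʳ → z ≈ 0#
    normSqʳ≤0⇒≈0 {z} h = square≤0⇒≈0 (re z) (≤ʳ-trans (re-square≤normSqʳ z) h)
                       , square≤0⇒≈0 (im z) (≤ʳ-trans (im-square≤normSqʳ z) h)

    ‖‖-cong : ∀ {z w} → z ≈ w → ‖ z ‖ ≈ʳ ‖ w ‖
    ‖‖-cong (p , q) = +ʳ-cong (absʳ-cong p) (absʳ-cong q)

    ‖‖-nonneg : ∀ z → 0ʳ ≤ʳ ‖ z ‖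
    ‖‖-nonneg z = +ʳ-nonneg (absʳ-nonneg (re z)) (absʳ-nonneg (im z))

    ‖‖-+ : ∀ z w → ‖ z + w ‖ ≤ʳ ‖ z ‖ +ʳ ‖ w ‖
    ‖‖-+ z w = ≤ʳ-trans (+ʳ-mono-≤ (absʳ-+ (re z) (re w)) (absʳ-+ (im z) (im w)))
      (≤ʳ-reflexive (solve 4 (λ a b c d → a :+ c :+ (b :+ d) := a :+ b :+ (c :+ d)) ≈ʳ-refl
        (absʳ (re z)) (absʳ (im z)) (absʳ (re w)) (absʳ (im w))))

    ‖‖-neg : ∀ z → ‖ - z ‖ ≈ʳ ‖ z ‖
    ‖‖-neg z = +ʳ-cong (absʳ-neg (re z)) (absʳ-neg (im z))

    ‖‖-conj : ∀ z → ‖ z ̄ ‖ ≈ʳ ‖ z ‖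
    ‖‖-conj z = +ʳ-cong ≈ʳ-refl (absʳ-neg (im z))

    ‖‖-* : ∀ z w → ‖ z * w ‖ ≤ʳ ‖ z ‖ *ʳ ‖ w ‖
    ‖‖-* z w = ≤ʳ-trans (+ʳ-mono-≤
        (≤ʳ-trans (absʳ-+ _ _) (+ʳ-mono-≤ (prod (re z) (re w))
          (≤ʳ-trans (≤ʳ-reflexive (absʳ-neg _)) (prod (im z) (im w)))))
        (≤ʳ-trans (absʳ-+ _ _) (+ʳ-mono-≤ (prod (re z) (im w)) (prod (im z) (re w)))))
      (≤ʳ-reflexive (solve 4 (λ a b c d → a :* c :+ b :* d :+ (a :* d :+ b :* c) := (a :+ b) :* (c :+ d)) ≈ʳ-refl
        (absʳ (re z)) (absʳ (im z)) (absʳ (re w)) (absʳ (im w))))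
      where
      prod : ∀ x y → absʳ (x *ʳ y) ≤ʳ absʳ x *ʳ absʳ y
      prod x y = ≤ʳ-reflexive (absʳ-* x y)

    ‖ι‖ : ∀ x → ‖ ι x ‖ ≈ʳ absʳ x
    ‖ι‖ x = ≈ʳ-trans (+ʳ-cong ≈ʳ-refl (absʳ-of-nonneg ≤ʳ-refl)) (+ʳ-identityʳ _)

    ‖𝕚‖ : ‖ 𝕚 ‖ ≈ʳ 1ʳ
    ‖𝕚‖ = ≈ʳ-trans (+ʳ-cong (absʳ-of-nonneg ≤ʳ-refl) (absʳ-of-nonneg (⌊⌋-mono 0≤1))) (+ʳ-identityˡ _)

    absʳ-re≤‖‖ : ∀ z → absʳ (re z) ≤ʳ ‖ z ‖
    absʳ-re≤‖‖ z = ≤ʳ-trans (≤ʳ-reflexive (≈ʳ-sym (+ʳ-identityʳ _))) (+ʳ-mono-≤ ≤ʳ-refl (absʳ-nonneg (im z)))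

    absʳ-im≤‖‖ : ∀ z → absʳ (im z) ≤ʳ ‖ z ‖
    absʳ-im≤‖‖ z = ≤ʳ-trans (≤ʳ-reflexive (≈ʳ-sym (+ʳ-identityˡ _))) (+ʳ-mono-≤ (absʳ-nonneg (re z)) ≤ʳ-refl)

    -- The difference is 2 ∣re z∣ ∣im z∣. This turns ℓ¹ estimates into the Euclidean ones that
    -- `_within_of_` asks for.
    normSqʳ≤‖‖² : ∀ z → normSqʳ z ≤ʳ ‖ z ‖ *ʳ ‖ z ‖
    normSqʳ≤‖‖² z = 0≤-⇒≤ʳ (≤ʳ-trans (+ʳ-nonneg (absʳ*absʳ-nonneg (re z) (im z)) (absʳ*absʳ-nonneg (re z) (im z)))
      (≤ʳ-reflexive (begin-equality
        a *ʳ b +ʳ a *ʳ b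
          ≈⟨ solve 2 (λ a b → a :* b :+ a :* b := (a :+ b) :* (a :+ b) :- (a :* a :+ b :* b)) ≈ʳ-refl a b ⟩
        (a +ʳ b) *ʳ (a +ʳ b) -ʳ (a *ʳ a +ʳ b *ʳ b)
          ≈⟨ +ʳ-cong ≈ʳ-refl (-ʳ-cong (+ʳ-cong (absʳ-square (re z)) (absʳ-square (im z)))) ⟩
        (a +ʳ b) *ʳ (a +ʳ b) -ʳ (re z *ʳ re z +ʳ im z *ʳ im z) ∎)))
      where
      open ℝ-Reasoning
      a b : ℝ
      a = absʳ (re z)
      b = absʳ (im z)

  ℂ-ring : CommutativeRing 0ℓ 0ℓ
  ℂ-ring = record { isCommutativeRing = ℂ-isCommutativeRing }

open ComplexNumbers

-- Limits of complex sequences.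

module ComplexLimits where
  ratC : ℚ → ℂ
  ratC p = ι ⌊ p ⌋

  open CommutativeRing ℂ-ring public
    using (_-_; +-cong; +-comm; +-assoc; +-identityˡ; +-identityʳ; *-cong; *-comm; *-assoc; *-identityˡ; *-identityʳ)
    renaming (refl to ≈-refl; sym to ≈-sym; trans to ≈-trans; -‿cong to neg-cong; -‿inverseʳ to neg-inverseʳ;
              zeroˡ to *-zeroˡ; zeroʳ to *-zeroʳ)

  module ℂ-Reasoning = Relation.Binary.Reasoning.Setoid (CommutativeRing.setoid ℂ-ring)

  ℚ→ℂ : CommutativeRing.rawRing ℚ.+-*-commutativeRing -Raw-AlmostCommutative⟶ fromCommutativeRing ℂ-ring
  ℚ→ℂ = record
    { ⟦_⟧ = ratC
    ; +-homo = λ p q → ≈-trans (ι-cong (⌊⌋-+ p q)) (ι-+ ⌊ p ⌋ ⌊ q ⌋)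
    ; *-homo = λ p q → ≈-trans (ι-cong (⌊⌋-* p q)) (ι-* ⌊ p ⌋ ⌊ q ⌋)
    ; -‿homo = λ p → ≈-trans (ι-cong (⌊⌋-neg p)) (ι-neg ⌊ p ⌋)
    ; 0-homo = ≈-refl ; 1-homo = ≈-refl }

  module ℂS = Algebra.Solver.Ring
    (CommutativeRing.rawRing ℚ.+-*-commutativeRing) (fromCommutativeRing ℂ-ring) ℚ→ℂ
    (λ p q → map ι-cong (⌊⌋-≟ p q))

  ratC-+ : ∀ p q → ratC (p ℚ.+ q) ≈ ratC p + ratC q
  ratC-+ = _-Raw-AlmostCommutative⟶_.+-homo ℚ→ℂ

  ratC-* : ∀ p q → ratC (p ℚ.* q) ≈ ratC p * ratC q
  ratC-* = _-Raw-AlmostCommutative⟶_.*-homo ℚ→ℂ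

  ratC-cong : ∀ {p q} → p ≡ q → ratC p ≈ ratC q
  ratC-cong ≡.refl = ≈-refl

  ι-sub : ∀ x y → ι (x -ʳ y) ≈ ι x - ι y
  ι-sub x y = ≈-trans (ι-+ x (-ʳ y)) (+-cong ≈-refl (ι-neg y))

  ‖‖-ratC : ∀ {p} → 0ℚ ℚ.≤ p → ‖ ratC p ‖ ≈ʳ ⌊ p ⌋
  ‖‖-ratC {p} 0≤p = ≈ʳ-trans (‖ι‖ ⌊ p ⌋) (absʳ-of-nonneg (⌊⌋-nonneg 0≤p))

  ‖‖-0 : ∀ {z} → z ≈ 0# → ‖ z ‖ ≈ʳ 0ʳ
  ‖‖-0 h = ≈ʳ-trans (‖‖-cong h) (‖‖-ratC ℚ.≤-refl)

  ‖‖-sub : ∀ z w → ‖ z - w ‖ ≤ʳ ‖ z ‖ +ʳ ‖ w ‖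
  ‖‖-sub z w = ≤ʳ-trans (‖‖-+ z (- w)) (+ʳ-mono-≤ ≤ʳ-refl (≤ʳ-reflexive (‖‖-neg w)))

  ‖‖-*-≤ : ∀ {z w a b} → ‖ z ‖ ≤ʳ a → ‖ w ‖ ≤ʳ b → ‖ z * w ‖ ≤ʳ a *ʳ b
  ‖‖-*-≤ {z} {w} h k = ≤ʳ-trans (‖‖-* z w)
    (*ʳ-mono-≤ (≤ʳ-trans (‖‖-nonneg z) h) (‖‖-nonneg w) h k)

  ‖‖-+-≤ : ∀ {z w a b} → ‖ z ‖ ≤ʳ a → ‖ w ‖ ≤ʳ b → ‖ z + w ‖ ≤ʳ a +ʳ b
  ‖‖-+-≤ {z} {w} h k = ≤ʳ-trans (‖‖-+ z w) (+ʳ-mono-≤ h k)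

  ‖‖≤0⇒≈0 : ∀ {z} → ‖ z ‖ ≤ʳ 0ʳ → z ≈ 0#
  ‖‖≤0⇒≈0 {z} h = normSqʳ≤0⇒≈0 (≤ʳ-trans (normSqʳ≤‖‖² z) (≤ʳ-trans
    (*ʳ-mono-≤ ≤ʳ-refl (‖‖-nonneg z) h h) (≤ʳ-reflexive (*ʳ-zeroˡ 0ʳ))))

  difference≈0 : ∀ {z w} → z - w ≈ 0# → z ≈ w
  difference≈0 {z} {w} h = ≈-trans (solve 2 (λ z w → z := z :- w :+ w) ≈-refl z w)
    (≈-trans (+-cong h ≈-refl) (+-identityˡ w))
    where open ℂS

  open Algebra.Properties.Semiring.Sum (CommutativeRing.semiring ℂ-ring) public
    using (sum-cong-≋; sum-cong-≗; ∑-comm; ∑-distrib-+; *-distribˡ-sum; *-distribʳ-sum; sum-init-last)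
    renaming (sum to ∑)

  infix 4 _⇝_

  -- Convergence in the ℓ¹ norm with rational tolerances, convenient for sums and multiples; `⇝⇒⟶`
  -- passes to the Euclidean notion.
  _⇝_ : (ℕ → ℂ) → ℂ → Set
  u ⇝ L = ∀ ε → 0ℚ ℚ.< ε → Eventually λ n → ‖ u n - L ‖ ≤ʳ ⌊ ε ⌋

  ⌊half⌋+⌊half⌋ : ∀ ε → ⌊ ½ ℚ.* ε ⌋ +ʳ ⌊ ½ ℚ.* ε ⌋ ≈ʳ ⌊ ε ⌋
  ⌊half⌋+⌊half⌋ ε = ≈ʳ-trans (≈ʳ-sym (⌊⌋-+ (½ ℚ.* ε) (½ ℚ.* ε))) (⌊⌋-cong (half+half ε))

  ⇝-cong : ∀ {u v L M} → (∀ n → u n ≈ v n) → L ≈ M → u ⇝ L → v ⇝ M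
  ⇝-cong h k u⇝L ε 0<ε = eventually-map
    (λ n → ≤ʳ-trans (≤ʳ-reflexive (‖‖-cong (≈-sym (+-cong (h n) (neg-cong k)))))) (u⇝L ε 0<ε)

  ⇝-const : ∀ L → (λ _ → L) ⇝ L
  ⇝-const L ε 0<ε = always λ n → ≤ʳ-trans
    (≤ʳ-reflexive (‖‖-0 (solve 1 (λ z → z :- z := con 0ℚ) ≈-refl L))) (⌊⌋-nonneg (ℚ.<⇒≤ 0<ε))
    where open ℂS

  ⇝-+ : ∀ {u v L M} → u ⇝ L → v ⇝ M → (λ n → u n + v n) ⇝ L + M
  ⇝-+ {u} {v} {L} {M} h k ε 0<ε = eventually-zip
    (λ n p q → ≤ʳ-trans
      (≤ʳ-reflexive (‖‖-cong (solve 4 (λ u v l m → u :+ v :- (l :+ m) := u :- l :+ (v :- m)) ≈-refl (u n) (v n) L M)))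
      (≤ʳ-trans (‖‖-+-≤ p q) (≤ʳ-reflexive (⌊half⌋+⌊half⌋ ε))))
    (h _ (½-pos 0<ε)) (k _ (½-pos 0<ε))
    where open ℂS

  ⇝-* : ∀ c {u L} → u ⇝ L → (λ n → c * u n) ⇝ c * L
  ⇝-* c {u} {L} h ε 0<ε =
    let (b , 0<b , c≤b) = upper-bound ‖ c ‖
    in eventually-map
      (λ n p → ≤ʳ-trans
        (≤ʳ-reflexive (‖‖-cong (solve 3 (λ c u l → c :* u :- c :* l := c :* (u :- l)) ≈-refl c (u n) L)))
        (≤ʳ-trans (‖‖-*-≤ c≤b p)
          (≤ʳ-reflexive (≈ʳ-trans (≈ʳ-sym (⌊⌋-* b (ε ℚ.* recip b 0<b))) (⌊⌋-cong (*-recip b ε 0<b))))))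
      (h (ε ℚ.* recip b 0<b) (*-pos 0<ε (recip-pos b 0<b)))
    where open ℂS

  ⇝-shift : ∀ {u L} → u ⇝ L → (λ n → u (suc n)) ⇝ L
  ⇝-shift h ε 0<ε = let (N , k) = h ε 0<ε in N , λ n p → k (suc n) (ℕ.m≤n⇒m≤1+n p)

  ⇝-bounded : ∀ {u L c} → u ⇝ L → (∀ n → ‖ u n ‖ ≤ʳ c) → ‖ L ‖ ≤ʳ c
  ⇝-bounded {u} {L} {c} h k = ≤ʳ-approx λ ε 0<ε →
    let (N , p) = h ε 0<ε
    in ≤ʳ-trans (≤ʳ-reflexive (‖‖-cong (solve 2 (λ u l → l := u :- (u :- l)) ≈-refl (u N) L)))
       (≤ʳ-trans (‖‖-sub (u N) (u N - L)) (+ʳ-mono-≤ (k N) (p N ℕ.≤-refl)))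
    where open ℂS

  -- The sequence u - u, written as u + (-1) u to fit `⇝-+` and `⇝-*`, vanishes; so the norm of its
  -- limit L - M is at most 0.
  ⇝-unique : ∀ {u L M} → u ⇝ L → u ⇝ M → L ≈ M
  ⇝-unique {u} {L} {M} h k = difference≈0 (‖‖≤0⇒≈0 (⇝-bounded
    (⇝-cong (λ n → solve 1 (λ u → u :+ con (ℚ.- 1ℚ) :* u := con 0ℚ) ≈-refl (u n))
            (solve 2 (λ l m → l :+ con (ℚ.- 1ℚ) :* m := l :- m) ≈-refl L M)
            (⇝-+ h (⇝-* (ratC (ℚ.- 1ℚ)) k)))
    (λ n → ≤ʳ-reflexive (‖‖-0 ≈-refl))))
    where open ℂS

  IsCauchyᶜ : (ℕ → ℂ) → Set
  IsCauchyᶜ u = ∀ ε → 0ℚ ℚ.< ε → ∃[ N ] ∀ m → N ℕ.≤ m → ∀ j → ‖ u (j ℕ.+ m) - u m ‖ ≤ʳ ⌊ ε ⌋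

  opaque
    unfolding _≈_

    re-sub : ∀ z w → re (z - w) ≈ʳ re z -ʳ re w
    re-sub z w = ≈ʳ-refl

    im-sub : ∀ z w → im (z - w) ≈ʳ im z -ʳ im w
    im-sub z w = ≈ʳ-refl

    ‖‖-components : ∀ z w → ‖ z - w ‖ ≈ʳ absʳ (re z -ʳ re w) +ʳ absʳ (im z -ʳ im w)
    ‖‖-components z w = ≈ʳ-refl

  module _ (u : ℕ → ℂ) (h : IsCauchyᶜ u) where

    re-cauchy : IsCauchyʳ (λ n → re (u n))
    re-cauchy ε 0<ε = let (N , k) = h ε 0<ε in N , λ m p j → ≤ʳ-trans
      (≤ʳ-reflexive (absʳ-cong (≈ʳ-sym (re-sub (u (j ℕ.+ m)) (u m))))) (≤ʳ-trans (absʳ-re≤‖‖ _) (k m p j))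

    im-cauchy : IsCauchyʳ (λ n → im (u n))
    im-cauchy ε 0<ε = let (N , k) = h ε 0<ε in N , λ m p j → ≤ʳ-trans
      (≤ʳ-reflexive (absʳ-cong (≈ʳ-sym (im-sub (u (j ℕ.+ m)) (u m))))) (≤ʳ-trans (absʳ-im≤‖‖ _) (k m p j))

    opaque
      limᶜ : ℂ
      limᶜ = Completeness.limit _ re-cauchy +i Completeness.limit _ im-cauchy

      limᶜ-converges : u ⇝ limᶜ
      limᶜ-converges ε 0<ε = eventually-zip
        (λ n p q → ≤ʳ-trans (≤ʳ-reflexive (‖‖-components (u n) limᶜ))
          (≤ʳ-trans (+ʳ-mono-≤ p q) (≤ʳ-reflexive (⌊half⌋+⌊half⌋ ε))))
        (Completeness.limit-converges _ re-cauchy _ (½-pos 0<ε))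
        (Completeness.limit-converges _ im-cauchy _ (½-pos 0<ε))

open ComplexLimits

-- The exponential series and its derivative.

module Exponential where
  open ℂS

  -- `expTermᶜ z k` is zᵏ/k! and `prevTermᶜ z k` its derivative in z, which is 0 for k = 0.
  expTermᶜ prevTermᶜ expSumᶜ : ℂ → ℕ → ℂ
  expTermᶜ z zero    = 1#
  expTermᶜ z (suc k) = ratC (1/suc k) * (z * expTermᶜ z k)
  prevTermᶜ z zero    = 0#
  prevTermᶜ z (suc k) = expTermᶜ z k
  expSumᶜ z zero    = 0#
  expSumᶜ z (suc k) = expSumᶜ z k + expTermᶜ z k

  ratC-inverse : ∀ k → ratC (1/suc k) * ratC (natℚ (suc k)) ≈ 1#
  ratC-inverse k = ≈-trans (≈-sym (ratC-* (1/suc k) (natℚ (suc k)))) (ratC-cong (1/suc-inverse k))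

  prevTermᶜ-step : ∀ z k → z * prevTermᶜ z k ≈ ratC (natℚ k) * expTermᶜ z k
  prevTermᶜ-step z zero    = ≈-trans (*-zeroʳ z) (≈-sym (*-zeroˡ 1#))
  prevTermᶜ-step z (suc k) = ≈-sym (begin
    N * (r * (z * a))   ≈⟨ solve 4 (λ n r z a → n :* (r :* (z :* a)) := r :* n :* (z :* a)) ≈-refl N r z a ⟩
    r * N * (z * a)     ≈⟨ *-cong (ratC-inverse k) ≈-refl ⟩
    1# * (z * a)        ≈⟨ *-identityˡ (z * a) ⟩
    z * a               ∎)
    where
    open ℂ-Reasoning
    N r a : ℂ
    N = ratC (natℚ (suc k))
    r = ratC (1/suc k)
    a = expTermᶜ z k

  module ExpEstimates (M : ℚ) (0≤M : 0ℚ ℚ.≤ M) where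
    open ExpBound M 0≤M

    ‖‖-scale : ∀ {p z a} → 0ℚ ℚ.≤ p → ‖ z ‖ ≤ʳ a → ‖ ratC p * z ‖ ≤ʳ ⌊ p ⌋ *ʳ a
    ‖‖-scale 0≤p h = ‖‖-*-≤ (≤ʳ-reflexive (‖‖-ratC 0≤p)) h

    expTermᶜ-bound : ∀ {z} → ‖ z ‖ ≤ʳ ⌊ M ⌋ → ∀ k → ‖ expTermᶜ z k ‖ ≤ʳ ⌊ expTerm k ⌋
    expTermᶜ-bound h zero    = ≤ʳ-reflexive (‖‖-ratC 0≤1)
    expTermᶜ-bound h (suc k) = ≤ʳ-trans
      (‖‖-scale (ℚ.<⇒≤ (1/suc-pos k)) (‖‖-*-≤ h (expTermᶜ-bound h k)))
      (≤ʳ-reflexive (≈ʳ-trans (*ʳ-cong ≈ʳ-refl (≈ʳ-sym (⌊⌋-* M (expTerm k))))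
        (≈ʳ-sym (⌊⌋-* (1/suc k) (M ℚ.* expTerm k)))))

    expSumᶜ-tail : ∀ {z} → ‖ z ‖ ≤ʳ ⌊ M ⌋ → ∀ j m →
                   ‖ expSumᶜ z (j ℕ.+ m) - expSumᶜ z m ‖ ≤ʳ ⌊ expSum (j ℕ.+ m) ℚ.- expSum m ⌋
    expSumᶜ-tail {z} h zero m = ≤ʳ-reflexive (≈ʳ-trans
      (‖‖-0 (neg-inverseʳ (expSumᶜ z m))) (⌊⌋-cong (≡.sym (ℚ.+-inverseʳ (expSum m)))))
    expSumᶜ-tail {z} h (suc j) m = ≤ʳ-trans
      (≤ʳ-reflexive (‖‖-cong (solve 3 (λ a b c → a :+ b :- c := a :- c :+ b) ≈-refl
        (expSumᶜ z (j ℕ.+ m)) (expTermᶜ z (j ℕ.+ m)) (expSumᶜ z m))))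
      (≤ʳ-trans (‖‖-+-≤ (expSumᶜ-tail h j m) (expTermᶜ-bound h (j ℕ.+ m)))
        (≤ʳ-reflexive (≈ʳ-trans (≈ʳ-sym (⌊⌋-+ (expSum (j ℕ.+ m) ℚ.- expSum m) (expTerm (j ℕ.+ m))))
          (⌊⌋-cong (ℚS.solve 3 (λ a b c → a ℚS.:- c ℚS.:+ b ℚS.:= a ℚS.:+ b ℚS.:- c) ≡.refl
            (expSum (j ℕ.+ m)) (expTerm (j ℕ.+ m)) (expSum m))))))
      where
      open import Data.Rational.Solver
      module ℚS = +-*-Solver

    expSumᶜ-cauchy : ∀ {z} → ‖ z ‖ ≤ʳ ⌊ M ⌋ → IsCauchyᶜ (expSumᶜ z)
    expSumᶜ-cauchy h ε 0<ε =
      let (N , k) = expSum-tail ε 0<ε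
      in N , λ m p j → ≤ʳ-trans (expSumᶜ-tail h j m) (⌊⌋-mono (k m p j))

    expSumᶜ-bound : ∀ {z} → ‖ z ‖ ≤ʳ ⌊ M ⌋ → ∀ n → ‖ expSumᶜ z n ‖ ≤ʳ ⌊ expBound ⌋
    expSumᶜ-bound {z} h n = ≤ʳ-trans (go n) (⌊⌋-mono (expSum-bounded n))
      where
      go : ∀ n → ‖ expSumᶜ z n ‖ ≤ʳ ⌊ expSum n ⌋
      go zero    = ≤ʳ-reflexive (‖‖-ratC ℚ.≤-refl)
      go (suc n) = ≤ʳ-trans (‖‖-+-≤ (go n) (expTermᶜ-bound h n)) (≤ʳ-reflexive (≈ʳ-sym (⌊⌋-+ (expSum n) (expTerm n))))

    module _ {z w : ℂ} (hz : ‖ z ‖ ≤ʳ ⌊ M ⌋) (hw : ‖ w ‖ ≤ʳ ⌊ M ⌋) where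

      private
        h : ℂ
        h = w - z

        H : ℝ
        H = ‖ h ‖ *ʳ ‖ h ‖

        0≤H : 0ʳ ≤ʳ H
        0≤H = *ʳ-nonneg (‖‖-nonneg h) (‖‖-nonneg h)

      -- What remains of wᵏ/k! after its linear Taylor polynomial at z.
      termRemainder : ℕ → ℂ
      termRemainder k = expTermᶜ w k - expTermᶜ z k - h * prevTermᶜ z k

      -- That is, (k + 1) R(k + 1) = w R(k) + h² p(k): the remainder of the product of w with wᵏ/k!.
      termRemainder-suc : ∀ k → termRemainder (suc k) ≈
                          ratC (1/suc k) * (w * termRemainder k + h * h * prevTermᶜ z k)
      termRemainder-suc k = begin
        r * (w * a) - r * (z * b) - (w - z) * b
          -- The factor 1 stays visible so that it can next be replaced by (1 + k)/(k + 1), while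
          -- `z * p` becomes `N * b`; the remaining terms then cancel.
          ≈⟨ solve 6 (λ r w z a b p → r :* (w :* a) :- r :* (z :* b) :- (w :- z) :* b
                   := r :* (w :* a :- z :* b :- (w :- z) :* z :* p) :+ r :* (w :- z) :* (z :* p) :- con 1ℚ :* ((w :- z) :* b))
               ≈-refl r w z a b p ⟩
        r * (w * a - z * b - h * z * p) + r * h * (z * p) - 1# * (h * b)
          ≈⟨ +-cong (+-cong ≈-refl (*-cong ≈-refl (prevTermᶜ-step z k)))
               (neg-cong (*-cong (≈-sym (≈-trans (*-cong ≈-refl (≈-sym (ratC-+ 1ℚ (natℚ k)))) (ratC-inverse k))) ≈-refl)) ⟩
        r * (w * a - z * b - h * z * p) + r * h * (N * b) - r * (1# + N) * (h * b)
          ≈⟨ solve 7 (λ r w z a b p n → r :* (w :* a :- z :* b :- (w :- z) :* z :* p) :+ r :* (w :- z) :* (n :* b)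
                                        :- r :* (con 1ℚ :+ n) :* ((w :- z) :* b)
                   := r :* (w :* (a :- b :- (w :- z) :* p) :+ (w :- z) :* (w :- z) :* p))
               ≈-refl r w z a b p N ⟩
        r * (w * (a - b - h * p) + h * h * p) ∎
        where
        open ℂ-Reasoning
        r a b p N : ℂ
        r = ratC (1/suc k)
        a = expTermᶜ w k
        b = expTermᶜ z k
        p = prevTermᶜ z k
        N = ratC (natℚ k)

      termRemainder-1 : termRemainder 1 ≈ 0#
      termRemainder-1 = ≈-trans (termRemainder-suc 0)
        (solve 3 (λ r w h → r :* (w :* (con 1ℚ :- con 1ℚ :- h :* con 0ℚ) :+ h :* h :* con 0ℚ) := con 0ℚ)
          ≈-refl (ratC (1/suc 0)) w h)

      -- `prevTerm k` is the second derivative of Mᵏ⁺¹/(k + 1)!, so this is Taylor's estimate up to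
      -- the factor ½. The induction rests on `remainder-step`.
      termRemainder-bound : ∀ k → ‖ termRemainder (suc k) ‖ ≤ʳ H *ʳ ⌊ prevTerm k ⌋
      termRemainder-bound zero = ≤ʳ-reflexive (≈ʳ-trans (‖‖-0 termRemainder-1) (≈ʳ-sym (*ʳ-zeroʳ H)))
      termRemainder-bound (suc k) = ≤ʳ-trans (≤ʳ-reflexive (‖‖-cong (termRemainder-suc (suc k))))
        (≤ʳ-trans (‖‖-scale (ℚ.<⇒≤ (1/suc-pos (suc k)))
          (‖‖-+-≤ (‖‖-*-≤ hw (termRemainder-bound k)) (‖‖-*-≤ (‖‖-* h h) (expTermᶜ-bound hz k))))
        (≤ʳ-trans (≤ʳ-reflexive (≈ʳ-trans
            (solveʳ 5 (λ r m H p a → r ⊗ (m ⊗ (H ⊗ p) ⊕ H ⊗ a)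
                                ⊜ H ⊗ (r ⊗ (m ⊗ p ⊕ a))) ≈ʳ-refl
              ⌊ 1/suc (suc k) ⌋ ⌊ M ⌋ H ⌊ prevTerm k ⌋ ⌊ expTerm k ⌋)
            (*ʳ-cong ≈ʳ-refl (≈ʳ-sym (≈ʳ-trans (⌊⌋-* (1/suc (suc k)) (M ℚ.* prevTerm k ℚ.+ expTerm k))
              (*ʳ-cong ≈ʳ-refl (≈ʳ-trans (⌊⌋-+ (M ℚ.* prevTerm k) (expTerm k))
                (+ʳ-cong (⌊⌋-* M (prevTerm k)) ≈ʳ-refl))))))))
          (*ʳ-monoˡ H 0≤H (⌊⌋-mono (remainder-step k)))))

      -- Differentiating a partial sum loses one term, hence `suc n` terms of the function against n
      -- of the derivative.
      sumRemainder : ℕ → ℂ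
      sumRemainder n = expSumᶜ w (suc n) - expSumᶜ z (suc n) - h * expSumᶜ z n

      sumRemainder-bound : ∀ n → ‖ sumRemainder n ‖ ≤ʳ H *ʳ ⌊ expBound ⌋
      sumRemainder-bound n = ≤ʳ-trans (go n) (*ʳ-monoˡ H 0≤H (⌊⌋-mono (prevSum-bounded n)))
        where
        prevSum : ℕ → ℚ
        prevSum zero    = 0ℚ
        prevSum (suc n) = expSum n
        prevSum-bounded : ∀ n → prevSum n ℚ.≤ expBound
        prevSum-bounded zero    = expBound-nonneg
        prevSum-bounded (suc n) = expSum-bounded n
        prevSum-suc : ∀ n → prevSum n ℚ.+ prevTerm n ≡ prevSum (suc n)
        prevSum-suc zero    = ≡.refl
        prevSum-suc (suc n) = ≡.refl
        step : ∀ n → sumRemainder (suc n) ≈ sumRemainder n + termRemainder (suc n)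
        step n = solve 8 (λ w z s a t b u c → s :+ a :- (t :+ b) :- (w :- z) :* (u :+ c)
            := (s :- t :- (w :- z) :* u) :+ (a :- b :- (w :- z) :* c)) ≈-refl w z
          (expSumᶜ w (suc n)) (expTermᶜ w (suc n)) (expSumᶜ z (suc n)) (expTermᶜ z (suc n)) (expSumᶜ z n) (expTermᶜ z n)
        go : ∀ n → ‖ sumRemainder n ‖ ≤ʳ H *ʳ ⌊ prevSum n ⌋
        go zero = ≤ʳ-reflexive (≈ʳ-trans (‖‖-0
          (solve 1 (λ h → con 0ℚ :+ con 1ℚ :- (con 0ℚ :+ con 1ℚ) :- h :* con 0ℚ := con 0ℚ) ≈-refl h)) (≈ʳ-sym (*ʳ-zeroʳ H)))
        go (suc n) = ≤ʳ-trans (≤ʳ-reflexive (‖‖-cong (step n)))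
          (≤ʳ-trans (‖‖-+-≤ (go n) (termRemainder-bound n)) (≤ʳ-reflexive (≈ʳ-trans
            (solveʳ 3 (λ H a b → H ⊗ a ⊕ H ⊗ b ⊜ H ⊗ (a ⊕ b)) ≈ʳ-refl
              H ⌊ prevSum n ⌋ ⌊ prevTerm n ⌋)
            (*ʳ-cong ≈ʳ-refl (≈ʳ-trans (≈ʳ-sym (⌊⌋-+ (prevSum n) (prevTerm n))) (⌊⌋-cong (prevSum-suc n)))))))

  opaque
    -- A rational bound on the norm of z feeds the majorant; being opaque, the value is reached only
    -- through `exp-converges`.
    exp : ℂ → ℂ
    exp z = let (b , 0<b , h) = upper-bound ‖ z ‖ in limᶜ (expSumᶜ z) (ExpEstimates.expSumᶜ-cauchy b (ℚ.<⇒≤ 0<b) h)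

    exp-converges : ∀ z → expSumᶜ z ⇝ exp z
    exp-converges z = let (b , 0<b , h) = upper-bound ‖ z ‖
                      in limᶜ-converges (expSumᶜ z) (ExpEstimates.expSumᶜ-cauchy b (ℚ.<⇒≤ 0<b) h)

  exp-bound : ∀ M (0≤M : 0ℚ ℚ.≤ M) {z} → ‖ z ‖ ≤ʳ ⌊ M ⌋ → ‖ exp z ‖ ≤ʳ ⌊ ExpBound.expBound M 0≤M ⌋
  exp-bound M 0≤M {z} h = ⇝-bounded (exp-converges z) (ExpEstimates.expSumᶜ-bound M 0≤M h)

  -- The limit of `sumRemainder-bound`. The constant is uniform on the ball of radius M, which later
  -- yields a single K on [0,T].
  exp-derivative : ∀ M (0≤M : 0ℚ ℚ.≤ M) {z w} → ‖ z ‖ ≤ʳ ⌊ M ⌋ → ‖ w ‖ ≤ʳ ⌊ M ⌋ →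
    ‖ exp w - exp z - (w - z) * exp z ‖ ≤ʳ ‖ w - z ‖ *ʳ ‖ w - z ‖ *ʳ ⌊ ExpBound.expBound M 0≤M ⌋
  exp-derivative M 0≤M {z} {w} hz hw = ⇝-bounded {u = sumRemainder hz hw}
    (⇝-cong (λ n → solve 4 (λ a b h c → a :+ con (ℚ.- 1ℚ) :* b :+ con (ℚ.- 1ℚ) :* (h :* c) := a :- b :- h :* c) ≈-refl
                (expSumᶜ w (suc n)) (expSumᶜ z (suc n)) (w - z) (expSumᶜ z n))
            (solve 3 (λ a b h → a :+ con (ℚ.- 1ℚ) :* b :+ con (ℚ.- 1ℚ) :* (h :* b) := a :- b :- h :* b) ≈-refl
                (exp w) (exp z) (w - z))
      (⇝-+ (⇝-+ (⇝-shift (exp-converges w)) (⇝-* (ratC (ℚ.- 1ℚ)) (⇝-shift (exp-converges z))))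
           (⇝-* (ratC (ℚ.- 1ℚ)) (⇝-* (w - z) (exp-converges z)))))
    (sumRemainder-bound hz hw)
    where
    open ExpEstimates M 0≤M

  -- All nonempty partial sums are 1. The exponent of a wave at time 0 is equal to 0 only up to
  -- `_≈_`, hence the hypothesis on z.
  exp-0 : ∀ {z} → z ≈ 0# → exp z ≈ 1#
  exp-0 {z} z≈0 = ⇝-unique (⇝-shift (exp-converges z)) (⇝-cong (λ n → ≈-sym (sums n)) ≈-refl (⇝-const 1#))
    where
    sums : ∀ n → expSumᶜ z (suc n) ≈ 1#
    sums zero    = +-identityˡ 1#
    sums (suc n) = ≈-trans (+-cong (sums n) (≈-trans (*-cong ≈-refl (≈-trans (*-cong z≈0 ≈-refl) (*-zeroˡ (expTermᶜ z n)))) (*-zeroʳ _)))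
      (+-identityʳ 1#)

open Exponential

-- Functions with f′ = c f, and the waves exp(-i t μ).

module Waves where
  open ℂS

  record _∈[0,_] (x T : ℝ) : Set where
    constructor within
    field
      0≤x : 0ʳ ≤ʳ x
      x≤T : x ≤ʳ T

  open _∈[0,_] public

  absʳ-sub-≤ : ∀ {T x y} → x ∈[0, T ] → y ∈[0, T ] → absʳ (y -ʳ x) ≤ʳ T
  absʳ-sub-≤ {T} {x} {y} hx hy = absʳ-least (one hx hy)
    (≤ʳ-trans (≤ʳ-reflexive (solveʳ 2 (λ x y → ⊖ (y ⊖ x) ⊜ x ⊖ y) ≈ʳ-refl x y)) (one hy hx))
    where
    one : ∀ {x y} → x ∈[0, T ] → y ∈[0, T ] → y -ʳ x ≤ʳ T
    one {x} {y} hx hy = 0≤-⇒≤ʳ (≤ʳ-trans (+ʳ-nonneg (≤ʳ⇒0≤- (x≤T hy)) (0≤x hx))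
      (≤ʳ-reflexive (solveʳ 3 (λ x y t → t ⊖ y ⊕ x ⊜ t ⊖ (y ⊖ x)) ≈ʳ-refl x y T)))

  ‖ι‖² : ∀ x → ‖ ι x ‖ *ʳ ‖ ι x ‖ ≈ʳ x *ʳ x
  ‖ι‖² x = ≈ʳ-trans (*ʳ-cong (‖ι‖ x) (‖ι‖ x)) (absʳ-square x)

  -- K may depend on T but not on x and y. These come in either order, since `cell-error` compares a
  -- tag with points on both sides of it.
  IsAntiderivative : (G f : ℝ → ℂ) → Set
  IsAntiderivative G f = ∀ T → ∃[ K ] 0ʳ ≤ʳ K × (∀ {x y} → x ∈[0, T ] → y ∈[0, T ] →
    ‖ G y - G x - ι (y -ʳ x) * f x ‖ ≤ʳ (y -ʳ x) *ʳ (y -ʳ x) *ʳ K)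

  LocallyBounded : (ℝ → ℂ) → Set
  LocallyBounded G = ∀ T → ∃[ B ] 0ʳ ≤ʳ B × (∀ {x} → x ∈[0, T ] → ‖ G x ‖ ≤ʳ B)

  -- The differential equation f′ = c f on the half-line; local boundedness is what the product rule
  -- uses to absorb the mixed terms.
  record IsExponential (c : ℂ) (G : ℝ → ℂ) : Set where
    field
      antiderivative : IsAntiderivative G (λ t → c * G t)
      locallyBounded : LocallyBounded G

  open IsExponential

  exponential-cong : ∀ {c d G} → c ≈ d → IsExponential c G → IsExponential d G
  exponential-cong c≈d e = record
    { antiderivative = λ T → let (K , 0≤K , h) = antiderivative e T in K , 0≤K , λ hx hy →
        ≤ʳ-trans (≤ʳ-reflexive (‖‖-cong (+-cong ≈-refl (neg-cong (*-cong ≈-refl (*-cong (≈-sym c≈d) ≈-refl)))))) (h hx hy)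
    ; locallyBounded = locallyBounded e
    }

  exponential-conj : ∀ {c G} → IsExponential c G → IsExponential (c ̄) (λ t → G t ̄)
  exponential-conj {c} {G} e = record
    { antiderivative = λ T → let (K , 0≤K , h) = antiderivative e T in K , 0≤K , λ {x} {y} hx hy →
        ≤ʳ-trans (≤ʳ-reflexive (≈ʳ-trans (‖‖-cong (≈-sym (conj-error x y))) (‖‖-conj _))) (h hx hy)
    ; locallyBounded = λ T → let (B , 0≤B , h) = locallyBounded e T in B , 0≤B , λ hx →
        ≤ʳ-trans (≤ʳ-reflexive (‖‖-conj _)) (h hx)
    }
    where
    conj-error : ∀ x y → (G y - G x - ι (y -ʳ x) * (c * G x)) ̄ ≈ G y ̄ - G x ̄ - ι (y -ʳ x) * (c ̄ * G x ̄)
    conj-error x y = begin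
      (G y - G x - ι (y -ʳ x) * (c * G x)) ̄
        ≈⟨ conj-+ (G y - G x) (- (ι (y -ʳ x) * (c * G x))) ⟩
      (G y - G x) ̄ + (- (ι (y -ʳ x) * (c * G x))) ̄
        ≈⟨ +-cong (≈-trans (conj-+ (G y) (- G x)) (+-cong ≈-refl (conj-neg (G x)))) (conj-neg _) ⟩
      G y ̄ - G x ̄ - (ι (y -ʳ x) * (c * G x)) ̄
        ≈⟨ +-cong ≈-refl (neg-cong (≈-trans (conj-* (ι (y -ʳ x)) (c * G x)) (*-cong (conj-ι (y -ʳ x)) (conj-* c (G x))))) ⟩
      G y ̄ - G x ̄ - ι (y -ʳ x) * (c ̄ * G x ̄) ∎
      where open ℂ-Reasoning

  exponential-* : ∀ {c d F G} → IsExponential c F → IsExponential d G →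
                  IsExponential (c + d) (λ t → F t * G t)
  exponential-* {c} {d} {F} {G} eF eG = record
    { antiderivative = λ T →
        let (K₁ , 0≤K₁ , h₁) = antiderivative eF T
            (K₂ , 0≤K₂ , h₂) = antiderivative eG T
            (B₁ , 0≤B₁ , b₁) = locallyBounded eF T
            (B₂ , 0≤B₂ , b₂) = locallyBounded eG T
            C = ‖ c ‖
            D = ‖ d ‖
            T⁺ = absʳ T
            0≤B₁+ = +ʳ-nonneg 0≤B₁ (*ʳ-nonneg (absʳ-nonneg T) (*ʳ-nonneg (‖‖-nonneg c) 0≤B₁))
        in K₁ *ʳ B₂ +ʳ (B₁ +ʳ T⁺ *ʳ (C *ʳ B₁)) *ʳ K₂ +ʳ C *ʳ D *ʳ (B₁ *ʳ B₂)
         , +ʳ-nonneg (+ʳ-nonneg (*ʳ-nonneg 0≤K₁ 0≤B₂) (*ʳ-nonneg 0≤B₁+ 0≤K₂))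
             (*ʳ-nonneg (*ʳ-nonneg (‖‖-nonneg c) (‖‖-nonneg d)) (*ʳ-nonneg 0≤B₁ 0≤B₂))
         , λ {x} {y} hx hy → ≤ʳ-trans (≤ʳ-reflexive (‖‖-cong (expand (ι (y -ʳ x)) (F y) (G y) (F x) (G x))))
             (≤ʳ-trans (‖‖-+-≤ (‖‖-+-≤ (‖‖-*-≤ (h₁ hx hy) (b₂ hy))
                 (‖‖-*-≤ (‖‖-+-≤ (b₁ hx) (‖‖-*-≤
                   (≤ʳ-trans (≤ʳ-reflexive (‖ι‖ (y -ʳ x))) (≤ʳ-trans (absʳ-sub-≤ hx hy) (≤absʳ T)))
                   (‖‖-*-≤ ≤ʳ-refl (b₁ hx)))) (h₂ hx hy)))
                 (‖‖-*-≤ (≤ʳ-trans (‖‖-* (ι (y -ʳ x)) (ι (y -ʳ x))) (≤ʳ-reflexive (‖ι‖² (y -ʳ x))))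
                   (‖‖-*-≤ (‖‖-* c d) (‖‖-*-≤ (b₁ hx) (b₂ hx)))))
               (≤ʳ-reflexive (solveʳ 8 (λ h k₁ k₂ b₁ b₂ c d t →
                 h ⊗ k₁ ⊗ b₂ ⊕ (b₁ ⊕ t ⊗ (c ⊗ b₁)) ⊗ (h ⊗ k₂)
                   ⊕ h ⊗ (c ⊗ d ⊗ (b₁ ⊗ b₂))
                 ⊜ h ⊗ (k₁ ⊗ b₂ ⊕ (b₁ ⊕ t ⊗ (c ⊗ b₁)) ⊗ k₂ ⊕ c ⊗ d ⊗ (b₁ ⊗ b₂)))
                 ≈ʳ-refl ((y -ʳ x) *ʳ (y -ʳ x)) K₁ K₂ B₁ B₂ C D T⁺)))
    ; locallyBounded = λ T →
        let (B₁ , 0≤B₁ , b₁) = locallyBounded eF T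
            (B₂ , 0≤B₂ , b₂) = locallyBounded eG T
        in B₁ *ʳ B₂ , *ʳ-nonneg 0≤B₁ 0≤B₂ , λ hx → ‖‖-*-≤ (b₁ hx) (b₂ hx)
    }
    where
    -- F(y) is split into error and linear part, then G(y) next to that linear part. The product of
    -- the two linear parts contributes the second-order term h² c d F G.
    expand : ∀ h fy gy fx gx → fy * gy - fx * gx - h * ((c + d) * (fx * gx)) ≈
      (fy - fx - h * (c * fx)) * gy + (fx + h * (c * fx)) * (gy - gx - h * (d * gx)) + h * h * (c * d * (fx * gx))
    expand h fy gy fx gx = solve 7 (λ c d h fy gy fx gx →
      fy :* gy :- fx :* gx :- h :* ((c :+ d) :* (fx :* gx)) :=
      (fy :- fx :- h :* (c :* fx)) :* gy :+ (fx :+ h :* (c :* fx)) :* (gy :- gx :- h :* (d :* gx))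
        :+ h :* h :* (c :* d :* (fx :* gx))) ≈-refl c d h fy gy fx gx

  -- The two halves of an interval contribute half of the quadratic bound, so
  -- the bound can be halved indefinitely.
  zero-derivative⇒constant : ∀ {G} → IsAntiderivative G (λ _ → 0#) → ∀ {t} → 0ʳ ≤ʳ t → G t ≈ G 0ʳ
  zero-derivative⇒constant {G} G′≈0 {t} 0≤t = difference≈0 (‖‖≤0⇒≈0 (≤ʳ-approx λ ε 0<ε →
    let (b , 0<b , t²K≤b) = upper-bound ((t -ʳ 0ʳ) *ʳ (t -ʳ 0ʳ) *ʳ K)
        (k , small) = 2⁻-null b ε 0<ε
    in begin
      ‖ G t - G 0ʳ ‖
        ≤⟨ halved k (within ≤ʳ-refl 0≤t) (within 0≤t ≤ʳ-refl) ⟩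
      (t -ʳ 0ʳ) *ʳ (t -ʳ 0ʳ) *ʳ K *ʳ ⌊ 2⁻ k ⌋
        ≤⟨ *ʳ-monoʳ ⌊ 2⁻ k ⌋ (⌊⌋-nonneg (ℚ.<⇒≤ (2⁻-pos k))) t²K≤b ⟩
      ⌊ b ⌋ *ʳ ⌊ 2⁻ k ⌋
        ≈⟨ ⌊⌋-* b (2⁻ k) ⟨
      ⌊ b ℚ.* 2⁻ k ⌋
        ≤⟨ ⌊⌋-mono (small k ℕ.≤-refl) ⟩
      ⌊ ε ⌋
        ≈⟨ +ʳ-identityˡ ⌊ ε ⌋ ⟨
      0ʳ +ʳ ⌊ ε ⌋ ∎))
    where
    open ℝ-Reasoning
    K : ℝ
    K = proj₁ (G′≈0 t)
    estimate : ∀ {x y} → x ∈[0, t ] → y ∈[0, t ] → ‖ G y - G x ‖ ≤ʳ (y -ʳ x) *ʳ (y -ʳ x) *ʳ K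
    estimate {x} {y} hx hy = ≤ʳ-trans
      (≤ʳ-reflexive (‖‖-cong (solve 3 (λ a b h → a :- b := a :- b :- h :* con 0ℚ) ≈-refl
        (G y) (G x) (ι (y -ʳ x)))))
      (proj₂ (proj₂ (G′≈0 t)) hx hy)
    halved : ∀ k {x y} → x ∈[0, t ] → y ∈[0, t ] → ‖ G y - G x ‖ ≤ʳ (y -ʳ x) *ʳ (y -ʳ x) *ʳ K *ʳ ⌊ 2⁻ k ⌋
    halved zero hx hy = ≤ʳ-trans (estimate hx hy) (≤ʳ-reflexive (≈ʳ-sym (*ʳ-identityʳ _)))
    halved (suc k) {x} {y} hx hy = begin
      ‖ G y - G x ‖
        ≈⟨ ‖‖-cong (solve 3 (λ a b m → a :- b := a :- m :+ (m :- b)) ≈-refl (G y) (G x) (G m)) ⟩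
      ‖ G y - G m + (G m - G x) ‖
        ≤⟨ ‖‖-+-≤ (halved k hm hy) (halved k hx hm) ⟩
      (y -ʳ m) *ʳ (y -ʳ m) *ʳ K *ʳ ⌊ 2⁻ k ⌋ +ʳ (m -ʳ x) *ʳ (m -ʳ x) *ʳ K *ʳ ⌊ 2⁻ k ⌋
        ≈⟨ solveʳ 4 (λ x y K p → let m = conʳ ½ ⊗ (x ⊕ y) in
             (y ⊖ m) ⊗ (y ⊖ m) ⊗ K ⊗ p ⊕ (m ⊖ x) ⊗ (m ⊖ x) ⊗ K ⊗ p
             ⊜ (y ⊖ x) ⊗ (y ⊖ x) ⊗ K ⊗ (conʳ ½ ⊗ p)) ≈ʳ-refl x y K ⌊ 2⁻ k ⌋ ⟩
      (y -ʳ x) *ʳ (y -ʳ x) *ʳ K *ʳ (⌊ ½ ⌋ *ʳ ⌊ 2⁻ k ⌋)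
        ≈⟨ *ʳ-cong ≈ʳ-refl (⌊⌋-* ½ (2⁻ k)) ⟨
      (y -ʳ x) *ʳ (y -ʳ x) *ʳ K *ʳ ⌊ 2⁻ (suc k) ⌋ ∎
      where
      m : ℝ
      m = ⌊ ½ ⌋ *ʳ (x +ʳ y)
      0≤½ : 0ʳ ≤ʳ ⌊ ½ ⌋
      0≤½ = ⌊⌋-nonneg (ℚ.<⇒≤ 0<½)
      hm : m ∈[0, t ]
      hm = within (*ʳ-nonneg 0≤½ (+ʳ-nonneg (0≤x hx) (0≤x hy)))
        (≤ʳ-trans (*ʳ-monoˡ ⌊ ½ ⌋ 0≤½ (+ʳ-mono-≤ (x≤T hx) (x≤T hy)))
          (≤ʳ-reflexive (solveʳ 1 (λ t → conʳ ½ ⊗ (t ⊕ t) ⊜ t) ≈ʳ-refl t)))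

  -- The exponent is bracketed as c μ with c = -i t, the factor that multiplies the adjacency matrix
  -- in the matrix exponential.
  wave : ℂ → ℝ → ℂ
  wave μ t = exp (- (𝕚 * ι t) * μ)

  frequency : ℂ → ℂ
  frequency μ = - (𝕚 * μ)

  wave-0 : ∀ μ → wave μ 0ʳ ≈ 1#
  wave-0 μ = exp-0 (solve 2 (λ i μ → :- (i :* con 0ℚ) :* μ := con 0ℚ) ≈-refl 𝕚 μ)

  module _ (μ : ℂ) (T : ℝ) where
    private
      b : ℝ
      b = absʳ T *ʳ ‖ μ ‖
      M : ℚ
      M = proj₁ (upper-bound b)
      0≤M : 0ℚ ℚ.≤ M
      0≤M = ℚ.<⇒≤ (proj₁ (proj₂ (upper-bound b)))

      ‖μ‖-scale : ∀ z → ‖ - (𝕚 * z) * μ ‖ ≤ʳ ‖ z ‖ *ʳ ‖ μ ‖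
      ‖μ‖-scale z = ‖‖-*-≤ (≤ʳ-trans (≤ʳ-reflexive (‖‖-neg (𝕚 * z))) (≤ʳ-trans (‖‖-* 𝕚 z)
        (≤ʳ-reflexive (≈ʳ-trans (*ʳ-cong ‖𝕚‖ ≈ʳ-refl) (*ʳ-identityˡ ‖ z ‖))))) ≤ʳ-refl

      phase-bound : ∀ {x} → x ∈[0, T ] → ‖ - (𝕚 * ι x) * μ ‖ ≤ʳ ⌊ M ⌋
      phase-bound {x} hx = ≤ʳ-trans (‖μ‖-scale (ι x)) (≤ʳ-trans
        (*ʳ-monoʳ ‖ μ ‖ (‖‖-nonneg μ) (≤ʳ-trans (≤ʳ-reflexive (≈ʳ-trans (‖ι‖ x) (absʳ-of-nonneg (0≤x hx))))
          (≤ʳ-trans (x≤T hx) (≤absʳ T))))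
        (proj₂ (proj₂ (upper-bound b))))

      B : ℝ
      B = ⌊ ExpBound.expBound M 0≤M ⌋

      0≤B : 0ʳ ≤ʳ B
      0≤B = ⌊⌋-nonneg (ExpBound.expBound-nonneg M 0≤M)

    wave-estimate : ∃[ K ] 0ʳ ≤ʳ K × (∀ {x y} → x ∈[0, T ] → y ∈[0, T ] →
      ‖ wave μ y - wave μ x - ι (y -ʳ x) * (frequency μ * wave μ x) ‖ ≤ʳ (y -ʳ x) *ʳ (y -ʳ x) *ʳ K)
    wave-estimate = ‖ μ ‖ *ʳ ‖ μ ‖ *ʳ B , *ʳ-nonneg (*ʳ-nonneg (‖‖-nonneg μ) (‖‖-nonneg μ)) 0≤B , λ {x} {y} hx hy →
      -- The phase is linear in time, so the estimate for `exp` at two phases becomes one in y - x,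
      -- and the square of ‖μ‖ goes into K.
      let Δ≈ = ≈-trans (solve 4 (λ i x y μ → :- (i :* y) :* μ :- :- (i :* x) :* μ
                                     := :- (i :* (y :- x)) :* μ) ≈-refl 𝕚 (ι x) (ι y) μ)
                 (*-cong (neg-cong (*-cong ≈-refl (≈-sym (ι-sub y x)))) ≈-refl)
          ‖Δ‖≤ = ≤ʳ-trans (≤ʳ-reflexive (‖‖-cong Δ≈)) (‖μ‖-scale (ι (y -ʳ x)))
      in begin
      ‖ wave μ y - wave μ x - ι (y -ʳ x) * (frequency μ * wave μ x) ‖
        ≈⟨ ‖‖-cong (+-cong ≈-refl (neg-cong (≈-trans
             (solve 4 (λ h i μ w → h :* (:- (i :* μ) :* w) := :- (i :* h) :* μ :* w) ≈-refl
               (ι (y -ʳ x)) 𝕚 μ (wave μ x))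
             (*-cong (≈-sym Δ≈) ≈-refl)))) ⟩
      ‖ wave μ y - wave μ x - (- (𝕚 * ι y) * μ - - (𝕚 * ι x) * μ) * wave μ x ‖
        ≤⟨ exp-derivative M 0≤M (phase-bound hx) (phase-bound hy) ⟩
      ‖ - (𝕚 * ι y) * μ - - (𝕚 * ι x) * μ ‖ *ʳ ‖ - (𝕚 * ι y) * μ - - (𝕚 * ι x) * μ ‖ *ʳ B
        ≤⟨ *ʳ-monoʳ B 0≤B (*ʳ-mono-≤ (≤ʳ-trans (‖‖-nonneg _) ‖Δ‖≤) (‖‖-nonneg _) ‖Δ‖≤ ‖Δ‖≤) ⟩
      (‖ ι (y -ʳ x) ‖ *ʳ ‖ μ ‖) *ʳ (‖ ι (y -ʳ x) ‖ *ʳ ‖ μ ‖) *ʳ B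
        ≈⟨ solveʳ 3 (λ h m b → (h ⊗ m) ⊗ (h ⊗ m) ⊗ b ⊜ h ⊗ h ⊗ (m ⊗ m ⊗ b)) ≈ʳ-refl
             ‖ ι (y -ʳ x) ‖ ‖ μ ‖ B ⟩
      ‖ ι (y -ʳ x) ‖ *ʳ ‖ ι (y -ʳ x) ‖ *ʳ (‖ μ ‖ *ʳ ‖ μ ‖ *ʳ B)
        ≈⟨ *ʳ-cong (‖ι‖² (y -ʳ x)) ≈ʳ-refl ⟩
      (y -ʳ x) *ʳ (y -ʳ x) *ʳ (‖ μ ‖ *ʳ ‖ μ ‖ *ʳ B) ∎
      where open ℝ-Reasoning

    wave-bounded : ∃[ B ] 0ʳ ≤ʳ B × (∀ {x} → x ∈[0, T ] → ‖ wave μ x ‖ ≤ʳ B)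
    wave-bounded = B , 0≤B , λ hx → exp-bound M 0≤M (phase-bound hx)

  wave-exponential : ∀ μ → IsExponential (frequency μ) (wave μ)
  wave-exponential μ = record { antiderivative = wave-estimate μ ; locallyBounded = wave-bounded μ }

  -- For real ν this is exp(-i t (μ - ν)), kept in the product form in which it occurs in the
  -- squared modulus of an entry of U.
  wavePair : ℂ → ℂ → ℝ → ℂ
  wavePair μ ν t = wave μ t * wave ν t ̄

  wavePair-exponential : ∀ {μ ν} → ν ̄ ≈ ν → IsExponential (frequency (μ - ν)) (wavePair μ ν)
  wavePair-exponential {μ} {ν} ν̄≈ν = exponential-cong (begin
      frequency μ + frequency ν ̄    ≈⟨ +-cong ≈-refl (≈-trans (conj-neg (𝕚 * ν)) (neg-cong (conj-* 𝕚 ν))) ⟩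
      frequency μ - 𝕚 ̄ * ν ̄         ≈⟨ +-cong ≈-refl (neg-cong (*-cong conj-𝕚 ν̄≈ν)) ⟩
      frequency μ - - 𝕚 * ν         ≈⟨ solve 3 (λ i μ ν → :- (i :* μ) :- :- i :* ν := :- (i :* (μ :- ν))) ≈-refl 𝕚 μ ν ⟩
      frequency (μ - ν)             ∎)
    (exponential-* (wave-exponential μ) (exponential-conj (wave-exponential ν)))
    where open ℂ-Reasoning

  wave-unit : ∀ {μ} → μ ̄ ≈ μ → ∀ {t} → 0ʳ ≤ʳ t → wavePair μ μ t ≈ 1#
  wave-unit {μ} μ̄≈μ {t} 0≤t = ≈-trans
    (zero-derivative⇒constant (λ T →
      let (K , 0≤K , h) = antiderivative (wavePair-exponential μ̄≈μ) T in K , 0≤K , λ {x} {y} hx hy →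
        ≤ʳ-trans (≤ʳ-reflexive (‖‖-cong (+-cong ≈-refl (neg-cong (*-cong ≈-refl
          (solve 3 (λ i μ w → con 0ℚ := :- (i :* (μ :- μ)) :* w) ≈-refl 𝕚 μ (wavePair μ μ x))))))) (h hx hy))
      0≤t)
    (≈-trans (*-cong (wave-0 μ) (conj-cong (wave-0 μ))) (≈-trans (*-identityˡ _) (conj-ι 1ʳ)))

  -- Turns a bound on the squared modulus into one on the ℓ¹ norm without a square root.
  ‖‖≤2+normSqʳ : ∀ z → ‖ z ‖ ≤ʳ ⌊ 2ℚ ⌋ +ʳ normSqʳ z
  ‖‖≤2+normSqʳ z = ≤ʳ-trans (≤ʳ-reflexive (‖‖-def z)) (≤ʳ-trans (+ʳ-mono-≤ (bound (re z)) (bound (im z)))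
    (≤ʳ-reflexive (≈ʳ-trans (solveʳ 2 (λ a b → (conʳ 1ℚ ⊕ a) ⊕ (conʳ 1ℚ ⊕ b)
        ⊜ conʳ 2ℚ ⊕ (a ⊕ b)) ≈ʳ-refl (re z *ʳ re z) (im z *ʳ im z))
      (+ʳ-cong ≈ʳ-refl (≈ʳ-sym (normSqʳ-def z))))))
    where
    opaque
      unfolding _≈_
      ‖‖-def : ∀ z → ‖ z ‖ ≈ʳ absʳ (re z) +ʳ absʳ (im z)
      ‖‖-def z = ≈ʳ-refl
      normSqʳ-def : ∀ z → normSqʳ z ≈ʳ re z *ʳ re z +ʳ im z *ʳ im z
      normSqʳ-def z = ≈ʳ-refl
    -- From 0 ≤ ∣x∣ + (∣x∣ − 1)².
    bound : ∀ x → absʳ x ≤ʳ 1ʳ +ʳ x *ʳ x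
    bound x = 0≤-⇒≤ʳ (≤ʳ-trans (+ʳ-nonneg (absʳ-nonneg x) (square-nonnegʳ (absʳ x -ʳ 1ʳ)))
      (≤ʳ-reflexive (≈ʳ-trans
        (solveʳ 1 (λ a → a ⊕ (a ⊖ conʳ 1ℚ) ⊗ (a ⊖ conʳ 1ℚ) ⊜ conʳ 1ℚ ⊕ a ⊗ a ⊖ a) ≈ʳ-refl (absʳ x))
        (+ʳ-cong (+ʳ-cong ≈ʳ-refl (absʳ-square x)) ≈ʳ-refl))))

  -- Uniform in t, unlike the constant in `LocallyBounded`; this keeps the oscillating integrals
  -- bounded for all T at once.
  wave-bound : ∀ {μ} → μ ̄ ≈ μ → ∀ {t} → 0ʳ ≤ʳ t → ‖ wave μ t ‖ ≤ʳ ⌊ 2ℚ ⌋ +ʳ 1ʳ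
  wave-bound {μ} μ̄≈μ {t} 0≤t = ≤ʳ-trans (‖‖≤2+normSqʳ (wave μ t)) (≤ʳ-reflexive (+ʳ-cong ≈ʳ-refl normSq≈1))
    where
    normSq≈1 : normSqʳ (wave μ t) ≈ʳ 1ʳ
    normSq≈1 = ≈ʳ-trans (≈ʳ-sym (re-ι _)) (≈ʳ-trans (re-cong (≈-trans (≈-sym (conj*self (wave μ t)))
      (≈-trans (*-comm _ _) (wave-unit μ̄≈μ 0≤t)))) (re-ι 1ʳ))

open Waves

-- Means, Riemann sums and time averages.

module TimeAverages where
  open ℂS

  -- Stronger than a limit of averages: the integral stays within a fixed distance of the line t L.
  -- This passes to sums and multiples, and division by T leaves an error of order 1/T.
  record HasMean (f : ℝ → ℂ) (L : ℂ) : Set where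
    field
      integral       : ℝ → ℂ
      antiderivative : IsAntiderivative integral f
      deviation      : ℝ
      near-linear    : ∀ {t} → 0ʳ ≤ʳ t → ‖ integral t - integral 0ʳ - ι t * L ‖ ≤ʳ deviation

  open HasMean

  mean-cong : ∀ {f g L M} → (∀ {t} → 0ʳ ≤ʳ t → f t ≈ g t) → L ≈ M → HasMean f L → HasMean g M
  mean-cong f≈g L≈M m = record
    { integral = integral m
    ; antiderivative = λ T → let (K , 0≤K , h) = antiderivative m T in K , 0≤K , λ hx hy →
        ≤ʳ-trans (≤ʳ-reflexive (‖‖-cong (+-cong ≈-refl (neg-cong (*-cong ≈-refl (≈-sym (f≈g (0≤x hx)))))))) (h hx hy)
    ; deviation = deviation m
    ; near-linear = λ 0≤t →
        ≤ʳ-trans (≤ʳ-reflexive (‖‖-cong (+-cong ≈-refl (neg-cong (*-cong ≈-refl (≈-sym L≈M)))))) (near-linear m 0≤t)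
    }

  mean-0 : HasMean (λ _ → 0#) 0#
  mean-0 = record
    { integral = λ _ → 0#
    ; antiderivative = λ T → 0ʳ , ≤ʳ-refl , λ {x} {y} _ _ → ≤ʳ-reflexive (≈ʳ-trans
        (‖‖-0 (solve 1 (λ h → con 0ℚ :- con 0ℚ :- h :* con 0ℚ := con 0ℚ) ≈-refl (ι (y -ʳ x))))
        (≈ʳ-sym (*ʳ-zeroʳ _)))
    ; deviation = 0ʳ
    ; near-linear = λ {t} _ → ≤ʳ-reflexive
        (‖‖-0 (solve 1 (λ h → con 0ℚ :- con 0ℚ :- h :* con 0ℚ := con 0ℚ) ≈-refl (ι t)))
    }

  mean-1 : HasMean (λ _ → 1#) 1#
  mean-1 = record
    { integral = ι
    ; antiderivative = λ T → 0ʳ , ≤ʳ-refl , λ {x} {y} _ _ → ≤ʳ-reflexive (≈ʳ-trans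
        (‖‖-0 (≈-trans (+-cong ≈-refl (neg-cong (*-cong (ι-sub y x) ≈-refl)))
          (solve 2 (λ y x → y :- x :- (y :- x) :* con 1ℚ := con 0ℚ) ≈-refl (ι y) (ι x))))
        (≈ʳ-sym (*ʳ-zeroʳ _)))
    ; deviation = 0ʳ
    ; near-linear = λ {t} _ → ≤ʳ-reflexive
        (‖‖-0 (solve 1 (λ t → t :- con 0ℚ :- t :* con 1ℚ := con 0ℚ) ≈-refl (ι t)))
    }

  mean-+ : ∀ {f g L M} → HasMean f L → HasMean g M → HasMean (λ t → f t + g t) (L + M)
  mean-+ {f} {g} {L} {M} m n = record
    { integral = λ t → integral m t + integral n t
    ; antiderivative = λ T →
        let (K₁ , 0≤K₁ , h₁) = antiderivative m T
            (K₂ , 0≤K₂ , h₂) = antiderivative n T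
        in K₁ +ʳ K₂ , +ʳ-nonneg 0≤K₁ 0≤K₂ , λ {x} {y} hx hy → ≤ʳ-trans
          (≤ʳ-reflexive (‖‖-cong (rearrange (integral m y) (integral n y) (integral m x) (integral n x) (ι (y -ʳ x)) (f x) (g x))))
          (≤ʳ-trans (‖‖-+-≤ (h₁ hx hy) (h₂ hx hy))
            (≤ʳ-reflexive (solveʳ 3 (λ h a b → h ⊗ a ⊕ h ⊗ b ⊜ h ⊗ (a ⊕ b)) ≈ʳ-refl
              ((y -ʳ x) *ʳ (y -ʳ x)) K₁ K₂)))
    ; deviation = deviation m +ʳ deviation n
    ; near-linear = λ {t} 0≤t → ≤ʳ-trans
        (≤ʳ-reflexive (‖‖-cong (rearrange (integral m t) (integral n t) (integral m 0ʳ) (integral n 0ʳ) (ι t) L M)))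
        (‖‖-+-≤ (near-linear m 0≤t) (near-linear n 0≤t))
    }
    where
    rearrange : ∀ a b c d h x y → a + b - (c + d) - h * (x + y) ≈ (a - c - h * x) + (b - d - h * y)
    rearrange = solve 7 (λ a b c d h x y → a :+ b :- (c :+ d) :- h :* (x :+ y) := (a :- c :- h :* x) :+ (b :- d :- h :* y)) ≈-refl

  mean-scale : ∀ c {f L} → HasMean f L → HasMean (λ t → c * f t) (c * L)
  mean-scale c {f} {L} m = record
    { integral = λ t → c * integral m t
    ; antiderivative = λ T →
        let (K , 0≤K , h) = antiderivative m T
        in ‖ c ‖ *ʳ K , *ʳ-nonneg (‖‖-nonneg c) 0≤K , λ {x} {y} hx hy → ≤ʳ-trans
          (≤ʳ-reflexive (‖‖-cong (factor (integral m y) (integral m x) (ι (y -ʳ x)) (f x))))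
          (≤ʳ-trans (‖‖-*-≤ ≤ʳ-refl (h hx hy))
            (≤ʳ-reflexive (solveʳ 3 (λ c h a → c ⊗ (h ⊗ a) ⊜ h ⊗ (c ⊗ a)) ≈ʳ-refl
              ‖ c ‖ ((y -ʳ x) *ʳ (y -ʳ x)) K)))
    ; deviation = ‖ c ‖ *ʳ deviation m
    ; near-linear = λ {t} 0≤t → ≤ʳ-trans
        (≤ʳ-reflexive (‖‖-cong (factor (integral m t) (integral m 0ʳ) (ι t) L)))
        (‖‖-*-≤ ≤ʳ-refl (near-linear m 0≤t))
    }
    where
    factor : ∀ a b h x → c * a - c * b - h * (c * x) ≈ c * (a - b - h * x)
    factor = solve 5 (λ c a b h x → c :* a :- c :* b :- h :* (c :* x) := c :* (a :- b :- h :* x)) ≈-refl c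

  mean-sum : ∀ {n} {f : Fin n → ℝ → ℂ} {L : Vector ℂ n} → (∀ i → HasMean (f i) (L i)) →
             HasMean (λ t → ∑ (λ i → f i t)) (∑ L)
  mean-sum {zero}  m = mean-0
  mean-sum {suc n} m = mean-+ (m zero) (mean-sum (λ i → m (suc i)))

  -- With κ = 1/c an antiderivative of f is κ f, which is bounded along with f and so never strays
  -- far from the line of slope 0.
  mean-exponential : ∀ {c κ f B} → κ * c ≈ 1# → IsExponential c f → (∀ {t} → 0ʳ ≤ʳ t → ‖ f t ‖ ≤ʳ B) → HasMean f 0#
  mean-exponential {c} {κ} {f} {B} κc≈1 e b = record
    { integral = λ t → κ * f t
    ; antiderivative = λ T →
        let (K , 0≤K , h) = IsExponential.antiderivative e T
        in ‖ κ ‖ *ʳ K , *ʳ-nonneg (‖‖-nonneg κ) 0≤K , λ {x} {y} hx hy → ≤ʳ-trans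
          (≤ʳ-reflexive (‖‖-cong (≈-trans
            (+-cong ≈-refl (neg-cong (*-cong ≈-refl (≈-trans (≈-sym (*-identityˡ (f x))) (*-cong (≈-sym κc≈1) ≈-refl)))))
            (solve 6 (λ κ c a b h x → κ :* a :- κ :* b :- h :* (κ :* c :* x) := κ :* (a :- b :- h :* (c :* x))) ≈-refl
              κ c (f y) (f x) (ι (y -ʳ x)) (f x)))))
          (≤ʳ-trans (‖‖-*-≤ ≤ʳ-refl (h hx hy))
            (≤ʳ-reflexive (solveʳ 3 (λ c h a → c ⊗ (h ⊗ a) ⊜ h ⊗ (c ⊗ a)) ≈ʳ-refl
              ‖ κ ‖ ((y -ʳ x) *ʳ (y -ʳ x)) K)))
    ; deviation = ‖ κ ‖ *ʳ (B +ʳ B)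
    ; near-linear = λ {t} 0≤t → ≤ʳ-trans
        (≤ʳ-reflexive (‖‖-cong (solve 4 (λ κ a b h → κ :* a :- κ :* b :- h :* con 0ℚ := κ :* (a :- b)) ≈-refl
          κ (f t) (f 0ʳ) (ι t))))
        (‖‖-*-≤ ≤ʳ-refl (≤ʳ-trans (‖‖-sub (f t) (f 0ʳ)) (+ʳ-mono-≤ (b 0≤t) (b ≤ʳ-refl))))
    }

  -- Riemann sums against an antiderivative.

  module Riemann {G f : ℝ → ℂ} (G′≈f : IsAntiderivative G f) (T : ℝ) where

    private
      K : ℝ
      K = proj₁ (G′≈f T)

    0≤K : 0ʳ ≤ʳ K
    0≤K = proj₁ (proj₂ (G′≈f T))

    estimate : ∀ {x y} → x ∈[0, T ] → y ∈[0, T ] →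
               ‖ G y - G x - ι (y -ʳ x) * f x ‖ ≤ʳ (y -ʳ x) *ʳ (y -ʳ x) *ʳ K
    estimate = proj₂ (proj₂ (G′≈f T))

    -- A function on `ℝ` need not respect `_≈ʳ_`; for G the estimate with y - x equal to 0 forces
    -- it. A partition meets 0 and T only up to `_≈ᴿ_`.
    G-cong : ∀ {x y} → x ∈[0, T ] → y ∈[0, T ] → x ≈ʳ y → G x ≈ G y
    G-cong {x} {y} hx hy x≈y = ≈-sym (difference≈0 (≈-trans
      (solve 2 (λ a h → a := a :- con 0ℚ :* h) ≈-refl (G y - G x) (f x))
      (≈-trans (+-cong ≈-refl (neg-cong (*-cong (ι-cong (≈ʳ-sym y-x≈0)) ≈-refl)))
        (‖‖≤0⇒≈0 (≤ʳ-trans (estimate hx hy) (≤ʳ-reflexive (≈ʳ-trans (*ʳ-cong (*ʳ-cong y-x≈0 ≈ʳ-refl) ≈ʳ-refl)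
          (≈ʳ-trans (*ʳ-cong (*ʳ-zeroˡ _) ≈ʳ-refl) (*ʳ-zeroˡ K)))))))))
      where
      y-x≈0 : y -ʳ x ≈ʳ 0ʳ
      y-x≈0 = ≈ʳ-trans (+ʳ-cong ≈ʳ-refl (-ʳ-cong x≈y)) (-ʳ-inverseʳ y)

    -- Both endpoints are expanded around the tag, where f is evaluated. The two squares add up to
    -- at most (y - x)², the difference being 2 (y - ξ)(ξ - x).
    cell-error : ∀ {x ξ y} → x ∈[0, T ] → y ∈[0, T ] → x ≤ʳ ξ → ξ ≤ʳ y →
                 ‖ f ξ * ι (y -ʳ x) - (G y - G x) ‖ ≤ʳ (y -ʳ x) *ʳ (y -ʳ x) *ʳ K
    cell-error {x} {ξ} {y} hx hy x≤ξ ξ≤y = begin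
      ‖ f ξ * ι (y -ʳ x) - (G y - G x) ‖
        ≈⟨ ‖‖-cong (≈-trans (+-cong (*-cong ≈-refl (ι-sub y x)) ≈-refl)
             (≈-trans (solve 7 (λ x y ξ F a b c → F :* (y :- x) :- (b :- a) :=
                 (a :- c :- (x :- ξ) :* F) :- (b :- c :- (y :- ξ) :* F)) ≈-refl
               (ι x) (ι y) (ι ξ) (f ξ) (G x) (G y) (G ξ))
             (+-cong (+-cong ≈-refl (neg-cong (*-cong (≈-sym (ι-sub x ξ)) ≈-refl)))
               (neg-cong (+-cong ≈-refl (neg-cong (*-cong (≈-sym (ι-sub y ξ)) ≈-refl))))))) ⟩
      ‖ (G x - G ξ - ι (x -ʳ ξ) * f ξ) - (G y - G ξ - ι (y -ʳ ξ) * f ξ) ‖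
        ≤⟨ ‖‖-sub _ _ ⟩
      ‖ G x - G ξ - ι (x -ʳ ξ) * f ξ ‖ +ʳ ‖ G y - G ξ - ι (y -ʳ ξ) * f ξ ‖
        ≤⟨ +ʳ-mono-≤ (estimate hξ hx) (estimate hξ hy) ⟩
      (x -ʳ ξ) *ʳ (x -ʳ ξ) *ʳ K +ʳ (y -ʳ ξ) *ʳ (y -ʳ ξ) *ʳ K
        ≤⟨ 0≤-⇒≤ʳ (≤ʳ-trans (*ʳ-nonneg (+ʳ-nonneg cross cross) 0≤K) (≤ʳ-reflexive
             (solveʳ 4 (λ x y ξ K → ((y ⊖ ξ) ⊗ (ξ ⊖ x) ⊕ (y ⊖ ξ) ⊗ (ξ ⊖ x)) ⊗ K ⊜
               (y ⊖ x) ⊗ (y ⊖ x) ⊗ K ⊖ ((x ⊖ ξ) ⊗ (x ⊖ ξ) ⊗ K ⊕ (y ⊖ ξ) ⊗ (y ⊖ ξ) ⊗ K))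
               ≈ʳ-refl x y ξ K))) ⟩
      (y -ʳ x) *ʳ (y -ʳ x) *ʳ K ∎
      where
      open ℝ-Reasoning
      hξ : ξ ∈[0, T ]
      hξ = within (≤ʳ-trans (0≤x hx) x≤ξ) (≤ʳ-trans ξ≤y (x≤T hy))
      cross : 0ʳ ≤ʳ (y -ʳ ξ) *ʳ (ξ -ʳ x)
      cross = *ʳ-nonneg (≤ʳ⇒0≤- ξ≤y) (≤ʳ⇒0≤- x≤ξ)

    endpoints-ordered : ∀ m (p : Vector ℝ (suc m)) → (∀ i → p (inject₁ i) ≤ʳ p (suc i)) → p zero ≤ʳ p (Fin.fromℕ m)
    endpoints-ordered zero    p asc = ≤ʳ-refl
    endpoints-ordered (suc m) p asc = ≤ʳ-trans (asc zero) (endpoints-ordered m (λ i → p (suc i)) (λ i → asc (suc i)))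

    -- The first cell is split off. One factor of its squared width is bounded by δ, and the other
    -- telescopes to the length of the interval.
    sum-error : ∀ {δ} m (p : Vector ℝ (suc m)) (ξ : Vector ℝ m) →
      (∀ i → p (inject₁ i) ≤ʳ ξ i) → (∀ i → ξ i ≤ʳ p (suc i)) →
      0ʳ ≤ʳ p zero → p (Fin.fromℕ m) ≤ʳ T → (∀ i → p (suc i) -ʳ p (inject₁ i) ≤ʳ δ) →
      ‖ ∑ (λ i → f (ξ i) * ι (p (suc i) -ʳ p (inject₁ i))) - (G (p (Fin.fromℕ m)) - G (p zero)) ‖
        ≤ʳ (p (Fin.fromℕ m) -ʳ p zero) *ʳ (δ *ʳ K)
    sum-error {δ} zero p ξ lo hi 0≤p p≤T fine = ≤ʳ-reflexive (≈ʳ-trans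
      (‖‖-0 (solve 1 (λ a → con 0ℚ :- (a :- a) := con 0ℚ) ≈-refl (G (p zero))))
      (≈ʳ-sym (≈ʳ-trans (*ʳ-cong (-ʳ-inverseʳ (p zero)) ≈ʳ-refl) (*ʳ-zeroˡ _))))
    sum-error {δ} (suc m) p ξ lo hi 0≤p p≤T fine = begin
      ‖ f (ξ zero) * ι (y -ʳ x) + S - (G z - G x) ‖
        ≈⟨ ‖‖-cong (solve 5 (λ c s a b d → c :+ s :- (d :- a) := (c :- (b :- a)) :+ (s :- (d :- b)))
             ≈-refl (f (ξ zero) * ι (y -ʳ x)) S (G x) (G y) (G z)) ⟩
      ‖ (f (ξ zero) * ι (y -ʳ x) - (G y - G x)) + (S - (G z - G y)) ‖
        ≤⟨ ‖‖-+-≤ (cell-error hx hy (lo zero) (hi zero))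
             (sum-error m (λ i → p (suc i)) (λ i → ξ (suc i)) (λ i → lo (suc i)) (λ i → hi (suc i)) (0≤x hy) p≤T (λ i → fine (suc i))) ⟩
      (y -ʳ x) *ʳ (y -ʳ x) *ʳ K +ʳ (z -ʳ y) *ʳ (δ *ʳ K)
        ≤⟨ +ʳ-mono-≤ (*ʳ-monoʳ K 0≤K (*ʳ-monoˡ (y -ʳ x) (≤ʳ⇒0≤- x≤y) (fine zero))) ≤ʳ-refl ⟩
      (y -ʳ x) *ʳ δ *ʳ K +ʳ (z -ʳ y) *ʳ (δ *ʳ K)
        ≈⟨ solveʳ 5 (λ x y z d k → (y ⊖ x) ⊗ d ⊗ k ⊕ (z ⊖ y) ⊗ (d ⊗ k) ⊜ (z ⊖ x) ⊗ (d ⊗ k)) ≈ʳ-refl x y z δ K ⟩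
      (z -ʳ x) *ʳ (δ *ʳ K) ∎
      where
      open ℝ-Reasoning
      x y z : ℝ
      x = p zero
      y = p (suc zero)
      z = p (Fin.fromℕ (suc m))
      S : ℂ
      S = ∑ (λ i → f (ξ (suc i)) * ι (p (suc (suc i)) -ʳ p (suc (inject₁ i))))
      asc : ∀ i → p (inject₁ i) ≤ʳ p (suc i)
      asc i = ≤ʳ-trans (lo i) (hi i)
      x≤y : x ≤ʳ y
      x≤y = asc zero
      y≤z : y ≤ʳ z
      y≤z = endpoints-ordered m (λ i → p (suc i)) (λ i → asc (suc i))
      hx : x ∈[0, T ]
      hx = within 0≤p (≤ʳ-trans x≤y (≤ʳ-trans y≤z p≤T))
      hy : y ∈[0, T ]
      hy = within (≤ʳ-trans 0≤p x≤y) (≤ʳ-trans y≤z p≤T)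

  -- Passage between the opaque operations and the notions of the statement.

  opaque
    unfolding _≈_ _≈ʳ_

    ≤ᴿ⇒≤ʳ : ∀ {x y} → x ≤ᴿ y → x ≤ʳ y
    ≤ᴿ⇒≤ʳ h = h

    ≈ᴿ⇒≈ʳ : ∀ {x y} → x ≈ᴿ y → x ≈ʳ y
    ≈ᴿ⇒≈ʳ h = h

    0≤ʳ : ∀ {x} → 0ᴿ <ᴿ x → 0ʳ ≤ʳ x
    0≤ʳ {x} 0<x = <ᴿ⇒≤ʳ {0ᴿ} {x} 0<x

    width≤ʳ : ∀ {x y δ} → (y -ᴿ x) <ᴿ δ → y -ʳ x ≤ʳ δ
    width≤ʳ {x} {y} {δ} h = <ᴿ⇒≤ʳ {y -ᴿ x} {δ} h

    ≈ʳ-0ᴿ : ∀ {x} → x ≈ᴿ 0ᴿ → x ≈ʳ 0ʳ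
    ≈ʳ-0ᴿ h = h

    0<⌊⌋ : ∀ {q} → 0ℚ ℚ.< q → 0ᴿ <ᴿ ⌊ q ⌋
    0<⌊⌋ {q} 0<q = <ᴿ-between {0ᴿ} {⌊ q ⌋} 0<q (≤ʳ-refl {0ʳ}) (≤ʳ-refl {⌊ q ⌋})

    -- `_within_of_` compares squares strictly, and the factor ½ leaves room for this: ∣z - w∣² ≤
    -- (q/2)² < q² ≤ ε².
    within-from-norm : ∀ {ε q z w} → 0ℚ ℚ.< q → ⌊ q ⌋ ≤ʳ ε → ‖ z - w ‖ ≤ʳ ⌊ ½ ℚ.* q ⌋ → z within ε of w
    within-from-norm {ε} {q} {z} {w} 0<q q≤ε h = <ᴿ-between {normSqʳ (z - w)} {ε *ʳ ε} ½q²<q²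
        (≤ʳ-trans {normSqʳ (z - w)} {‖ z - w ‖ *ʳ ‖ z - w ‖} {⌊ (½ ℚ.* q) ℚ.* (½ ℚ.* q) ⌋} (normSqʳ≤‖‖² (z - w))
          (≤ʳ-trans {‖ z - w ‖ *ʳ ‖ z - w ‖} {⌊ ½ ℚ.* q ⌋ *ʳ ⌊ ½ ℚ.* q ⌋} {⌊ (½ ℚ.* q) ℚ.* (½ ℚ.* q) ⌋}
            (*ʳ-mono-≤ {‖ z - w ‖} {⌊ ½ ℚ.* q ⌋} {‖ z - w ‖} {⌊ ½ ℚ.* q ⌋}
              (⌊⌋-nonneg (ℚ.<⇒≤ (½-pos 0<q))) (‖‖-nonneg (z - w)) h h)
            (≤ʳ-refl {⌊ (½ ℚ.* q) ℚ.* (½ ℚ.* q) ⌋})))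
        (*ʳ-mono-≤ {⌊ q ⌋} {ε} {⌊ q ⌋} {ε} (≤ʳ-trans {0ʳ} {⌊ q ⌋} {ε} (⌊⌋-nonneg (ℚ.<⇒≤ 0<q)) q≤ε)
          (⌊⌋-nonneg (ℚ.<⇒≤ 0<q)) q≤ε q≤ε)
      where
      ½q²<q² : (½ ℚ.* q) ℚ.* (½ ℚ.* q) ℚ.< q ℚ.* q
      ½q²<q² = ℚ.<-trans (ℚ.*-monoʳ-<-pos (½ ℚ.* q) {{ℚ.positive (½-pos 0<q)}} (half< 0<q))
        (ℚ.*-monoˡ-<-pos q {{ℚ.positive 0<q}} (half< 0<q))

    riemannSum-≡ : ∀ {a b} f (P : TaggedPartition a b) → riemannSum f P ≡
      ∑ (λ i → f (tag P i) * ι (point P (suc i) -ʳ point P (inject₁ i)))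
    riemannSum-≡ f P = ≡.refl

  fundamental-theorem : ∀ {G f} → IsAntiderivative G f → ∀ T → 0ʳ ≤ʳ T → IsIntegral f 0ᴿ T (G T - G 0ʳ)
  fundamental-theorem {G} {f} G′≈f T 0≤T ε 0<ε =
    let (q , 0<q , q≤ε)  = 0<⇒lower {ε} 0<ε
        (K , 0≤K , _)    = G′≈f T
        (b , 0<b , TK≤b) = upper-bound (T *ʳ K)
        η                = ½ ℚ.* q
        -- The mesh: a Riemann sum that fine errs by at most T K d ≤ b d = η.
        d                = η ℚ.* recip b 0<b
        0<d              = *-pos (½-pos 0<q) (recip-pos b 0<b)
    in ⌊ d ⌋ , 0<⌊⌋ 0<d , λ P fine →
       let p     = point P
           N     = size P
           p₀≈0  = ≈ʳ-0ᴿ {p zero} (first P)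
           p₁≈T  = ≈ᴿ⇒≈ʳ {p (Fin.fromℕ N)} {T} (last P)
           p₀∈   = within (≤ʳ-reflexive (≈ʳ-sym p₀≈0)) (≤ʳ-trans (≤ʳ-reflexive p₀≈0) 0≤T)
           p₁∈   = within (≤ʳ-trans 0≤T (≤ʳ-reflexive (≈ʳ-sym p₁≈T))) (≤ʳ-reflexive p₁≈T)
       in within-from-norm 0<q q≤ε (begin
         ‖ riemannSum f P - (G T - G 0ʳ) ‖
           ≡⟨ ≡.cong (λ s → ‖ s - (G T - G 0ʳ) ‖) (riemannSum-≡ f P) ⟩
         ‖ ∑ (λ i → f (tag P i) * ι (p (suc i) -ʳ p (inject₁ i))) - (G T - G 0ʳ) ‖
           ≈⟨ ‖‖-cong (+-cong ≈-refl (neg-cong (+-cong (G-cong (within 0≤T ≤ʳ-refl) p₁∈ (≈ʳ-sym p₁≈T))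
                (neg-cong (G-cong (within ≤ʳ-refl 0≤T) p₀∈ (≈ʳ-sym p₀≈0)))))) ⟩
         ‖ ∑ (λ i → f (tag P i) * ι (p (suc i) -ʳ p (inject₁ i))) - (G (p (Fin.fromℕ N)) - G (p zero)) ‖
           ≤⟨ sum-error N p (tag P) (λ i → ≤ᴿ⇒≤ʳ {p (inject₁ i)} {tag P i} (point≤tag P i)) (λ i → ≤ᴿ⇒≤ʳ {tag P i} {p (suc i)} (tag≤point P i))
                (0≤x p₀∈) (x≤T p₁∈) (λ i → width≤ʳ {p (inject₁ i)} {p (suc i)} (fine i)) ⟩
         (p (Fin.fromℕ N) -ʳ p zero) *ʳ (⌊ d ⌋ *ʳ K)
           ≈⟨ *ʳ-cong (+ʳ-cong p₁≈T (-ʳ-cong p₀≈0)) ≈ʳ-refl ⟩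
         (T -ʳ 0ʳ) *ʳ (⌊ d ⌋ *ʳ K)
           ≈⟨ solveʳ 3 (λ t d k → (t ⊖ conʳ 0ℚ) ⊗ (d ⊗ k) ⊜ t ⊗ k ⊗ d) ≈ʳ-refl T ⌊ d ⌋ K ⟩
         T *ʳ K *ʳ ⌊ d ⌋
           ≤⟨ *ʳ-monoʳ ⌊ d ⌋ (⌊⌋-nonneg (ℚ.<⇒≤ 0<d)) TK≤b ⟩
         ⌊ b ⌋ *ʳ ⌊ d ⌋
           ≈⟨ ⌊⌋-* b d ⟨
         ⌊ b ℚ.* d ⌋
           ≈⟨ ⌊⌋-cong (*-recip b η 0<b) ⟩
         ⌊ η ⌋ ∎)
    where
    open ℝ-Reasoning
    open Riemann G′≈f T

  module _ {f L} (m : HasMean f L) where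

    private
      growth : (T : ℝ) → ℂ
      growth T = integral m T - integral m 0ʳ

    -- With 1/T factored out, what remains is the deviation, at most c, divided by T ≥ c/q.
    average-error : ∀ {q c T} (0<q : 0ℚ ℚ.< q) (0<T : 0ᴿ <ᴿ T) → deviation m ≤ʳ ⌊ c ⌋ →
                    ⌊ c ℚ.* recip q 0<q ⌋ ≤ʳ T → ‖ ι (inverse T 0<T) * growth T - L ‖ ≤ʳ ⌊ q ⌋
    average-error {q} {c} {T} 0<q 0<T dev≤c T₀≤T = begin
      ‖ ι v * growth T - L ‖
        ≈⟨ ‖‖-cong (≈-trans (+-cong ≈-refl (neg-cong (≈-trans (≈-sym (*-identityˡ L))
             (*-cong (≈-trans (≈-sym (ι-cong (inverse-inverseˡ T 0<T))) (ι-* v T)) ≈-refl))))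
             (solve 4 (λ v g t l → v :* g :- v :* t :* l := v :* (g :- t :* l)) ≈-refl
               (ι v) (growth T) (ι T) L)) ⟩
      ‖ ι v * (growth T - ι T * L) ‖
        ≤⟨ ‖‖-*-≤ (≤ʳ-reflexive (≈ʳ-trans (‖ι‖ v) (absʳ-of-nonneg 0≤v))) (≤ʳ-trans (near-linear m (0≤ʳ 0<T)) dev≤c) ⟩
      v *ʳ ⌊ c ⌋
        ≈⟨ *ʳ-cong ≈ʳ-refl (≈ʳ-trans (⌊⌋-cong (≡.sym (*-recip q c 0<q))) (⌊⌋-* q (c ℚ.* recip q 0<q))) ⟩
      v *ʳ (⌊ q ⌋ *ʳ ⌊ c ℚ.* recip q 0<q ⌋)
        ≤⟨ *ʳ-monoˡ v 0≤v (*ʳ-monoˡ ⌊ q ⌋ (⌊⌋-nonneg (ℚ.<⇒≤ 0<q)) T₀≤T) ⟩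
      v *ʳ (⌊ q ⌋ *ʳ T)
        ≈⟨ solveʳ 3 (λ v q t → v ⊗ (q ⊗ t) ⊜ (v ⊗ t) ⊗ q) ≈ʳ-refl v ⌊ q ⌋ T ⟩
      v *ʳ T *ʳ ⌊ q ⌋
        ≈⟨ ≈ʳ-trans (*ʳ-cong (inverse-inverseˡ T 0<T) ≈ʳ-refl) (*ʳ-identityˡ ⌊ q ⌋) ⟩
      ⌊ q ⌋ ∎
      where
      open ℝ-Reasoning
      v : ℝ
      v = inverse T 0<T
      0≤v : 0ʳ ≤ʳ v
      0≤v = inverse-nonneg T 0<T

    opaque
      unfolding _≈_ _≈ʳ_

      average-limit : Defs.LimitAtInfinity (λ T 0<T → fromℝ (inverse T 0<T) *ᶜ growth T) L
      average-limit ε 0<ε =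
        let (q , 0<q , q≤ε)   = 0<⇒lower {ε} 0<ε
            (c , 0<c , dev≤c) = upper-bound (deviation m)
            0<½q              = ½-pos 0<q
        in ⌊ c ℚ.* recip (½ ℚ.* q) 0<½q ⌋ , λ T 0<T T₀≤T →
           within-from-norm {ε} {q} {fromℝ (inverse T 0<T) *ᶜ growth T} {L} 0<q q≤ε
             (average-error {½ ℚ.* q} {c} {T} 0<½q 0<T dev≤c T₀≤T)

    mean⇒time-average : IsTimeAverage f L
    mean⇒time-average =
      (λ T _ → growth T) , (λ T 0<T → fundamental-theorem (antiderivative m) T (0≤ʳ 0<T)) , average-limit

open TimeAverages

-- The cyclic shift of indices.

module CyclicShift where
  open import Data.Integer.Solver using (module +-*-Solver)

  rotate : ∀ {m} → Fin (suc m) → Fin (suc m)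
  rotate i with view i
  ... | ‵fromℕ     = zero
  ... | ‵inject₁ j = suc j

  rotate-last : ∀ m → rotate (Fin.fromℕ m) ≡ zero
  rotate-last m rewrite view-fromℕ m = ≡.refl

  rotate-inject₁ : ∀ {m} (j : Fin m) → rotate (inject₁ j) ≡ suc j
  rotate-inject₁ j rewrite view-inject₁ j = ≡.refl

  toℕ-rotate : ∀ {m} (i : Fin (suc m)) → ∃[ q ] ℤ.+ toℕ (rotate i) ≡ 1ℤ ℤ.+ ℤ.+ toℕ i ℤ.+ q ℤ.* ℤ.+ suc m
  toℕ-rotate {m} i with view i
  -- The wrap-around of the top index m: 0 = 1 + m - (m + 1).
  ... | ‵fromℕ     = -1ℤ , ≡.trans (solve 1 (λ x → con 0ℤ := x :+ con -1ℤ :* x) ≡.refl (ℤ.+ suc m))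
    (≡.cong (λ k → ℤ.+ suc k ℤ.+ -1ℤ ℤ.* ℤ.+ suc m) (≡.sym (toℕ-fromℕ m)))
    where open +-*-Solver
  ... | ‵inject₁ j = 0ℤ , ≡.trans (≡.cong (ℤ.+_ ∘ suc) (≡.sym (toℕ-inject₁ j))) (≡.sym (ℤ.+-identityʳ _))

  -- Both indices move by 1 modulo n, so their difference changes by a multiple of n. This is the
  -- premise under which `IsCirculant` identifies an entry with its shift.
  rotate-difference : ∀ {m} (j k : Fin (suc m)) →
    ℤ.+ suc m ℤ.∣ (ℤ.+ toℕ (rotate k) ℤ.- ℤ.+ toℕ (rotate j)) ℤ.- (ℤ.+ toℕ k ℤ.- ℤ.+ toℕ j)
  rotate-difference {m} j k =
    let (p , hp) = toℕ-rotate j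
        (q , hq) = toℕ-rotate k
    in Signed.∣⇒∣ᵤ (Signed.divides (q ℤ.- p) (≡.trans
         (≡.cong₂ (λ a b → (a ℤ.- b) ℤ.- (ℤ.+ toℕ k ℤ.- ℤ.+ toℕ j)) hq hp)
         (solve 5 (λ j k p q n → (con 1ℤ :+ k :+ q :* n) :- (con 1ℤ :+ j :+ p :* n) :- (k :- j) := (q :- p) :* n)
           ≡.refl (ℤ.+ toℕ j) (ℤ.+ toℕ k) p q (ℤ.+ suc m))))
    where open +-*-Solver

open CyclicShift

-- Finite sums and inner products.

module SpectralTheory where
  open ℂS

  sum-conj : ∀ {n} (f : Vector ℂ n) → ∑ f ̄ ≈ ∑ (λ i → f i ̄)
  sum-conj {zero}  f = conj-ι 0ʳ
  sum-conj {suc n} f = ≈-trans (conj-+ (f zero) _) (+-cong ≈-refl (sum-conj (f ∘ suc)))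

  sum-neg : ∀ {n} (f : Vector ℂ n) → - ∑ f ≈ ∑ (λ i → - f i)
  sum-neg {zero}  f = solve 0 (:- con 0ℚ := con 0ℚ) ≈-refl
  sum-neg {suc n} f = ≈-trans (solve 2 (λ a b → :- (a :+ b) := :- a :+ :- b) ≈-refl (f zero) (∑ (f ∘ suc)))
    (+-cong ≈-refl (sum-neg (f ∘ suc)))

  sum-zero : ∀ {n} (f : Vector ℂ n) → (∀ i → f i ≈ 0#) → ∑ f ≈ 0#
  sum-zero {zero}  f h = ≈-refl
  sum-zero {suc n} f h = ≈-trans (+-cong (h zero) (sum-zero (f ∘ suc) (h ∘ suc))) (+-identityˡ 0#)

  sum-single : ∀ {n} r (f : Vector ℂ n) → (∀ s → r ≢ s → f s ≈ 0#) → ∑ f ≈ f r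
  sum-single zero    f h = ≈-trans (+-cong ≈-refl (sum-zero (f ∘ suc) (λ s → h (suc s) λ ()))) (+-identityʳ (f zero))
  sum-single (suc r) f h = ≈-trans
    (+-cong (h zero λ ()) (sum-single r (f ∘ suc) (λ s r≢s → h (suc s) (r≢s ∘ suc-injective)))) (+-identityˡ (f (suc r)))

  sum-constant : ∀ n x → ∑ {n} (λ _ → x) ≈ ratC (natℚ n) * x
  sum-constant zero    x = ≈-sym (*-zeroˡ x)
  sum-constant (suc n) x = ≈-trans (+-cong ≈-refl (sum-constant n x))
    (≈-trans (solve 2 (λ x n → x :+ n :* x := (con 1ℚ :+ n) :* x) ≈-refl x (ratC (natℚ n)))
      (*-cong (≈-sym (ratC-+ 1ℚ (natℚ n))) ≈-refl))

  re-sum-nonneg : ∀ {n} (f : Vector ℂ n) → (∀ i → 0ʳ ≤ʳ re (f i)) → 0ʳ ≤ʳ re (∑ f)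
  re-sum-nonneg {zero}  f h = ≤ʳ-reflexive (≈ʳ-sym (re-ι 0ʳ))
  re-sum-nonneg {suc n} f h = ≤ʳ-trans (+ʳ-nonneg (h zero) (re-sum-nonneg (f ∘ suc) (h ∘ suc)))
    (≤ʳ-reflexive (≈ʳ-sym (re-+ (f zero) (∑ (f ∘ suc)))))

  re-term≤re-sum : ∀ {n} (f : Vector ℂ n) → (∀ i → 0ʳ ≤ʳ re (f i)) → ∀ i → re (f i) ≤ʳ re (∑ f)
  re-term≤re-sum f h zero = ≤ʳ-trans (≤ʳ-reflexive (≈ʳ-sym (+ʳ-identityʳ _)))
    (≤ʳ-trans (+ʳ-mono-≤ ≤ʳ-refl (re-sum-nonneg (f ∘ suc) (h ∘ suc))) (≤ʳ-reflexive (≈ʳ-sym (re-+ (f zero) _))))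
  re-term≤re-sum f h (suc i) = ≤ʳ-trans (≤ʳ-reflexive (≈ʳ-sym (+ʳ-identityˡ _)))
    (≤ʳ-trans (+ʳ-mono-≤ (h zero) (re-term≤re-sum (f ∘ suc) (h ∘ suc) i)) (≤ʳ-reflexive (≈ʳ-sym (re-+ (f zero) _))))

  re-conj*self : ∀ z → re (z ̄ * z) ≈ʳ normSqʳ z
  re-conj*self z = ≈ʳ-trans (re-cong (conj*self z)) (re-ι (normSqʳ z))

  conj*self-nonneg : ∀ z → 0ʳ ≤ʳ re (z ̄ * z)
  conj*self-nonneg z = ≤ʳ-trans (normSqʳ-nonneg z) (≤ʳ-reflexive (≈ʳ-sym (re-conj*self z)))

  -- The identity matrix `𝟙` in terms of the opaque constants; it also tabulates the means of
  -- `wavePair`.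
  δ : ∀ {n} → Matrix n
  δ j k with j Fin.≟ k
  ... | yes _ = 1#
  ... | no  _ = 0#

  δ-refl : ∀ {n} (j : Fin n) → δ j j ≈ 1#
  δ-refl j with j Fin.≟ j
  ... | yes _   = ≈-refl
  ... | no  j≢j = ⊥-elim (j≢j ≡.refl)

  δ-≢ : ∀ {n} {j k : Fin n} → j ≢ k → δ j k ≈ 0#
  δ-≢ {j = j} {k} j≢k with j Fin.≟ k
  ... | yes j≡k = ⊥-elim (j≢k j≡k)
  ... | no  _   = ≈-refl

  δ-real : ∀ {n} (j k : Fin n) → δ j k ̄ ≈ δ j k
  δ-real j k with j Fin.≟ k
  ... | yes _ = conj-ι 1ʳ
  ... | no  _ = conj-ι 0ʳ

  sum-δ : ∀ {n} j (f : Vector ℂ n) → ∑ (λ k → δ j k * f k) ≈ f j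
  sum-δ j f = ≈-trans (sum-single j (λ k → δ j k * f k) (λ k j≢k → ≈-trans (*-cong (δ-≢ j≢k) ≈-refl) (*-zeroˡ (f k))))
    (≈-trans (*-cong (δ-refl j) ≈-refl) (*-identityˡ (f j)))

  ⟪_,_⟫ : ∀ {n} → Vector ℂ n → Vector ℂ n → ℂ
  ⟪ u , w ⟫ = ∑ (λ j → u j ̄ * w j)

  inner-conj : ∀ {n} (u w : Vector ℂ n) → ⟪ u , w ⟫ ̄ ≈ ⟪ w , u ⟫
  inner-conj u w = ≈-trans (sum-conj (λ j → u j ̄ * w j)) (sum-cong-≋ λ j →
    ≈-trans (conj-* (u j ̄) (w j)) (≈-trans (*-cong (conj-involutive (u j)) ≈-refl) (*-comm (u j) (w j ̄))))

  inner-scaleʳ : ∀ {n} c (u w w′ : Vector ℂ n) → (∀ j → w′ j ≈ c * w j) → ⟪ u , w′ ⟫ ≈ c * ⟪ u , w ⟫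
  inner-scaleʳ c u w w′ h = ≈-trans (sum-cong-≋ λ j → ≈-trans (*-cong ≈-refl (h j))
      (solve 3 (λ c u w → u :* (c :* w) := c :* (u :* w)) ≈-refl c (u j ̄) (w j)))
    (≈-sym (*-distribˡ-sum c (λ j → u j ̄ * w j)))

  inner-scaleˡ : ∀ {n} c (u u′ w : Vector ℂ n) → (∀ j → u′ j ≈ c * u j) → ⟪ u′ , w ⟫ ≈ c ̄ * ⟪ u , w ⟫
  inner-scaleˡ c u u′ w h = ≈-trans
    (sum-cong-≋ λ j → ≈-trans (*-cong (≈-trans (conj-cong (h j)) (conj-* c (u j))) ≈-refl) (*-assoc (c ̄) (u j ̄) (w j)))
    (≈-sym (*-distribˡ-sum (c ̄) (λ j → u j ̄ * w j)))

  -- Spectral resolution of a Hermitian matrix with distinct eigenvalues.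

  module Eigenbasis {n : ℕ} (A : Matrix n) (A-hermitian : ∀ j k → A j k ≈ A k j ̄)
    (μ : Vector ℂ n) (v : Fin n → Vector ℂ n)
    (v-eigen : ∀ r j → ∑ (λ k → A j k * v r k) ≈ μ r * v r j)
    (d : Vector ℂ n) (d-inverse : ∀ r → d r * ⟪ v r , v r ⟫ ≈ 1#)
    (μ-distinct : ∀ r s → r ≢ s → ∃[ κ ] κ * (μ r - μ s) ≈ 1#) where

    IsEigenvector : ℂ → Vector ℂ n → Set
    IsEigenvector α w = ∀ j → ∑ (λ k → A j k * w k) ≈ α * w j

    self-adjoint : ∀ u w → ⟪ u , (λ j → ∑ (λ k → A j k * w k)) ⟫ ≈ ⟪ (λ j → ∑ (λ k → A j k * u k)) , w ⟫
    self-adjoint u w = begin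
      ∑ (λ j → u j ̄ * ∑ (λ k → A j k * w k))
        ≈⟨ sum-cong-≋ (λ j → *-distribˡ-sum (u j ̄) (λ k → A j k * w k)) ⟩
      ∑ (λ j → ∑ (λ k → u j ̄ * (A j k * w k)))
        ≈⟨ ∑-comm (λ j k → u j ̄ * (A j k * w k)) ⟩
      ∑ (λ k → ∑ (λ j → u j ̄ * (A j k * w k)))
        ≈⟨ sum-cong-≋ (λ k → sum-cong-≋ (λ j → entry j k)) ⟩
      ∑ (λ k → ∑ (λ j → (A k j * u j) ̄ * w k))
        ≈⟨ sum-cong-≋ (λ k → ≈-trans (*-cong (sum-conj (λ j → A k j * u j)) ≈-refl) (*-distribʳ-sum (w k) (λ j → (A k j * u j) ̄))) ⟨
      ∑ (λ k → ∑ (λ j → A k j * u j) ̄ * w k) ∎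
      where
      open ℂ-Reasoning
      entry : ∀ j k → u j ̄ * (A j k * w k) ≈ (A k j * u j) ̄ * w k
      entry j k = begin
        u j ̄ * (A j k * w k)     ≈⟨ *-cong ≈-refl (*-cong (A-hermitian j k) ≈-refl) ⟩
        u j ̄ * (A k j ̄ * w k)    ≈⟨ solve 3 (λ u a w → u :* (a :* w) := a :* u :* w) ≈-refl (u j ̄) (A k j ̄) (w k) ⟩
        A k j ̄ * u j ̄ * w k      ≈⟨ *-cong (conj-* (A k j) (u j)) ≈-refl ⟨
        (A k j * u j) ̄ * w k     ∎

    -- Compares ⟨A u, w⟩ with ⟨u, A w⟩. The case u = w makes eigenvalues real; distinct eigenvalues
    -- give orthogonality.
    eigenvector-inner : ∀ {α β u w} → IsEigenvector α u → IsEigenvector β w → (α ̄ - β) * ⟪ u , w ⟫ ≈ 0#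
    eigenvector-inner {α} {β} {u} {w} hu hw = begin
      (α ̄ - β) * ⟪ u , w ⟫
        ≈⟨ solve 3 (λ a b x → (a :- b) :* x := a :* x :- b :* x) ≈-refl (α ̄) β ⟪ u , w ⟫ ⟩
      α ̄ * ⟪ u , w ⟫ - β * ⟪ u , w ⟫
        ≈⟨ +-cong (inner-scaleˡ α u _ w hu) (neg-cong (inner-scaleʳ β u w _ hw)) ⟨
      ⟪ (λ j → ∑ (λ k → A j k * u k)) , w ⟫ - ⟪ u , (λ j → ∑ (λ k → A j k * w k)) ⟫
        ≈⟨ +-cong (self-adjoint u w) ≈-refl ⟨
      ⟪ u , (λ j → ∑ (λ k → A j k * w k)) ⟫ - ⟪ u , (λ j → ∑ (λ k → A j k * w k)) ⟫
        ≈⟨ neg-inverseʳ _ ⟩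
      0# ∎
      where open ℂ-Reasoning

    μ-real : ∀ r → μ r ̄ ≈ μ r
    μ-real r = difference≈0 (begin
      μ r ̄ - μ r                        ≈⟨ *-identityʳ (μ r ̄ - μ r) ⟨
      (μ r ̄ - μ r) * 1#                 ≈⟨ *-cong ≈-refl (≈-trans (*-comm D (d r)) (d-inverse r)) ⟨
      (μ r ̄ - μ r) * (D * d r)          ≈⟨ *-assoc (μ r ̄ - μ r) D (d r) ⟨
      (μ r ̄ - μ r) * D * d r            ≈⟨ *-cong (eigenvector-inner (v-eigen r) (v-eigen r)) ≈-refl ⟩
      0# * d r                          ≈⟨ *-zeroˡ (d r) ⟩
      0#                                ∎)
      where
      open ℂ-Reasoning
      D : ℂ
      D = ⟪ v r , v r ⟫

    -- Here w is an arbitrary eigenvector for `μ s`, so that shifted eigenvectors are covered as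
    -- well.
    orthogonal : ∀ {r s w} → r ≢ s → IsEigenvector (μ s) w → ⟪ v r , w ⟫ ≈ 0#
    orthogonal {r} {s} {w} r≢s hw = begin
      ⟪ v r , w ⟫                         ≈⟨ *-identityˡ _ ⟨
      1# * ⟪ v r , w ⟫                    ≈⟨ *-cong (proj₂ (μ-distinct r s r≢s)) ≈-refl ⟨
      κ * (μ r - μ s) * ⟪ v r , w ⟫       ≈⟨ *-assoc κ (μ r - μ s) ⟪ v r , w ⟫ ⟩
      κ * ((μ r - μ s) * ⟪ v r , w ⟫)     ≈⟨ *-cong ≈-refl (*-cong (+-cong (μ-real r) ≈-refl) ≈-refl) ⟨
      κ * ((μ r ̄ - μ s) * ⟪ v r , w ⟫)    ≈⟨ *-cong ≈-refl (eigenvector-inner (v-eigen r) hw) ⟩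
      κ * 0#                              ≈⟨ *-zeroʳ κ ⟩
      0#                                  ∎
      where
      open ℂ-Reasoning
      κ : ℂ
      κ = proj₁ (μ-distinct r s r≢s)

    d-real : ∀ r → d r ̄ ≈ d r
    d-real r = begin
      d r ̄              ≈⟨ *-identityʳ (d r ̄) ⟨
      d r ̄ * 1#         ≈⟨ *-cong ≈-refl (d-inverse r) ⟨
      d r ̄ * (d r * D)  ≈⟨ solve 3 (λ a b c → a :* (b :* c) := b :* (a :* c)) ≈-refl (d r ̄) (d r) D ⟩
      d r * (d r ̄ * D)  ≈⟨ *-cong ≈-refl (*-cong ≈-refl (inner-conj (v r) (v r))) ⟨
      d r * (d r ̄ * D ̄) ≈⟨ *-cong ≈-refl (conj-* (d r) D) ⟨
      d r * (d r * D) ̄  ≈⟨ *-cong ≈-refl (≈-trans (conj-cong (d-inverse r)) (conj-ι 1ʳ)) ⟩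
      d r * 1#          ≈⟨ *-identityʳ (d r) ⟩
      d r               ∎
      where
      open ℂ-Reasoning
      D : ℂ
      D = ⟪ v r , v r ⟫

    E : Fin n → Matrix n
    E r j k = d r * (v r j * v r k ̄)

    E-conj : ∀ r j k → E r j k ̄ ≈ E r k j
    E-conj r j k = begin
      (d r * (v r j * v r k ̄)) ̄   ≈⟨ conj-* (d r) _ ⟩
      d r ̄ * (v r j * v r k ̄) ̄    ≈⟨ *-cong (d-real r) (conj-* (v r j) (v r k ̄)) ⟩
      d r * (v r j ̄ * v r k ̄ ̄)    ≈⟨ *-cong ≈-refl (≈-trans (*-cong ≈-refl (conj-involutive (v r k))) (*-comm _ _)) ⟩
      d r * (v r k * v r j ̄)      ∎
      where open ℂ-Reasoning

    P : Matrix n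
    P j k = ∑ (λ r → E r j k)

    P-conj : ∀ j k → P j k ̄ ≈ P k j
    P-conj j k = ≈-trans (sum-conj (λ r → E r j k)) (sum-cong-≋ (λ r → E-conj r j k))

    P-apply : ∀ j w → ∑ (λ k → P j k * w k) ≈ ∑ (λ r → d r * v r j * ⟪ v r , w ⟫)
    P-apply j w = begin
      ∑ (λ k → P j k * w k)
        ≈⟨ sum-cong-≋ (λ k → *-distribʳ-sum (w k) (λ r → E r j k)) ⟩
      ∑ (λ k → ∑ (λ r → E r j k * w k))
        ≈⟨ ∑-comm (λ k r → E r j k * w k) ⟩
      ∑ (λ r → ∑ (λ k → E r j k * w k))
        ≈⟨ sum-cong-≋ (λ r → ≈-trans (sum-cong-≋ λ k →
             solve 4 (λ d a b w → d :* (a :* b) :* w := d :* a :* (b :* w)) ≈-refl (d r) (v r j) (v r k ̄) (w k))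
             (≈-sym (*-distribˡ-sum (d r * v r j) (λ k → v r k ̄ * w k)))) ⟩
      ∑ (λ r → d r * v r j * ⟪ v r , w ⟫) ∎
      where open ℂ-Reasoning

    -- Orthogonality leaves a single summand, a multiple of `v s`. Once P is known to be the
    -- identity, this says that eigenspaces are lines.
    P-eigenvector : ∀ {s w} → IsEigenvector (μ s) w → ∀ j → ∑ (λ k → P j k * w k) ≈ d s * v s j * ⟪ v s , w ⟫
    P-eigenvector {s} {w} hw j = ≈-trans (P-apply j w) (sum-single s (λ r → d r * v r j * ⟪ v r , w ⟫)
      λ r s≢r → ≈-trans (*-cong ≈-refl (orthogonal (s≢r ∘ ≡.sym) hw)) (*-zeroʳ _))

    P-fixes : ∀ s j → ∑ (λ k → P j k * v s k) ≈ v s j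
    P-fixes s j = ≈-trans (P-eigenvector (v-eigen s) j) (≈-trans
      (solve 3 (λ d v D → d :* v :* D := (d :* D) :* v) ≈-refl (d s) (v s j) ⟪ v s , v s ⟫)
      (≈-trans (*-cong (d-inverse s) ≈-refl) (*-identityˡ (v s j))))

    -- The columns of P are combinations of the vectors `v r`, which P fixes.
    P-idempotent : ∀ j l → ∑ (λ k → P j k * P k l) ≈ P j l
    P-idempotent j l = begin
      ∑ (λ k → P j k * P k l)
        ≈⟨ sum-cong-≋ (λ k → *-distribˡ-sum (P j k) (λ r → E r k l)) ⟩
      ∑ (λ k → ∑ (λ r → P j k * E r k l))
        ≈⟨ ∑-comm (λ k r → P j k * E r k l) ⟩
      ∑ (λ r → ∑ (λ k → P j k * E r k l))
        ≈⟨ sum-cong-≋ (λ r → ≈-trans (sum-cong-≋ λ k →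
             solve 4 (λ p d a b → p :* (d :* (a :* b)) := d :* b :* (p :* a)) ≈-refl (P j k) (d r) (v r k) (v r l ̄))
             (≈-sym (*-distribˡ-sum (d r * v r l ̄) (λ k → P j k * v r k)))) ⟩
      ∑ (λ r → d r * v r l ̄ * ∑ (λ k → P j k * v r k))
        ≈⟨ sum-cong-≋ (λ r → ≈-trans (*-cong ≈-refl (P-fixes r j))
             (solve 3 (λ d a b → d :* b :* a := d :* (a :* b)) ≈-refl (d r) (v r j) (v r l ̄))) ⟩
      P j l ∎
      where open ℂ-Reasoning

    P-trace : ∑ (λ j → P j j) ≈ ∑ {n} (λ _ → 1#)
    P-trace = begin
      ∑ (λ j → ∑ (λ r → E r j j))     ≈⟨ ∑-comm (λ j r → E r j j) ⟩
      ∑ (λ r → ∑ (λ j → E r j j))     ≈⟨ sum-cong-≋ (λ r → ≈-trans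
                                                (sum-cong-≋ λ j → *-cong (≈-refl {d r}) (*-comm (v r j) (v r j ̄)))
                                                (≈-sym (*-distribˡ-sum (d r) (λ j → v r j ̄ * v r j)))) ⟩
      ∑ (λ r → d r * ⟪ v r , v r ⟫)     ≈⟨ sum-cong-≋ d-inverse ⟩
      ∑ {n} (λ _ → 1#)                  ∎
      where open ℂ-Reasoning

    private
      Q : Matrix n
      Q j k = δ j k - P j k

      row-normSq : ∀ j → ∑ (λ k → Q j k ̄ * Q j k) ≈ 1# - P j j
      row-normSq j = begin
        ∑ (λ k → Q j k ̄ * Q j k)
          ≈⟨ sum-cong-≋ (λ k → *-cong (≈-trans (conj-+ (δ j k) (- P j k)) (+-cong (δ-real j k)
               (≈-trans (conj-neg (P j k)) (neg-cong (P-conj j k))))) ≈-refl) ⟩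
        ∑ (λ k → (δ j k - P k j) * (δ j k - P j k))
          -- Regrouped so that `δ j k` acts as a weight selecting k = j, and the rest is a diagonal
          -- entry of P P, given by idempotence.
          ≈⟨ sum-cong-≋ (λ k → solve 3 (λ e p q → (e :- q) :* (e :- p) := e :* (e :- p :- q) :+ p :* q)
               ≈-refl (δ j k) (P j k) (P k j)) ⟩
        ∑ (λ k → δ j k * (δ j k - P j k - P k j) + P j k * P k j)
          ≈⟨ ∑-distrib-+ (λ k → δ j k * (δ j k - P j k - P k j)) (λ k → P j k * P k j) ⟩
        ∑ (λ k → δ j k * (δ j k - P j k - P k j)) + ∑ (λ k → P j k * P k j)
          ≈⟨ +-cong (≈-trans (sum-δ j (λ k → δ j k - P j k - P k j)) (+-cong (+-cong (δ-refl j) ≈-refl) ≈-refl)) (P-idempotent j j) ⟩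
        1# - P j j - P j j + P j j
          ≈⟨ solve 1 (λ p → con 1ℚ :- p :- p :+ p := con 1ℚ :- p) ≈-refl (P j j) ⟩
        1# - P j j ∎
        where open ℂ-Reasoning

      total-normSq : ∑ (λ j → ∑ (λ k → Q j k ̄ * Q j k)) ≈ 0#
      total-normSq = begin
        ∑ (λ j → ∑ (λ k → Q j k ̄ * Q j k))      ≈⟨ sum-cong-≋ row-normSq ⟩
        ∑ (λ j → 1# - P j j)                      ≈⟨ ∑-distrib-+ (λ _ → 1#) (λ j → - P j j) ⟩
        ∑ {n} (λ _ → 1#) + ∑ (λ j → - P j j)    ≈⟨ +-cong ≈-refl (sum-neg (λ j → P j j)) ⟨
        ∑ {n} (λ _ → 1#) - ∑ (λ j → P j j)      ≈⟨ +-cong ≈-refl (neg-cong P-trace) ⟩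
        ∑ {n} (λ _ → 1#) - ∑ {n} (λ _ → 1#)     ≈⟨ neg-inverseʳ _ ⟩
        0#                                          ∎
        where open ℂ-Reasoning

    -- 1 − P is a Hermitian idempotent of trace 0, so its entries have total
    -- squared modulus 0.
    completeness : ∀ j k → P j k ≈ δ j k
    completeness j k = ≈-sym (difference≈0 (normSqʳ≤0⇒≈0 (begin
      normSqʳ (Q j k)                              ≈⟨ re-conj*self (Q j k) ⟨
      re (Q j k ̄ * Q j k)                          ≤⟨ re-term≤re-sum _ (λ k → conj*self-nonneg (Q j k)) k ⟩
      re (∑ (λ k → Q j k ̄ * Q j k))              ≤⟨ re-term≤re-sum _ (λ j → re-sum-nonneg _ (λ k → conj*self-nonneg (Q j k))) j ⟩
      re (∑ (λ j → ∑ (λ k → Q j k ̄ * Q j k)))  ≈⟨ re-cong total-normSq ⟩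
      re 0#                                        ≈⟨ re-ι 0ʳ ⟩
      0ʳ                                           ∎)))
      where open ℝ-Reasoning

    E-eigen : ∀ r j k → ∑ (λ l → A j l * E r l k) ≈ μ r * E r j k
    E-eigen r j k = begin
      ∑ (λ l → A j l * (d r * (v r l * v r k ̄)))
        ≈⟨ sum-cong-≋ (λ l → solve 4 (λ a d x y → a :* (d :* (x :* y)) := d :* y :* (a :* x)) ≈-refl (A j l) (d r) (v r l) (v r k ̄)) ⟩
      ∑ (λ l → d r * v r k ̄ * (A j l * v r l))
        ≈⟨ *-distribˡ-sum (d r * v r k ̄) (λ l → A j l * v r l) ⟨
      d r * v r k ̄ * ∑ (λ l → A j l * v r l)
        ≈⟨ *-cong ≈-refl (v-eigen r j) ⟩
      d r * v r k ̄ * (μ r * v r j)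
        ≈⟨ solve 4 (λ m d x y → d :* y :* (m :* x) := m :* (d :* (x :* y))) ≈-refl (μ r) (d r) (v r j) (v r k ̄) ⟩
      μ r * E r j k ∎
      where open ℂ-Reasoning

  sum-rotate : ∀ {m} (f : Vector ℂ (suc m)) → ∑ (f ∘ rotate) ≈ ∑ f
  sum-rotate {m} f = begin
    ∑ (f ∘ rotate)
      ≈⟨ sum-init-last (f ∘ rotate) ⟩
    ∑ (f ∘ rotate ∘ inject₁) + f (rotate (Fin.fromℕ m))
      ≈⟨ +-cong (sum-cong-≋ (λ j → ≡⇒≈ (≡.cong f (rotate-inject₁ j)))) (≡⇒≈ (≡.cong f (rotate-last m))) ⟩
    ∑ (f ∘ suc) + f zero
      ≈⟨ +-comm (∑ (f ∘ suc)) (f zero) ⟩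
    ∑ f ∎
    where
    open ℂ-Reasoning
    ≡⇒≈ : ∀ {z w} → z ≡ w → z ≈ w
    ≡⇒≈ ≡.refl = ≈-refl

  -- Below the top index `rotate` is the successor, so induction starting from index 0 reaches every
  -- index.
  rotate-invariant : ∀ {m} (g : Vector ℂ (suc m)) → (∀ j → g (rotate j) ≈ g j) → ∀ j → g j ≈ g zero
  rotate-invariant g h = <-weakInduction (λ j → g j ≈ g zero) ≈-refl λ j gj≈g0 →
    ≈-trans (≡.subst (λ k → g k ≈ g (inject₁ j)) (rotate-inject₁ j) (h (inject₁ j))) gj≈g0

  -- With `power` and `partialExp` this restates the matrix exponential in the opaque operations;
  -- `partialExp-≡` identifies the two versions.
  scaled : ∀ {n} → ℂ → Matrix n → Matrix n
  scaled c A j k = c * A j k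

  power : ∀ {n} → Matrix n → ℕ → Matrix n
  power B zero          = δ
  power B (suc k) j l = ∑ (λ i → B j i * power B k i l)

  partialExp : ∀ {n} → Matrix n → ℕ → Matrix n
  partialExp B zero    j l = 0#
  partialExp B (suc k) j l = partialExp B k j l + ratC 1/[ k !] * power B k j l

  ⇝-sum : ∀ {n} {u : Fin n → ℕ → ℂ} {L : Vector ℂ n} → (∀ i → u i ⇝ L i) → (λ k → ∑ (λ i → u i k)) ⇝ ∑ L
  ⇝-sum {zero}  h = ⇝-const 0#
  ⇝-sum {suc n} h = ⇝-+ (h zero) (⇝-sum (λ i → h (suc i)))

  -- Circulant matrices: moduli of eigenvectors, the transition matrix and its mean.

  module CirculantEigenbasis {m : ℕ} (A : Matrix (suc m)) (A-hermitian : ∀ j k → A j k ≈ A k j ̄)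
    (A-rotate : ∀ j k → A (rotate j) (rotate k) ≈ A j k)
    (μ : Vector ℂ (suc m)) (v : Fin (suc m) → Vector ℂ (suc m))
    (v-eigen : ∀ r j → ∑ (λ k → A j k * v r k) ≈ μ r * v r j)
    (d : Vector ℂ (suc m)) (d-inverse : ∀ r → d r * ⟪ v r , v r ⟫ ≈ 1#)
    (μ-distinct : ∀ r s → r ≢ s → ∃[ κ ] κ * (μ r - μ s) ≈ 1#) where

    open Eigenbasis A A-hermitian μ v v-eigen d d-inverse μ-distinct public

    n : ℕ
    n = suc m

    rotated-eigenvector : ∀ r → IsEigenvector (μ r) (v r ∘ rotate)
    rotated-eigenvector r j = begin
      ∑ (λ k → A j k * v r (rotate k))                   ≈⟨ sum-cong-≋ (λ k → *-cong (A-rotate j k) (≈-refl {v r (rotate k)})) ⟨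
      ∑ (λ k → A (rotate j) (rotate k) * v r (rotate k)) ≈⟨ sum-rotate (λ k → A (rotate j) k * v r k) ⟩
      ∑ (λ k → A (rotate j) k * v r k)                   ≈⟨ v-eigen r (rotate j) ⟩
      μ r * v r (rotate j)                                 ∎
      where open ℂ-Reasoning

    rotation-factor : Fin n → ℂ
    rotation-factor r = d r * ⟪ v r , v r ∘ rotate ⟫

    -- Eigenspaces are one-dimensional, so rotating an eigenvector rescales it.
    rotate-eigenvector : ∀ r j → v r (rotate j) ≈ rotation-factor r * v r j
    rotate-eigenvector r j = begin
      v r (rotate j)                            ≈⟨ sum-δ j (v r ∘ rotate) ⟨
      ∑ (λ k → δ j k * v r (rotate k))        ≈⟨ sum-cong-≋ (λ k → *-cong (completeness j k) (≈-refl {v r (rotate k)})) ⟨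
      ∑ (λ k → P j k * v r (rotate k))        ≈⟨ P-eigenvector (rotated-eigenvector r) j ⟩
      d r * v r j * ⟪ v r , v r ∘ rotate ⟫      ≈⟨ solve 3 (λ d v x → d :* v :* x := d :* x :* v) ≈-refl
                                                     (d r) (v r j) ⟪ v r , v r ∘ rotate ⟫ ⟩
      rotation-factor r * v r j                 ∎
      where open ℂ-Reasoning

    -- The shift permutes coordinates and so preserves the squared norm D: ∣c∣² D = D, and D is
    -- invertible.
    rotation-factor-unit : ∀ r → rotation-factor r ̄ * rotation-factor r ≈ 1#
    rotation-factor-unit r = begin
      c ̄ * c                          ≈⟨ *-identityʳ (c ̄ * c) ⟨
      c ̄ * c * 1#                     ≈⟨ *-cong ≈-refl (d-inverse r) ⟨
      c ̄ * c * (d r * D)              ≈⟨ solve 4 (λ a b d D → a :* b :* (d :* D) := d :* (b :* (a :* D))) ≈-refl (c ̄) c (d r) D ⟩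
      d r * (c * (c ̄ * D))            ≈⟨ *-cong ≈-refl (*-cong ≈-refl (inner-scaleˡ c (v r) (v r ∘ rotate) (v r) (rotate-eigenvector r))) ⟨
      d r * (c * ⟪ v r ∘ rotate , v r ⟫) ≈⟨ *-cong ≈-refl (inner-scaleʳ c (v r ∘ rotate) (v r) (v r ∘ rotate) (rotate-eigenvector r)) ⟨
      d r * ⟪ v r ∘ rotate , v r ∘ rotate ⟫ ≈⟨ *-cong ≈-refl (sum-rotate (λ j → v r j ̄ * v r j)) ⟩
      d r * D                         ≈⟨ d-inverse r ⟩
      1#                              ∎
      where
      open ℂ-Reasoning
      c D : ℂ
      c = rotation-factor r
      D = ⟪ v r , v r ⟫

    modulus-constant : ∀ r j → v r j ̄ * v r j ≈ v r zero ̄ * v r zero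
    modulus-constant r = rotate-invariant (λ j → v r j ̄ * v r j) λ j → begin
      v r (rotate j) ̄ * v r (rotate j)     ≈⟨ *-cong (≈-trans (conj-cong (rotate-eigenvector r j)) (conj-* c (v r j))) (rotate-eigenvector r j) ⟩
      (c ̄ * v r j ̄) * (c * v r j)          ≈⟨ solve 4 (λ a b x y → (a :* x) :* (b :* y) := (a :* b) :* (x :* y)) ≈-refl
                                                (c ̄) c (v r j ̄) (v r j) ⟩
      (c ̄ * c) * (v r j ̄ * v r j)          ≈⟨ *-cong (rotation-factor-unit r) ≈-refl ⟩
      1# * (v r j ̄ * v r j)                ≈⟨ *-identityˡ _ ⟩
      v r j ̄ * v r j                       ∎
      where
      open ℂ-Reasoning
      c : ℂ
      c = rotation-factor r

    1/n : ℂ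
    1/n = ratC (1ℤ ℚ./ n)

    1/n-inverse : 1/n * ratC (natℚ n) ≈ 1#
    1/n-inverse = ≈-trans (≈-sym (ratC-* (1ℤ ℚ./ n) (natℚ n))) (ratC-cong (1/n*n≡1 n))

    -- The n entries share one squared modulus x, and n x is the squared norm, to which `d r` is
    -- inverse.
    normalised-modulus : ∀ r j → d r * (v r j ̄ * v r j) ≈ 1/n
    normalised-modulus r j = begin
      d r * (v r j ̄ * v r j)                 ≈⟨ *-cong ≈-refl (modulus-constant r j) ⟩
      d r * x                                ≈⟨ *-identityˡ (d r * x) ⟨
      1# * (d r * x)                         ≈⟨ *-cong 1/n-inverse ≈-refl ⟨
      1/n * ratC (natℚ n) * (d r * x)       ≈⟨ solve 4 (λ a n d x → a :* n :* (d :* x) := a :* (d :* (n :* x))) ≈-refl 1/n (ratC (natℚ n)) (d r) x ⟩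
      1/n * (d r * (ratC (natℚ n) * x))     ≈⟨ *-cong ≈-refl (*-cong ≈-refl (sum-constant n x)) ⟨
      1/n * (d r * ∑ {n} (λ _ → x))        ≈⟨ *-cong ≈-refl (*-cong ≈-refl (sum-cong-≋ (modulus-constant r))) ⟨
      1/n * (d r * ⟪ v r , v r ⟫)            ≈⟨ *-cong ≈-refl (d-inverse r) ⟩
      1/n * 1#                               ≈⟨ *-identityʳ 1/n ⟩
      1/n                                    ∎
      where
      open ℂ-Reasoning
      x : ℂ
      x = v r zero ̄ * v r zero

    E-modulus : ∀ r j k → E r j k * E r j k ̄ ≈ 1/n * 1/n
    E-modulus r j k = begin
      E r j k * E r j k ̄
        ≈⟨ *-cong ≈-refl (E-conj r j k) ⟩
      d r * (v r j * v r k ̄) * (d r * (v r k * v r j ̄))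
        ≈⟨ solve 5 (λ d x x̄ y ȳ → d :* (x :* ȳ) :* (d :* (y :* x̄)) := (d :* (x̄ :* x)) :* (d :* (ȳ :* y)))
             ≈-refl (d r) (v r j) (v r j ̄) (v r k) (v r k ̄) ⟩
      d r * (v r j ̄ * v r j) * (d r * (v r k ̄ * v r k))
        ≈⟨ *-cong (normalised-modulus r j) (normalised-modulus r k) ⟩
      1/n * 1/n ∎
      where open ℂ-Reasoning

    sum-E-modulus : ∀ j k → ∑ (λ r → E r j k * E r j k ̄) ≈ 1/n
    sum-E-modulus j k = begin
      ∑ (λ r → E r j k * E r j k ̄)     ≈⟨ sum-cong-≋ (λ r → E-modulus r j k) ⟩
      ∑ {n} (λ _ → 1/n * 1/n)          ≈⟨ sum-constant n (1/n * 1/n) ⟩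
      ratC (natℚ n) * (1/n * 1/n)       ≈⟨ solve 2 (λ n x → n :* (x :* x) := x :* n :* x) ≈-refl (ratC (natℚ n)) 1/n ⟩
      1/n * ratC (natℚ n) * 1/n         ≈⟨ *-cong 1/n-inverse ≈-refl ⟩
      1# * 1/n                           ≈⟨ *-identityˡ 1/n ⟩
      1/n                                ∎
      where open ℂ-Reasoning

    ratC-1/!-suc : ∀ k → ratC 1/[ suc k !] ≈ ratC (1/suc k) * ratC 1/[ k !]
    ratC-1/!-suc k = ≈-trans (ratC-cong (1/!-suc k)) (ratC-* (1/suc k) 1/[ k !])

    -- Induction on k by means of A Eᵣ = μᵣ Eᵣ; for k = 0 it is the resolution of the identity. The
    -- factorial is peeled off together with the power to match the recursion of `expTermᶜ`.
    exp-term-spectral : ∀ c k j l →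
      ratC 1/[ k !] * power (scaled c A) k j l ≈ ∑ (λ r → expTermᶜ (c * μ r) k * E r j l)
    exp-term-spectral c zero j l = ≈-trans (*-identityˡ (δ j l)) (≈-trans (≈-sym (completeness j l))
      (sum-cong-≋ (λ r → ≈-sym (*-identityˡ (E r j l)))))
    exp-term-spectral c (suc k) j l = begin
      ratC 1/[ suc k !] * ∑ (λ i → c * A j i * power (scaled c A) k i l)
        ≈⟨ *-distribˡ-sum (ratC 1/[ suc k !]) (λ i → c * A j i * power (scaled c A) k i l) ⟩
      ∑ (λ i → ratC 1/[ suc k !] * (c * A j i * power (scaled c A) k i l))
        ≈⟨ sum-cong-≋ (λ i → ≈-trans (*-cong (ratC-1/!-suc k) ≈-refl)
             (solve 5 (λ s f c a p → s :* f :* (c :* a :* p) := s :* c :* a :* (f :* p)) ≈-refl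
               s (ratC 1/[ k !]) c (A j i) (power (scaled c A) k i l))) ⟩
      ∑ (λ i → s * c * A j i * (ratC 1/[ k !] * power (scaled c A) k i l))
        ≈⟨ sum-cong-≋ (λ i → ≈-trans (*-cong ≈-refl (exp-term-spectral c k i l)) (*-distribˡ-sum (s * c * A j i) (λ r → t r * E r i l))) ⟩
      ∑ (λ i → ∑ (λ r → s * c * A j i * (t r * E r i l)))
        ≈⟨ ∑-comm (λ i r → s * c * A j i * (t r * E r i l)) ⟩
      ∑ (λ r → ∑ (λ i → s * c * A j i * (t r * E r i l)))
        ≈⟨ sum-cong-≋ (λ r → ≈-trans (sum-cong-≋ λ i →
             solve 5 (λ s c a t e → s :* c :* a :* (t :* e) := s :* c :* t :* (a :* e)) ≈-refl s c (A j i) (t r) (E r i l))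
             (≈-sym (*-distribˡ-sum (s * c * t r) (λ i → A j i * E r i l)))) ⟩
      ∑ (λ r → s * c * t r * ∑ (λ i → A j i * E r i l))
        ≈⟨ sum-cong-≋ (λ r → ≈-trans (*-cong ≈-refl (E-eigen r j l))
             (solve 5 (λ s c t m e → s :* c :* t :* (m :* e) := s :* (c :* m :* t) :* e) ≈-refl s c (t r) (μ r) (E r j l))) ⟩
      ∑ (λ r → expTermᶜ (c * μ r) (suc k) * E r j l) ∎
      where
      open ℂ-Reasoning
      s : ℂ
      s = ratC (1/suc k)
      t : Vector ℂ n
      t r = expTermᶜ (c * μ r) k

    exp-sum-spectral : ∀ c k j l →
      partialExp (scaled c A) k j l ≈ ∑ (λ r → E r j l * expSumᶜ (c * μ r) k)
    exp-sum-spectral c zero j l = ≈-sym (sum-zero _ (λ r → *-zeroʳ (E r j l)))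
    exp-sum-spectral c (suc k) j l = begin
      partialExp (scaled c A) k j l + ratC 1/[ k !] * power (scaled c A) k j l
        ≈⟨ +-cong (exp-sum-spectral c k j l) (exp-term-spectral c k j l) ⟩
      ∑ (λ r → E r j l * expSumᶜ (c * μ r) k) + ∑ (λ r → expTermᶜ (c * μ r) k * E r j l)
        ≈⟨ ∑-distrib-+ (λ r → E r j l * expSumᶜ (c * μ r) k) (λ r → expTermᶜ (c * μ r) k * E r j l) ⟨
      ∑ (λ r → E r j l * expSumᶜ (c * μ r) k + expTermᶜ (c * μ r) k * E r j l)
        ≈⟨ sum-cong-≋ (λ r → solve 3 (λ e s t → e :* s :+ t :* e := e :* (s :+ t)) ≈-refl
             (E r j l) (expSumᶜ (c * μ r) k) (expTermᶜ (c * μ r) k)) ⟩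
      ∑ (λ r → E r j l * expSumᶜ (c * μ r) (suc k)) ∎
      where open ℂ-Reasoning

    U : ℝ → Matrix n
    U t j l = ∑ (λ r → E r j l * wave (μ r) t)

    U-converges : ∀ t j l → (λ k → partialExp (scaled (- (𝕚 * ι t)) A) k j l) ⇝ U t j l
    U-converges t j l = ⇝-cong (λ k → ≈-sym (exp-sum-spectral (- (𝕚 * ι t)) k j l)) ≈-refl
      (⇝-sum (λ r → ⇝-* (E r j l) (exp-converges (- (𝕚 * ι t) * μ r))))

    wavePair-mean : ∀ r s → HasMean (wavePair (μ r) (μ s)) (δ r s)
    wavePair-mean r s with r Fin.≟ s
    ... | yes ≡.refl = mean-cong (λ 0≤t → ≈-sym (wave-unit (μ-real r) 0≤t)) ≈-refl mean-1
    -- The frequency is -i (μ r - μ s), with inverse i κ: here distinctness of the eigenvalues makes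
    -- the oscillating integrals bounded.
    ... | no  r≢s    = mean-exponential {κ = κ * 𝕚} κ𝕚-inverse (wavePair-exponential (μ-real s))
        (λ {t} 0≤t → ‖‖-*-≤ (wave-bound (μ-real r) 0≤t)
          (≤ʳ-trans (≤ʳ-reflexive (‖‖-conj (wave (μ s) t))) (wave-bound (μ-real s) 0≤t)))
      where
      open ℂ-Reasoning
      κ : ℂ
      κ = proj₁ (μ-distinct r s r≢s)
      κ𝕚-inverse : κ * 𝕚 * frequency (μ r - μ s) ≈ 1#
      κ𝕚-inverse = begin
        κ * 𝕚 * (- (𝕚 * (μ r - μ s)))   ≈⟨ solve 3 (λ k i m → k :* i :* (:- (i :* m)) := :- (i :* i) :* (k :* m)) ≈-refl κ 𝕚 (μ r - μ s) ⟩
        - (𝕚 * 𝕚) * (κ * (μ r - μ s))   ≈⟨ *-cong (neg-cong 𝕚*𝕚≈-1) (proj₂ (μ-distinct r s r≢s)) ⟩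
        - - 1# * 1#                     ≈⟨ solve 0 (:- (:- con 1ℚ) :* con 1ℚ := con 1ℚ) ≈-refl ⟩
        1#                              ∎

    mixing-spectral : ∀ t j l → U t j l * U t j l ̄ ≈
      ∑ (λ r → ∑ (λ s → E r j l * E s j l ̄ * wavePair (μ r) (μ s) t))
    mixing-spectral t j l = begin
      U t j l * U t j l ̄
        ≈⟨ *-distribʳ-sum (U t j l ̄) (λ r → E r j l * wave (μ r) t) ⟩
      ∑ (λ r → E r j l * wave (μ r) t * U t j l ̄)
        ≈⟨ sum-cong-≋ (λ r → *-cong (≈-refl {E r j l * wave (μ r) t}) (sum-conj (λ s → E s j l * wave (μ s) t))) ⟩
      ∑ (λ r → E r j l * wave (μ r) t * ∑ (λ s → (E s j l * wave (μ s) t) ̄))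
        ≈⟨ sum-cong-≋ (λ r → *-distribˡ-sum (E r j l * wave (μ r) t) (λ s → (E s j l * wave (μ s) t) ̄)) ⟩
      ∑ (λ r → ∑ (λ s → E r j l * wave (μ r) t * (E s j l * wave (μ s) t) ̄))
        ≈⟨ sum-cong-≋ (λ r → sum-cong-≋ λ s → ≈-trans (*-cong ≈-refl (conj-* (E s j l) (wave (μ s) t)))
             (solve 4 (λ a b c d → a :* b :* (c :* d) := a :* c :* (b :* d)) ≈-refl
               (E r j l) (wave (μ r) t) (E s j l ̄) (wave (μ s) t ̄))) ⟩
      ∑ (λ r → ∑ (λ s → E r j l * E s j l ̄ * wavePair (μ r) (μ s) t)) ∎
      where open ℂ-Reasoning

    mixing-mean : ∀ j l → HasMean (λ t → U t j l * U t j l ̄) 1/n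
    mixing-mean j l = mean-cong (λ {t} _ → ≈-sym (mixing-spectral t j l)) mean≈1/n
      (mean-sum (λ r → mean-sum (λ s → mean-scale (E r j l * E s j l ̄) (wavePair-mean r s))))
      where
      open ℂ-Reasoning
      mean≈1/n : ∑ (λ r → ∑ (λ s → E r j l * E s j l ̄ * δ r s)) ≈ 1/n
      mean≈1/n = begin
        ∑ (λ r → ∑ (λ s → E r j l * E s j l ̄ * δ r s))
          ≈⟨ sum-cong-≋ (λ r → sum-cong-≋ λ s → *-comm (E r j l * E s j l ̄) (δ r s)) ⟩
        ∑ (λ r → ∑ (λ s → δ r s * (E r j l * E s j l ̄)))
          ≈⟨ sum-cong-≋ (λ r → sum-δ r (λ s → E r j l * E s j l ̄)) ⟩
        ∑ (λ r → E r j l * E r j l ̄)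
          ≈⟨ sum-E-modulus j l ⟩
        1/n ∎

  -- From the hypotheses of the statement to the algebraic setting, and back.

  opaque
    unfolding _≈_ _≈ʳ_

    ≈ᶜ⇒≈ : ∀ {z w} → z ≈ᶜ w → z ≈ w
    ≈ᶜ⇒≈ h = h

    eigen-equation : ∀ {n} (A : Matrix n) (w : Vector ℂ n) α → (∀ j → (A *ᵛ w) j ≈ᶜ α *ᶜ w j) →
                     ∀ j → ∑ (λ k → A j k * w k) ≈ α * w j
    eigen-equation A w α h = h

    hermitian-≈ : ∀ {n} (A : Matrix n) → IsHermitian A → ∀ j k → A j k ≈ A k j ̄
    hermitian-≈ A h = h

    -- The inverse is the conjugate divided by the squared modulus, whose positivity is exactly what
    -- `_#_` asserts.
    apart⇒invertible : ∀ z w → z # w → ∃[ κ ] κ * (z - w) ≈ 1#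
    apart⇒invertible z w z#w = ι (inverse s z#w) * (z - w) ̄ , apart-inverse
      where
      s : ℝ
      s = normSqʳ (z - w)
      apart-inverse : ι (inverse s z#w) * (z - w) ̄ * (z - w) ≈ 1#
      apart-inverse = ≈-trans {ι (inverse s z#w) * (z - w) ̄ * (z - w)} {ι (inverse s z#w) * ((z - w) ̄ * (z - w))} {1#}
        (*-assoc (ι (inverse s z#w)) ((z - w) ̄) (z - w))
        (≈-trans {ι (inverse s z#w) * ((z - w) ̄ * (z - w))} {ι (inverse s z#w) * ι s} {1#}
          (*-cong {ι (inverse s z#w)} {ι (inverse s z#w)} {(z - w) ̄ * (z - w)} {ι s} (≈-refl {ι (inverse s z#w)}) (conj*self (z - w)))
          (≈-trans {ι (inverse s z#w) * ι s} {ι (inverse s z#w *ʳ s)} {1#}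
            (≈-sym {ι (inverse s z#w *ʳ s)} {ι (inverse s z#w) * ι s} (ι-* (inverse s z#w) s))
            (ι-cong {inverse s z#w *ʳ s} {1ʳ} (inverse-inverseˡ s z#w))))

    apart-0⇒lower : ∀ z → z # 0ᶜ → ∃[ q ] 0ℚ ℚ.< q × ⌊ q ⌋ ≤ʳ normSqʳ (z - 0#)
    apart-0⇒lower z z#0 = 0<⇒lower {normSqʳ (z - 0#)} z#0

    lower⇒positive : ∀ {q x} → 0ℚ ℚ.< q → ⌊ q ⌋ ≤ʳ x → 0ᴿ <ᴿ x
    lower⇒positive {q} {x} 0<q q≤x = <ᴿ-between {0ᴿ} {x} 0<q (≤ʳ-refl {0ʳ}) q≤x

    -- After unfolding, the two recursions agree except in the base case, where `𝟙` and `δ` each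
    -- decide `j Fin.≟ l` on their own.
    power-≡ : ∀ {n} (B : Matrix n) k j l → (B ^ᴹ k) j l ≡ power B k j l
    power-≡ B zero j l with j Fin.≟ l
    ... | yes _ = ≡.refl
    ... | no  _ = ≡.refl
    power-≡ B (suc k) j l = sum-cong-≗ (λ i → ≡.cong (B j i *_) (power-≡ B k i l))

    partialExp-≡ : ∀ {n} (B : Matrix n) k j l → expPartialSum B k j l ≡ partialExp B k j l
    partialExp-≡ B zero    j l = ≡.refl
    partialExp-≡ B (suc k) j l = ≡.cong₂ (λ z w → z + ratC 1/[ k !] * w) (partialExp-≡ B k j l) (power-≡ B k j l)

    ⇝⇒⟶ : ∀ {u L} → u ⇝ L → u ⟶ L
    ⇝⇒⟶ {u} {L} h ε 0<ε =
      let (q , 0<q , q≤ε) = 0<⇒lower {ε} 0<ε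
      in eventually-map (λ k → within-from-norm {ε} {q} {u k} {L} 0<q q≤ε) (h (½ ℚ.* q) (½-pos 0<q))

  expPartialSum-⇝ : ∀ {n} (B : Matrix n) {L} j l → (λ k → partialExp B k j l) ⇝ L → (λ k → expPartialSum B k j l) ⇝ L
  expPartialSum-⇝ B {L} j l h ε 0<ε = eventually-map
    (λ k → ≡.subst (λ z → ‖ z - L ‖ ≤ʳ ⌊ ε ⌋) (≡.sym (partialExp-≡ B k j l))) (h ε 0<ε)

  opaque
    unfolding _≈_ _≈ʳ_

    transition-from-⇝ : ∀ {n} (X : Graph n) t (V : Matrix n) →
      (∀ j l → (λ k → partialExp (scaled (- (𝕚 * ι t)) (adjacency X)) k j l) ⇝ V j l) → IsTransitionMatrix X t V
    transition-from-⇝ {n} X t V h j l = ⇝⇒⟶ {λ k → expPartialSum B k j l} {V j l} (expPartialSum-⇝ B {V j l} j l (h j l))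
      where
      B : Matrix n
      B = (-ᶜ (iᶜ *ᶜ fromℝ t)) •ᴹ adjacency X

    -- The factor `1#` is the entry of `J`; with it the mean unfolds to the entry of the target
    -- matrix.
    average-mixing-from-mean : ∀ {n} .{{_ : ℕ.NonZero n}} (X : Graph n) (V : ℝ → Matrix n) →
      (∀ t → IsTransitionMatrix X t (V t)) →
      (∀ j l → HasMean (λ t → V t j l * V t j l ̄) (ratC (1ℤ ℚ./ n) * 1#)) → HasAverageUniformMixing X
    average-mixing-from-mean X V h m = V , h , λ j l → mean⇒time-average (m j l)

  -- One entry apart from 0 keeps the squared norm above a positive rational. The inner product is
  -- its own conjugate, so inverting its real part suffices.
  norm-invertible : ∀ {n} (w : Vector ℂ n) → ∃[ j ] w j # 0ᶜ → ∃[ d ] d * ⟪ w , w ⟫ ≈ 1#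
  norm-invertible w (j , wj#0) =
    let (q , 0<q , q≤) = apart-0⇒lower (w j) wj#0
        0<D = lower⇒positive 0<q (begin
          ⌊ q ⌋                 ≤⟨ q≤ ⟩
          normSqʳ (w j - 0#)    ≈⟨ normSqʳ-cong (solve 1 (λ z → z :- con 0ℚ := z) ≈-refl (w j)) ⟩
          normSqʳ (w j)         ≈⟨ re-conj*self (w j) ⟨
          re (w j ̄ * w j)       ≤⟨ re-term≤re-sum (λ j → w j ̄ * w j) (λ j → conj*self-nonneg (w j)) j ⟩
          re ⟪ w , w ⟫          ∎)
        D = re ⟪ w , w ⟫
    in ι (inverse D 0<D) ,
       ≈-trans (*-cong ≈-refl (self-conj⇒real (inner-conj w w)))
         (≈-trans (≈-sym (ι-* (inverse D 0<D) D)) (ι-cong (inverse-inverseˡ D 0<D)))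
    where open ℝ-Reasoning

open SpectralTheory

theorem5 : (n : ℕ) .{{_ : NonZero n}} (X : Graph n) →
    IsCirculant (adjacency X) →
    HasDistinctEigenvalues (adjacency X) →
    HasAverageUniformMixing X
theorem5 (suc m) X circulant (μ , eigenvalue , distinct) =
  average-mixing-from-mean X U (λ t → transition-from-⇝ X t (U t) (U-converges t))
    (λ j l → mean-cong (λ _ → ≈-refl) (≈-sym (*-identityʳ 1/n)) (mixing-mean j l))
  where
  A : Matrix (suc m)
  A = adjacency X
  v : Fin (suc m) → Vector ℂ (suc m)
  v r = proj₁ (eigenvalue r)
  inverse-norm : ∀ r → ∃[ d ] d * ⟪ v r , v r ⟫ ≈ 1#
  inverse-norm r = norm-invertible (v r) (proj₁ (proj₂ (eigenvalue r)))
  open CirculantEigenbasis A (hermitian-≈ A (hermitian X))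
    (λ j k → ≈ᶜ⇒≈ (circulant (rotate j) (rotate k) j k (rotate-difference j k)))
    μ v (λ r → eigen-equation A (v r) (μ r) (proj₂ (proj₂ (eigenvalue r))))
    (λ r → proj₁ (inverse-norm r)) (λ r → proj₂ (inverse-norm r))
    (λ r s r≢s → apart⇒invertible (μ r) (μ s) (distinct r s r≢s))
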